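{- In the random order model, there exists a $(1-1/e)$-competitive online probing algorithm for the online stochastic matching problem with known i.d. instances. That is, there is an online probing algorithm such that for every known i.d. input $(H_{\mathrm{typ}},(\mathcal{D}_i)_{i=1}^n)$ with downward-closed probing constraints, when the online vertices arrive in uniformly random order, its output matching $\mathcal{M}$ satisfies $\mathbb{E}[w(\mathcal{M})]\ge\left(1-\frac1e\right)\mathrm{OPT}(H_{\mathrm{typ}},(\mathcal{D}_i)_{i=1}^n)$.
   Context: Known i.d. input: a type graph $H_{\mathrm{typ}}=(U,B,F)$ with finite $U$ and $B$, $F=U\times B$, weights $w_f\ge0$, probabilities $p_f\in[0,1]$, and for each $b\in B$ a probing constraint $\mathcal{C}_b$, which is a set of strings with distinct entries from $\partial(b)$ (the edges containing $b$), containing the empty string and downward-closed (closed under substrings and permutations); together with distributions $\mathcal{D}_1,\dots,\mathcal{D}_n$ on $B$. $G\sim(H_{\mathrm{typ}},(\mathcal{D}_i)_i)$: draw $v_i\sim\mathcal{D}_i$ independently; $G=(U,V,U\times V)$ with $V$ the multiset $\{v_1,\dots,v_n\}$ (arrivals are distinct vertices even if of equal type), each $v_i$ inheriting the weights, probabilities and constraint of its type. Each edge $e$ of $G$ is active independently with probability $p_e$. Online probing algorithm: knows the input $(H_{\mathrm{typ}},(\mathcal{D}_i)_i)$ in advance. Vertices arrive in order $v_{\pi(1)},\dots,v_{\pi(n)}$, where $\pi$ is a uniformly random permutation of $[n]$ independent of all other randomness. When $v_{\pi(t)}$ arrives the algorithm learns its type and the index $\pi(t)$ of its distribution; it may then adaptively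 (and with randomization) probe edges of $\partial(v_{\pi(t)})$, each probe revealing whether the edge is active, the sequence of probes lying in the constraint of $v_{\pi(t)}$. When a probed edge is active, it must irrevocably decide whether to include it in its matching before any further probe, and all decisions for $v_{\pi(t)}$ are made before the next arrival. It outputs a matching $\mathcal{M}$ of probed active edges, with weight $w(\mathcal{M})=\sum_{e\in\mathcal{M}}w_e$; the expectation is over all randomness including $G$ and $\pi$. Benchmark: an offline probing algorithm knows $G$ but not the edge states, and may adaptively probe edges in any order (interleaving vertices), subject to the sequence of probes at each $v$ lying in its constraint and to the same commitment rule, returning a matching of probed active edges; $\mathrm{OPT}(G)$ is the maximum expected weight achievable, and $\mathrm{OPT}(H_{\mathrm{typ}},(\mathcal{D}_i)_i)=\mathbb{E}[\mathrm{OPT}(G)]$ over $G\sim(H_{\mathrm{typ}},(\mathcal{D}_i)_i)$. -}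

module Defs where

open import Algebra.Bundles using (CommutativeRing)
import Algebra.Properties.Ring as RingProperties
import Algebra.Properties.Semiring.Mult as Mult
import Algebra.Properties.Semiring.Sum as Sum
open import Data.Bool.Base using (Bool; true; false; if_then_else_)
open import Data.Empty using (⊥-elim)
open import Data.Fin.Base using (Fin; zero; suc)
import Data.Fin.Properties as Fin
open import Data.List.Base as List using (List; []; _∷_; _++_; _∷ʳ_; length; concatMap; allFin)
import Data.List.Extrema as Extrema
open import Data.List.Membership.Propositional using (lose)
open import Data.List.Membership.Propositional.Properties using (∈-allFin; ∈-lookup)
import Data.List.Properties as List
open import Data.List.Relation.Binary.Permutation.Propositional using (_↭_)
import Data.List.Relation.Unary.All as All
open import Data.List.Relation.Unary.Any using (Any; here)
import Data.List.Relation.Unary.Any.Properties as Any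
import Data.List.Relation.Unary.AllPairs as AllPairs
open import Data.List.Relation.Unary.Unique.Propositional using (Unique)
open import Data.Maybe.Base using (Maybe; just; nothing; maybe)
import Data.Maybe.Properties as Maybe
open import Data.Nat.Base as ℕ using (ℕ; zero; suc; _∸_; _!)
import Data.Nat.Properties as ℕ
open import Data.Product.Base using (∃; _×_; _,_; proj₁; proj₂)
open import Data.Sum.Base using (inj₁; inj₂)
open import Data.Vec.Base as Vec using (Vec; []; _∷_; lookup; _[_]≔_; replicate)
open import Data.Vec.Relation.Unary.AllPairs using (allPairs?)
open import Function.Base using (_∘_)
open import Level using (0ℓ)
open import Relation.Binary.Bundles using (DecTotalOrder)
open import Relation.Binary.Core using (Rel)
open import Relation.Binary.PropositionalEquality as ≡ using (_≡_; _≢_)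
import Relation.Binary.Reasoning.Setoid as SetoidReasoning
open import Relation.Binary.Structures using (IsDecTotalOrder)
open import Relation.Nullary using (¬_; Dec; yes; no; does; ¬?; _×-dec_)
open import Relation.Unary using (Pred; Decidable)

-- The real numbers, given axiomatically as a Dedekind-complete ordered field;
-- these axioms determine ℝ up to unique isomorphism.  Decidability of the
-- order and the existence of all suprema hold classically (given excluded
-- middle); nothing below assumes any other classical principle.
record Reals : Set₁ where
  field
    commutativeRing : CommutativeRing 0ℓ 0ℓ

  open CommutativeRing commutativeRing public
    using (Carrier; _≈_; _+_; _*_; -_; _-_; 0# ; 1#)

  infix  4 _≤_
  infix  8 _⁻¹
  field
    _≤_             : Rel Carrier 0ℓ
    isDecTotalOrder : IsDecTotalOrder _≈_ _≤_
    +-monoʳ-≤       : ∀ x {y z} → y ≤ z → x + y ≤ x + z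
    *-nonneg        : ∀ {x y} → 0# ≤ x → 0# ≤ y → 0# ≤ x * y
    0≉1             : ¬ 0# ≈ 1#
    -- total for convenience: the value of 0# ⁻¹ is unconstrained
    _⁻¹             : Carrier → Carrier
    *-inverseʳ      : ∀ {x} → ¬ x ≈ 0# → x * x ⁻¹ ≈ 1#

  IsUpperBound : Pred Carrier 0ℓ → Pred Carrier 0ℓ
  IsUpperBound P b = ∀ x → P x → x ≤ b

  IsSupremum : Pred Carrier 0ℓ → Pred Carrier 0ℓ
  IsSupremum P s = IsUpperBound P s × (∀ b → IsUpperBound P b → s ≤ b)

  IsMaximum : Pred Carrier 0ℓ → Pred Carrier 0ℓ
  IsMaximum P x = P x × IsUpperBound P x

  field
    complete : ∀ P → ∃ P → ∃ (IsUpperBound P) → ∃ (IsSupremum P)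

  decTotalOrder : DecTotalOrder 0ℓ 0ℓ 0ℓ
  decTotalOrder = record { isDecTotalOrder = isDecTotalOrder }

module RealNumbers (ℝ : Reals) where

  open Reals ℝ public
  open CommutativeRing commutativeRing
    hiding (Carrier; _≈_; _+_; _*_; -_; _-_; 0#; 1#; zero; _≉_)
  open DecTotalOrder decTotalOrder
    using (total; antisym; totalOrder)
    renaming (refl to ≤-refl; trans to ≤-trans; reflexive to ≤-reflexive)
  open RingProperties ring using (-‿involutive; -‿distribˡ-*)
  open Mult semiring using (×1-homo-*) renaming (_×_ to _·_)
  open Sum semiring public using (sum)
  open SetoidReasoning setoid

  fromℕ : ℕ → Carrier
  fromℕ n = n · 1#

  ≤-resp-≈ : ∀ {x x′ y y′} → x ≈ x′ → y ≈ y′ → x ≤ y → x′ ≤ y′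
  ≤-resp-≈ p q x≤y = ≤-trans (≤-reflexive (sym p)) (≤-trans x≤y (≤-reflexive q))

  +-mono-≤ : ∀ {x x′ y y′} → x ≤ x′ → y ≤ y′ → x + y ≤ x′ + y′
  +-mono-≤ {x} {x′} {y} {y′} p q =
    ≤-trans (+-monoʳ-≤ x q) (≤-resp-≈ (+-comm y′ x) (+-comm y′ x′) (+-monoʳ-≤ y′ p))

  x≤y⇒0≤y-x : ∀ {x y} → x ≤ y → 0# ≤ y - x
  x≤y⇒0≤y-x {x} {y} p = ≤-resp-≈ (-‿inverseˡ x) (+-comm (- x) y) (+-monoʳ-≤ (- x) p)

  0≤y-x⇒x≤y : ∀ {x y} → 0# ≤ y - x → x ≤ y
  0≤y-x⇒x≤y {x} {y} p = ≤-resp-≈ (+-identityʳ x) eq (+-monoʳ-≤ x p)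
    where
    eq : x + (y - x) ≈ y
    eq = begin
      x + (y - x)   ≈⟨ +-congˡ (+-comm y (- x)) ⟩
      x + (- x + y) ≈⟨ +-assoc x (- x) y ⟨
      x - x + y     ≈⟨ +-congʳ (-‿inverseʳ x) ⟩
      0# + y        ≈⟨ +-identityˡ y ⟩
      y             ∎

  *-monoˡ-≤ : ∀ {x y z} → 0# ≤ x → y ≤ z → x * y ≤ x * z
  *-monoˡ-≤ {x} {y} {z} 0≤x y≤z = 0≤y-x⇒x≤y (≤-resp-≈ refl eq (*-nonneg 0≤x (x≤y⇒0≤y-x y≤z)))
    where
    open RingProperties ring using (-‿distribʳ-*)
    eq : x * (z - y) ≈ x * z - x * y
    eq = trans (distribˡ x z (- y)) (+-congˡ (sym (-‿distribʳ-* x y)))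

  x≤0⇒0≤-x : ∀ {x} → x ≤ 0# → 0# ≤ - x
  x≤0⇒0≤-x {x} p = ≤-resp-≈ refl (+-identityˡ (- x)) (x≤y⇒0≤y-x p)

  0≤1 : 0# ≤ 1#
  0≤1 with total 0# 1#
  ... | inj₁ p = p
  ... | inj₂ p = ≤-resp-≈ refl eq (*-nonneg (x≤0⇒0≤-x p) (x≤0⇒0≤-x p))
    where
    eq : - 1# * - 1# ≈ 1#
    eq = begin
      - 1# * - 1#   ≈⟨ -‿distribˡ-* 1# (- 1#) ⟨
      - (1# * - 1#) ≈⟨ -‿cong (*-identityˡ (- 1#)) ⟩
      - - 1#        ≈⟨ -‿involutive 1# ⟩
      1#            ∎

  x≤x+y : ∀ {x y} → 0# ≤ y → x ≤ x + y
  x≤x+y {x} p = ≤-resp-≈ (+-identityʳ x) refl (+-monoʳ-≤ x p)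

  0≤fromℕ : ∀ n → 0# ≤ fromℕ n
  0≤fromℕ zero    = ≤-refl
  0≤fromℕ (suc n) = ≤-trans 0≤1 (x≤x+y (0≤fromℕ n))

  1≤fromℕ : ∀ n → .{{ℕ.NonZero n}} → 1# ≤ fromℕ n
  1≤fromℕ (suc n) = x≤x+y (0≤fromℕ n)

  1≤x⇒x≉0 : ∀ {x} → 1# ≤ x → ¬ x ≈ 0#
  1≤x⇒x≉0 p x≈0 = 0≉1 (antisym 0≤1 (≤-trans p (≤-reflexive x≈0)))

  1≤x⇒0≤x⁻¹ : ∀ {x} → 1# ≤ x → 0# ≤ x ⁻¹
  1≤x⇒0≤x⁻¹ {x} 1≤x with total 0# (x ⁻¹)
  ... | inj₁ p = p
  ... | inj₂ p = ⊥-elim (0≉1 (antisym 0≤1 (≤-resp-≈ (*-inverseʳ (1≤x⇒x≉0 1≤x)) (zeroʳ x)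
                   (*-monoˡ-≤ (≤-trans 0≤1 1≤x) p))))

  1/! : ℕ → Carrier
  1/! k = fromℕ (k !) ⁻¹

  expSum : ℕ → Carrier
  expSum zero    = 0#
  expSum (suc k) = expSum k + 1/! k

  IsExpSum : Pred Carrier 0ℓ
  IsExpSum x = ∃ λ k → x ≈ expSum k

  private
    1≤! : ∀ k → 1# ≤ fromℕ (k !)
    1≤! k = 1≤fromℕ (k !) {{ℕ._!≢0 k}}

    0≤1/! : ∀ k → 0# ≤ 1/! k
    0≤1/! k = 1≤x⇒0≤x⁻¹ (1≤! k)

    1/!-step : ∀ k → fromℕ (suc k) * 1/! (suc k) ≈ 1/! k
    1/!-step k = begin
      N * b                 ≈⟨ *-identityʳ (N * b) ⟨
      N * b * 1#            ≈⟨ *-congˡ (*-inverseʳ (1≤x⇒x≉0 (1≤! k))) ⟨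
      N * b * (F * F ⁻¹)    ≈⟨ *-assoc (N * b) F (F ⁻¹) ⟨
      N * b * F * F ⁻¹      ≈⟨ *-congʳ (*-assoc N b F) ⟩
      N * (b * F) * F ⁻¹    ≈⟨ *-congʳ (*-congˡ (*-comm b F)) ⟩
      N * (F * b) * F ⁻¹    ≈⟨ *-congʳ (*-assoc N F b) ⟨
      N * F * b * F ⁻¹      ≈⟨ *-congʳ (*-congʳ (×1-homo-* (suc k) (k !))) ⟨
      fromℕ (suc k !) * b * F ⁻¹ ≈⟨ *-congʳ (*-inverseʳ (1≤x⇒x≉0 (1≤! (suc k)))) ⟩
      1# * F ⁻¹             ≈⟨ *-identityˡ (F ⁻¹) ⟩
      F ⁻¹                  ∎
      where
      N = fromℕ (suc k)
      F = fromℕ (k !)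
      b = 1/! (suc k)

    1/!-halves : ∀ k → 1/! (2 ℕ.+ k) + 1/! (2 ℕ.+ k) ≤ 1/! (suc k)
    1/!-halves k = ≤-resp-≈ refl (1/!-step (suc k))
      (≤-resp-≈ refl (sym eq) (+-monoʳ-≤ b (x≤x+y (*-nonneg (0≤fromℕ k) (0≤1/! (2 ℕ.+ k))))))
      where
      b = 1/! (2 ℕ.+ k)
      eq : fromℕ (2 ℕ.+ k) * b ≈ b + (b + fromℕ k * b)
      eq = begin
        (1# + (1# + fromℕ k)) * b           ≈⟨ distribʳ b 1# _ ⟩
        1# * b + (1# + fromℕ k) * b         ≈⟨ +-cong (*-identityˡ b) (distribʳ b 1# _) ⟩
        b + (1# * b + fromℕ k * b)          ≈⟨ +-congˡ (+-congʳ (*-identityˡ b)) ⟩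
        b + (b + fromℕ k * b)               ∎

    bound : Carrier
    bound = expSum 1 + (1/! 1 + 1/! 1)

    expSum+2/!≤bound : ∀ k → expSum (suc k) + (1/! (suc k) + 1/! (suc k)) ≤ bound
    expSum+2/!≤bound zero    = ≤-refl
    expSum+2/!≤bound (suc k) = ≤-trans
      (≤-trans (+-monoʳ-≤ (expSum (2 ℕ.+ k)) (1/!-halves k))
               (≤-reflexive (+-assoc (expSum (suc k)) (1/! (suc k)) (1/! (suc k)))))
      (expSum+2/!≤bound k)

    expSum≤bound : ∀ k → expSum k ≤ bound
    expSum≤bound zero    = ≤-trans (x≤x+y (0≤1/! 0)) (expSum≤bound 1)
    expSum≤bound (suc k) = ≤-trans
      (x≤x+y (≤-trans (0≤1/! (suc k)) (x≤x+y (0≤1/! (suc k))))) (expSum+2/!≤bound k)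

  -- e = Σₖ 1/k!, the supremum of the partial sums since the terms are
  -- nonnegative.
  abstract
    e-exists : ∃ (IsSupremum IsExpSum)
    e-exists = complete IsExpSum (0# , 0 , refl)
      (bound , λ { x (k , x≈) → ≤-trans (≤-reflexive x≈) (expSum≤bound k) })

  e : Carrier
  e = proj₁ e-exists

  Probability : Set
  Probability = ∃ λ q → 0# ≤ q × q ≤ 1#

  -- Finitely supported laws on A are given by their expectation functionals.
  Functional : Set → Set
  Functional A = (A → Carrier) → Carrier

  bernoulli : Probability → Functional Bool
  bernoulli (q , _) f = q * f true + (1# - q) * f false

  -- The product law, as an iterated integral.
  independent : ∀ {A n} → (Fin n → Functional A) → Functional (Vec A n)
  independent {n = zero}  E f = f []
  independent {n = suc n} E f = E zero λ a → independent (E ∘ suc) λ v → f (a ∷ v)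

  record Distribution (n : ℕ) : Set where
    field
      mass        : Fin n → Carrier
      mass-nonneg : ∀ b → 0# ≤ mass b
      mass-total  : sum mass ≈ 1#

    expectation : Functional (Fin n)
    expectation f = sum λ b → mass b * f b

  -- A permutation π of [n] is the vector π(1), …, π(n) of its values: a
  -- repetition-free vector of length n over Fin n.
  uniformPermutation : ∀ n → Functional (Vec (Fin n) n)
  uniformPermutation n f =
    fromℕ (n !) ⁻¹ * independent (λ _ → sum)
      λ π → if does (allPairs? (λ i j → ¬? (i Fin.≟ j)) π) then f π else 0#

  record Linear {A : Set} (E : Functional A) : Set where
    field
      cong  : ∀ {f g} → (∀ a → f a ≈ g a) → E f ≈ E g
      add   : ∀ f g → E (λ a → f a + g a) ≈ E f + E g
      scale : ∀ c f → E (λ a → c * f a) ≈ c * E f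

  +-interchange : ∀ a b c d → (a + b) + (c + d) ≈ (a + c) + (b + d)
  +-interchange a b c d = begin
    (a + b) + (c + d) ≈⟨ +-assoc a b (c + d) ⟩
    a + (b + (c + d)) ≈⟨ +-congˡ (+-assoc b c d) ⟨
    a + ((b + c) + d) ≈⟨ +-congˡ (+-congʳ (+-comm b c)) ⟩
    a + ((c + b) + d) ≈⟨ +-congˡ (+-assoc c b d) ⟩
    a + (c + (b + d)) ≈⟨ +-assoc a c (b + d) ⟨
    (a + c) + (b + d) ∎

  *-swap : ∀ a b c → a * (b * c) ≈ b * (a * c)
  *-swap a b c = begin
    a * (b * c) ≈⟨ *-assoc a b c ⟨
    a * b * c   ≈⟨ *-congʳ (*-comm a b) ⟩
    b * a * c   ≈⟨ *-assoc b a c ⟩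
    b * (a * c) ∎

  bernoulli-linear : ∀ p → Linear (bernoulli p)
  bernoulli-linear (q , _) = record
    { cong  = λ f≈g → +-cong (*-congˡ (f≈g true)) (*-congˡ (f≈g false))
    ; add   = λ f g → trans (+-cong (distribˡ q _ _) (distribˡ (1# - q) _ _)) (+-interchange _ _ _ _)
    ; scale = λ c f → trans (+-cong (*-swap q c _) (*-swap (1# - q) c _)) (sym (distribˡ c _ _))
    }

  independent-linear : ∀ {A n} (E : Fin n → Functional A) →
                       (∀ i → Linear (E i)) → Linear (independent E)
  independent-linear {n = zero} E lin = record
    { cong = λ f≈g → f≈g [] ; add = λ _ _ → refl ; scale = λ _ _ → refl }
  independent-linear {n = suc n} E lin = record
    { cong  = λ f≈g → E₀.cong λ a → Eₛ.cong λ v → f≈g (a ∷ v)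
    ; add   = λ f g → trans (E₀.cong λ a → Eₛ.add _ _) (E₀.add _ _)
    ; scale = λ c f → trans (E₀.cong λ a → Eₛ.scale c _) (E₀.scale c _)
    }
    where
    module E₀ = Linear (lin zero)
    module Eₛ = Linear (independent-linear (E ∘ suc) (lin ∘ suc))

  convex≤ : ∀ ((q , _) : Probability) {x y z} → x ≤ z → y ≤ z → q * x + (1# - q) * y ≤ z
  convex≤ (q , 0≤q , q≤1) {z = z} x≤z y≤z = ≤-resp-≈ refl eq
    (+-mono-≤ (*-monoˡ-≤ 0≤q x≤z) (*-monoˡ-≤ (x≤y⇒0≤y-x q≤1) y≤z))
    where
    eq : q * z + (1# - q) * z ≈ z
    eq = begin
      q * z + (1# - q) * z  ≈⟨ distribʳ z q (1# - q) ⟨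
      (q + (1# - q)) * z    ≈⟨ *-congʳ (+-comm q (1# - q)) ⟩
      ((1# - q) + q) * z    ≈⟨ *-congʳ (+-assoc 1# (- q) q) ⟩
      (1# + (- q + q)) * z  ≈⟨ *-congʳ (+-congˡ (-‿inverseˡ q)) ⟩
      (1# + 0#) * z         ≈⟨ *-congʳ (+-identityʳ 1#) ⟩
      1# * z                ≈⟨ *-identityˡ z ⟩
      z                     ∎

module Matching (ℝ : Reals) where

  open RealNumbers ℝ
  open CommutativeRing commutativeRing
    using (refl; sym; trans; +-cong; +-identityˡ; +-identityʳ)
  open DecTotalOrder decTotalOrder
    using (totalOrder) renaming (refl to ≤-refl; trans to ≤-trans; reflexive to ≤-reflexive)

  -- A bipartite stochastic graph with offline vertices Fin m, vertices
  -- Fin n carrying probing constraints, and all m × n edges.  The strings of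
  -- edges of ∂(v) are written as strings of offline vertices, u standing for
  -- the edge (u , v).  Both the type graph (Fin n the set of types) and the
  -- realized graph (Fin n the set of arrivals) are of this form.
  record StochasticGraph (m n : ℕ) : Set₁ where
    field
      w             : Fin m → Fin n → Carrier
      w-nonneg      : ∀ u v → 0# ≤ w u v
      p             : Fin m → Fin n → Probability
      C             : Fin n → Pred (List (Fin m)) 0ℓ
      C?            : ∀ v → Decidable (C v)
      C-distinct    : ∀ {v s} → C v s → Unique s
      C-empty       : ∀ v → C v []
      C-substring   : ∀ {v} xs {ys} zs → C v (xs ++ ys ++ zs) → C v ys
      C-permutation : ∀ {v s t} → s ↭ t → C v s → C v t

  instantiate : ∀ {m k n} → StochasticGraph m k → Vec (Fin k) n → StochasticGraph m n
  instantiate H τ = record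
    { w             = λ u i → w u (lookup τ i)
    ; w-nonneg      = λ u i → w-nonneg u (lookup τ i)
    ; p             = λ u i → p u (lookup τ i)
    ; C             = λ i → C (lookup τ i)
    ; C?            = λ i → C? (lookup τ i)
    ; C-distinct    = C-distinct
    ; C-empty       = λ i → C-empty (lookup τ i)
    ; C-substring   = C-substring
    ; C-permutation = C-permutation
    }
    where open StochasticGraph H

  -- The partner of each offline vertex, if any.  That no v is the partner of
  -- two offline vertices is maintained by only adding edges that are Free.
  PartialMatching : ℕ → ℕ → Set
  PartialMatching m n = Vec (Maybe (Fin n)) m

  emptyMatching : ∀ {m n} → PartialMatching m n
  emptyMatching = replicate _ nothing

  Free : ∀ {m n} → PartialMatching m n → Fin m → Fin n → Set
  Free M u v = lookup M u ≡ nothing × (∀ u′ → lookup M u′ ≢ just v)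

  weight : ∀ {m n} → StochasticGraph m n → PartialMatching m n → Carrier
  weight G M = sum λ u → maybe (StochasticGraph.w G u) 0# (lookup M u)

  EdgeStates : ℕ → ℕ → Set
  EdgeStates m n = Vec (Vec Bool n) m

  active : ∀ {m n} → EdgeStates m n → Fin m → Fin n → Bool
  active st u v = lookup (lookup st u) v

  edgeStates : ∀ {m n} → StochasticGraph m n → Functional (EdgeStates m n)
  edgeStates G = independent λ u → independent λ v → bernoulli (StochasticGraph.p G u v)

  module _ {m n : ℕ} (G : StochasticGraph m n) where

    open StochasticGraph G

    -- An adaptive randomized strategy after the string `lookup h v` of edges
    -- has been probed at each v and the matching M has been committed to.
    -- Randomizing the decision on an active edge is done by a flip before
    -- the probe.
    mutual
      data Offline (h : Vec (List (Fin m)) n) (M : PartialMatching m n) : Set where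
        stop  : Offline h M
        flip  : Probability → Offline h M → Offline h M → Offline h M
        probe : (u : Fin m) (v : Fin n) → let s = lookup h v ∷ʳ u in C v s →
                (ifInactive : Offline (h [ v ]≔ s) M) →
                (ifActive : Decision u v (h [ v ]≔ s) M) →
                Offline h M

      data Decision (u : Fin m) (v : Fin n)
                    (h : Vec (List (Fin m)) n) (M : PartialMatching m n) : Set where
        reject : Offline h M → Decision u v h M
        accept : Free M u v → Offline h (M [ u ]≔ just v) → Decision u v h M

    OfflineAlgorithm : Set
    OfflineAlgorithm = Offline (replicate n []) emptyMatching

    -- Expected weight of the output, over the algorithm's own flips, for
    -- fixed edge states.
    mutual
      runOffline : ∀ {h M} → Offline h M → EdgeStates m n → Carrier
      runOffline {M = M} stop st = weight G M
      runOffline (flip q σ₁ σ₂) st = bernoulli q λ b → if b then runOffline σ₁ st else runOffline σ₂ st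
      runOffline (probe u v _ σ δ) st = if active st u v then runDecision δ st else runOffline σ st

      runDecision : ∀ {u v h M} → Decision u v h M → EdgeStates m n → Carrier
      runDecision (reject σ)   st = runOffline σ st
      runDecision (accept _ σ) st = runOffline σ st

    offlineValue : OfflineAlgorithm → Carrier
    offlineValue σ = edgeStates G (runOffline σ)

    Achievable : Pred Carrier 0ℓ
    Achievable x = ∃ λ σ → x ≈ offlineValue σ

    -- The maximum exists: flips never help, so a dynamic program over the
    -- finitely many deterministic strategies attains it.  The program runs
    -- over arbitrary linear E, since conditioning on probe outcomes changes E.
    private
      restrict : (EdgeStates m n → Bool) → Functional (EdgeStates m n) → Functional (EdgeStates m n)
      restrict c E f = E λ st → if c st then f st else 0#

      restrict-linear : ∀ c {E} → Linear E → Linear (restrict c E)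
      restrict-linear c {E} lin = record
        { cong  = λ f≈g → L.cong λ st → cong′ (c st) (f≈g st)
        ; add   = λ f g → trans (L.cong λ st → add′ (c st)) (L.add _ _)
        ; scale = λ k f → trans (L.cong λ st → scale′ (c st) k) (L.scale k _)
        }
        where
        module L = Linear lin
        open CommutativeRing commutativeRing using (zeroʳ)
        cong′ : ∀ b {x y} → x ≈ y → (if b then x else 0#) ≈ (if b then y else 0#)
        cong′ true  eq = eq
        cong′ false eq = refl
        add′ : ∀ b {x y} → (if b then x + y else 0#) ≈ (if b then x else 0#) + (if b then y else 0#)
        add′ true  = refl
        add′ false = sym (+-identityʳ 0#)
        scale′ : ∀ b k {x} → (if b then k * x else 0#) ≈ k * (if b then x else 0#)
        scale′ true  k = refl
        scale′ false k = sym (zeroʳ k)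

      isActive isInactive : Fin m → Fin n → EdgeStates m n → Bool
      isActive u v st = active st u v
      isInactive u v st = if active st u v then false else true

      split : ∀ {E} → Linear E → ∀ u v f g →
              E (λ st → if active st u v then f st else g st) ≈
              restrict (isActive u v) E f + restrict (isInactive u v) E g
      split lin u v f g = trans (L.cong λ st → lemma (active st u v)) (L.add _ _)
        where
        module L = Linear lin
        lemma : ∀ b {x y} → (if b then x else y) ≈
                (if b then x else 0#) + (if (if b then false else true) then y else 0#)
        lemma true  = sym (+-identityʳ _)
        lemma false = sym (+-identityˡ _)

      split-mono : ∀ {E} → Linear E → ∀ u v {f f′ g g′} →
                   restrict (isActive u v) E f ≤ restrict (isActive u v) E f′ →
                   restrict (isInactive u v) E g ≤ restrict (isInactive u v) E g′ →
                   E (λ st → if active st u v then f st else g st) ≤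
                   E (λ st → if active st u v then f′ st else g′ st)
      split-mono lin u v p q = ≤-resp-≈ (sym (split lin u v _ _)) (sym (split lin u v _ _)) (+-mono-≤ p q)

      free? : ∀ M u v → Dec (Free {m} {n} M u v)
      free? M u v = Maybe.≡-dec Fin._≟_ (lookup M u) nothing ×-dec
                    Fin.all? λ u′ → ¬? (Maybe.≡-dec Fin._≟_ (lookup M u′) (just v))

      lookup-injective : ∀ {s : List (Fin m)} → Unique s →
                         ∀ {i j} → List.lookup s i ≡ List.lookup s j → i ≡ j
      lookup-injective (_ AllPairs.∷ _)  {zero}  {zero}  eq = ≡.refl
      lookup-injective (x∉ AllPairs.∷ _) {zero}  {suc j} eq = ⊥-elim (All.lookup x∉ (∈-lookup j) eq)
      lookup-injective (x∉ AllPairs.∷ _) {suc i} {zero}  eq = ⊥-elim (All.lookup x∉ (∈-lookup i) (≡.sym eq))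
      lookup-injective (_ AllPairs.∷ us) {suc i} {suc j} eq = ≡.cong suc (lookup-injective us eq)

      remaining : ∀ {n′} → Vec (List (Fin m)) n′ → ℕ
      remaining []      = 0
      remaining (s ∷ h) = (m ∸ length s) ℕ.+ remaining h

      remaining-decreases : ∀ {n′} (h : Vec (List (Fin m)) n′) v u → Unique (lookup h v ∷ʳ u) →
                            remaining (h [ v ]≔ (lookup h v ∷ʳ u)) ℕ.< remaining h
      remaining-decreases (s ∷ h) zero u us = ℕ.+-monoˡ-< (remaining h)
        (ℕ.∸-monoʳ-< (≡.subst (length s ℕ.<_) (≡.sym (≡.trans (List.length-++ s) (ℕ.+-comm (length s) 1))) ℕ.≤-refl)
                     (Fin.injective⇒≤ (lookup-injective us)))
      remaining-decreases (s ∷ h) (suc v) u us = ℕ.+-monoʳ-< (m ∸ length s) (remaining-decreases h v u us)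

      module _ where
        open Extrema totalOrder

        acceptances : ∀ {u v h M} → Offline h (M [ u ]≔ just v) → Dec (Free M u v) → List (Decision u v h M)
        acceptances σ (yes fr) = accept fr σ ∷ []
        acceptances σ (no _)   = []

        mutual
          best : ℕ → Functional (EdgeStates m n) → ∀ h M → Offline h M
          best zero    E h M = stop
          best (suc k) E h M = argmax (E ∘ runOffline) stop (candidates k E h M)

          bestDecision : ℕ → Functional (EdgeStates m n) → ∀ u v h M → Decision u v h M
          bestDecision k E u v h M =
            argmax (E ∘ runDecision) (reject (best k E h M))
              (acceptances (best k E h (M [ u ]≔ just v)) (free? M u v))

          candidates : ℕ → Functional (EdgeStates m n) → ∀ h M → List (Offline h M)
          candidates k E h M =
            concatMap (λ u → concatMap (λ v → probes k E h M u v (C? v (lookup h v ∷ʳ u))) (allFin n)) (allFin m)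

          probes : ℕ → Functional (EdgeStates m n) → ∀ h M u v →
                   Dec (C v (lookup h v ∷ʳ u)) → List (Offline h M)
          probes k E h M u v (yes ok) =
            probe u v ok (best k (restrict (isInactive u v) E) _ M)
                         (bestDecision k (restrict (isActive u v) E) u v _ M) ∷ []
          probes k E h M u v (no _) = []

        mutual
          best-optimal : ∀ k {E} → Linear E → ∀ {h M} → remaining h ℕ.≤ k → (σ : Offline h M) →
                         E (runOffline σ) ≤ E (runOffline (best k E h M))
          best-optimal zero lin r stop = ≤-refl
          best-optimal (suc k) {E} lin {h} {M} r stop =
            f[⊥]≤f[argmax] {f = E ∘ runOffline} stop (candidates k E h M)
          best-optimal k {E} lin r (flip q σ₁ σ₂) = ≤-trans (≤-reflexive eq)
            (convex≤ q (best-optimal k lin r σ₁) (best-optimal k lin r σ₂))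
            where
            module L = Linear lin
            eq = trans (L.add _ _) (+-cong (L.scale _ _) (L.scale _ _))
          best-optimal zero lin {h} r (probe u v ok σ δ)
            with ℕ.<-≤-trans (remaining-decreases h v u (C-distinct ok)) r
          ... | ()
          best-optimal (suc k) {E} lin {h} {M} r (probe u v ok σ δ) =
            v≤f[argmax]⁺ {f = E ∘ runOffline} stop (candidates k E h M)
              (inj₂ (Any.concatMap⁺ _ (lose (∈-allFin u) (Any.concatMap⁺ _ (lose (∈-allFin v)
                (probes-optimal k lin r ok σ δ (C? v (lookup h v ∷ʳ u))))))))

          probes-optimal : ∀ k {E} → Linear E → ∀ {h M u v} → remaining h ℕ.≤ suc k → ∀ ok σ δ d →
                           Any (λ τ → E (runOffline (probe u v ok σ δ)) ≤ E (runOffline τ))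
                               (probes k E h M u v d)
          probes-optimal k lin {h} {M} {u} {v} r ok σ δ (yes _) =
            here (split-mono lin u v
              (bestDecision-optimal k (restrict-linear (isActive u v) lin) r′ δ)
              (best-optimal k (restrict-linear (isInactive u v) lin) r′ σ))
            where
            r′ = ℕ.≤-pred (ℕ.<-≤-trans (remaining-decreases h v u (C-distinct ok)) r)
          probes-optimal k lin r ok σ δ (no ¬ok) = ⊥-elim (¬ok ok)

          bestDecision-optimal : ∀ k {E} → Linear E → ∀ {u v h M} → remaining h ℕ.≤ k →
                                 (δ : Decision u v h M) →
                                 E (runDecision δ) ≤ E (runDecision (bestDecision k E u v h M))
          bestDecision-optimal k {E} lin {u} {v} {h} {M} r (reject σ) =
            ≤-trans (best-optimal k lin r σ)
              (f[⊥]≤f[argmax] {f = E ∘ runDecision} (reject (best k E h M)) (acceptances _ (free? M u v)))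
          bestDecision-optimal k {E} lin {u} {v} {h} {M} r (accept fr σ) =
            v≤f[argmax]⁺ {f = E ∘ runDecision} (reject (best k E h M)) (acceptances _ (free? M u v))
              (inj₂ (acceptance-optimal (free? M u v)))
            where
            acceptance-optimal : ∀ d → Any (λ τ → E (runOffline σ) ≤ E (runDecision τ))
                                           (acceptances (best k E h (M [ u ]≔ just v)) d)
            acceptance-optimal (yes _)  = here (best-optimal k lin r σ)
            acceptance-optimal (no ¬fr) = ⊥-elim (¬fr fr)

    edgeStates-linear : Linear (edgeStates G)
    edgeStates-linear = independent-linear _ λ u → independent-linear _ λ v → bernoulli-linear (p u v)

    abstract
      optimum : ∃ (IsMaximum Achievable)
      optimum = offlineValue σ , (σ , refl) ,
        λ { x (τ , x≈) → ≤-trans (≤-reflexive x≈) (best-optimal _ edgeStates-linear ℕ.≤-refl τ) }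
        where
        σ : OfflineAlgorithm
        σ = best (remaining (replicate n [])) (edgeStates G) _ _

    OPTᴳ : Carrier
    OPTᴳ = proj₁ optimum

  -- A known i.d. input: type graph on U = Fin m and B = Fin k, n arrivals.
  record Input : Set₁ where
    field
      {m k n} : ℕ
      H       : StochasticGraph m k
      D       : Fin n → Distribution k

  module _ (I : Input) where

    open Input I
    open StochasticGraph H

    types : Functional (Vec (Fin k) n)
    types = independent λ i → Distribution.expectation (D i)

    OPT : Carrier
    OPT = types λ τ → OPTᴳ (instantiate H τ)

    -- Online t M: a strategy awaiting the remaining t arrivals.
    -- Session t i b s M: the strategy while v_i, revealed to have type b, is
    -- present, after the string s of edges of ∂(v_i) has been probed.
    -- An arrival order repeats no index, so the behaviour prescribed for
    -- indices that have arrived before is irrelevant.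
    mutual
      data Online : ℕ → PartialMatching m n → Set where
        end    : ∀ {M} → Online 0 M
        arrive : ∀ {t M} → ((i : Fin n) (b : Fin k) → Session t i b [] M) → Online (suc t) M

      data Session (t : ℕ) (i : Fin n) (b : Fin k)
                   (s : List (Fin m)) (M : PartialMatching m n) : Set where
        done  : Online t M → Session t i b s M
        flip  : Probability → Session t i b s M → Session t i b s M → Session t i b s M
        probe : (u : Fin m) → C b (s ∷ʳ u) →
                (ifInactive : Session t i b (s ∷ʳ u) M) →
                (ifActive : Verdict t i b u (s ∷ʳ u) M) →
                Session t i b s M

      data Verdict (t : ℕ) (i : Fin n) (b : Fin k) (u : Fin m)
                   (s : List (Fin m)) (M : PartialMatching m n) : Set where
        reject : Session t i b s M → Verdict t i b u s M
        accept : Free M u i → Session t i b s (M [ u ]≔ just i) → Verdict t i b u s M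

    -- Expected weight of the output, over the algorithm's own flips, for
    -- fixed types τ, arrival order and edge states.
    module _ (τ : Vec (Fin k) n) (st : EdgeStates m n) where
      mutual
        runOnline : ∀ {t M} → Online t M → Vec (Fin n) t → Carrier
        runOnline {M = M} end  []      = weight (instantiate H τ) M
        runOnline (arrive σ)   (i ∷ π) = runSession (σ i (lookup τ i)) π

        runSession : ∀ {t i b s M} → Session t i b s M → Vec (Fin n) t → Carrier
        runSession (done σ) π       = runOnline σ π
        runSession (flip q σ₁ σ₂) π = bernoulli q λ b → if b then runSession σ₁ π else runSession σ₂ π
        runSession {i = i} (probe u _ σ δ) π = if active st u i then runVerdict δ π else runSession σ π

        runVerdict : ∀ {t i b u s M} → Verdict t i b u s M → Vec (Fin n) t → Carrier
        runVerdict (reject σ)   π = runSession σ π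
        runVerdict (accept _ σ) π = runSession σ π

    -- 𝔼[w(𝓜)] in the random order model
    randomOrderValue : Online n emptyMatching → Carrier
    randomOrderValue σ =
      types λ τ → uniformPermutation n λ π → edgeStates (instantiate H τ) λ st → runOnline τ st σ π

  OnlineAlgorithm : Set₁
  OnlineAlgorithm = (I : Input) → Online I (Input.n I) emptyMatching

{-# OPTIONS --safe #-}

-- When v_i arrives with type b, draw types for all other vertices afresh and
-- simulate an optimal offline strategy on the resulting graph, tossing coins
-- for the edges away from v_i and probing the edges at v_i.  The first edge
-- (u , v_i) that the simulation adds is the candidate of v_i.  Candidates of
-- different arrivals are independent, their expected weights add up to OPT,
-- and each u is proposed with total probability at most 1.  So each u faces a
-- stopping problem of its own: take the candidate if its weight is at least
-- the value of waiting.
--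
-- Let v be the value of this problem for N arrivals of total expected weight
-- W.  Passing by one random arrival costs at most what the dynamic program
-- gains on it, which is at least 1/N times the current shortfall from W.
-- Hence the shortfall grows by a factor 1 + 1/N with each arrival passed by,
-- and it is W when none is left: (1 + 1/N)^N (W - v) ≤ W.  Adding worthless
-- arrivals does not change v, so N may tend to infinity and e (W - v) ≤ W.

module Submission where

open import Algebra.Bundles using (CommutativeRing; RawRing)
import Algebra.Construct.NaturalChoice.Max as Max
import Algebra.Properties.Ring as RingProperties
import Algebra.Properties.Semiring.Exp as Exp
import Algebra.Properties.Semiring.Mult as Mult
import Algebra.Properties.Semiring.Sum as Sum
import Algebra.Solver.Ring as RingSolver
open import Algebra.Solver.Ring.AlmostCommutativeRing using (fromCommutativeRing; _-Raw-AlmostCommutative⟶_)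
open import Data.Bool.Base using (Bool; true; false; if_then_else_)
open import Data.Empty using (⊥-elim)
open import Data.Fin.Base using (Fin; zero; suc)
import Data.Fin.Properties as Fin
open import Data.List.Base using (List; []; _∷_; _∷ʳ_)
open import Data.List.Membership.Propositional using (_∈_; _∉_)
open import Data.List.Membership.Propositional.Properties using (∈-++⁺ˡ; ∈-++⁺ʳ)
import Data.List.Relation.Unary.All as All
import Data.List.Relation.Unary.AllPairs as AllPairs
open import Data.List.Relation.Unary.Any using (here; there)
open import Data.List.Relation.Unary.Unique.Propositional using (Unique)
open import Data.Maybe.Base using (Maybe; just; nothing; maybe)
import Data.Maybe.Properties as Maybe
open import Data.Nat.Base as ℕ using (ℕ; zero; suc; _!)
import Data.Nat.Properties as ℕ
open import Data.Product.Base using (∃; _×_; _,_; proj₁; proj₂)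
open import Data.Sum.Base using (inj₁; inj₂)
open import Data.Vec.Base as Vec using (Vec; []; _∷_; lookup; _[_]≔_)
import Data.Vec.Membership.Propositional as Vec
import Data.Vec.Membership.Propositional.Properties as Vec
import Data.Vec.Properties as Vec
import Data.Vec.Relation.Unary.All as VecAll
import Data.Vec.Relation.Unary.All.Properties as VecAll
import Data.Vec.Relation.Unary.AllPairs as VecAllPairs
import Data.Vec.Relation.Unary.AllPairs.Properties as VecAllPairs
import Data.Vec.Relation.Unary.Any as VecAny
open import Function.Base using (_∘_; id)
open import Relation.Binary.Bundles using (DecTotalOrder)
open import Relation.Binary.PropositionalEquality as ≡ using (_≡_; _≢_)
import Relation.Binary.Reasoning.PartialOrder as PosetReasoning
open import Relation.Nullary using (¬_; Dec; yes; no; does; ¬?; _×-dec_)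
open import Defs

-- At v_i the simulated graph has the true type and the true edge states, elsewhere fresh
-- independent ones. It is therefore distributed as G, and (u , v_i) becomes the candidate exactly
-- as often as the optimum matches it. The simulation starts from an empty matching of its own and
-- never looks at the real one, so real acceptances do not bias later candidates; this is why the
-- value splits exactly into one stopping problem for each u.
--
-- The rate is 1/N at every step, however few arrivals are left, because the arrival that follows k
-- random ones is again uniform over all N: on average its weight is W/N and its chance of proposing
-- u at most 1/N. It is correlated with the value of what remains after it, but in the harmless
-- direction, since taking an arrival away can only lower that value.
--
-- For a fixed N the shortfall inequality yields a factor below 1 - 1/e, as (1 + 1/N)^N < e. The
-- worthless arrivals are what reaches the constant.

module _ (ℝ : Reals) where

  open RealNumbers ℝ
  open Matching ℝ
  open CommutativeRing commutativeRing
    hiding (Carrier; _≈_; _+_; _*_; -_; _-_; 0#; 1#; zero; _≉_)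
  open DecTotalOrder decTotalOrder
    using (poset; _≟_; _≤?_; total; antisym; totalOrder)
    renaming (refl to ≤-refl; trans to ≤-trans; reflexive to ≤-reflexive)
  open RingProperties ring using (-‿distribˡ-*; -‿distribʳ-*; -‿involutive; -‿+-comm; -0#≈0#)
  open Mult semiring using (×1-homo-*; ×-homo-+)
  open Sum semiring using (sum-cong-≋; sum-replicate-zero; ∑-distrib-+; *-distribˡ-sum; *-distribʳ-sum)
  open Exp semiring using (_^_; ^-homo-*; ^-congˡ)
  open Max totalOrder using (_⊔_; x≤x⊔y; x≤y⊔x; ⊔-monoʳ-≤; x≤y⇒x⊔y≈y; x≤y⇒y⊔x≈y)
  open PosetReasoning poset

  -- Real arithmetic and finitely supported laws

  -- Differences a - b of natural numbers are a coefficient ring for the ring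
  -- solver in which cancellation is decidable.
  coefficients : RawRing _ _
  coefficients = record
    { Carrier = ℕ × ℕ
    ; _≈_     = _≡_
    ; _+_     = λ (a , b) (c , d) → a ℕ.+ c , b ℕ.+ d
    ; _*_     = λ (a , b) (c , d) → a ℕ.* c ℕ.+ b ℕ.* d , a ℕ.* d ℕ.+ b ℕ.* c
    ; -_      = λ (a , b) → b , a
    ; 0#      = 0 , 0
    ; 1#      = 1 , 0
    }

  -‿interchange : ∀ a b c d → (a + c) - (b + d) ≈ (a - b) + (c - d)
  -‿interchange a b c d = begin-equality
    (a + c) - (b + d)     ≈⟨ +-congˡ (-‿+-comm b d) ⟨
    (a + c) + (- b - d)   ≈⟨ +-interchange a c (- b) (- d) ⟩
    (a - b) + (c - d)     ∎

  *-expand : ∀ a b c d → (a * c + b * d) - (a * d + b * c) ≈ (a - b) * (c - d)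
  *-expand a b c d = begin-equality
    (a * c + b * d) - (a * d + b * c)            ≈⟨ -‿interchange (a * c) (a * d) (b * d) (b * c) ⟩
    (a * c - a * d) + (b * d - b * c)            ≈⟨ +-cong (+-congˡ (-‿distribʳ-* a d)) (+-comm (b * d) (- (b * c))) ⟩
    (a * c + a * - d) + (- (b * c) + b * d)      ≈⟨ +-cong (distribˡ a c (- d)) (+-congˡ (-‿involutive (b * d))) ⟨
    a * (c - d) + (- (b * c) + - - (b * d))      ≈⟨ +-congˡ (-‿+-comm (b * c) (- (b * d))) ⟩
    a * (c - d) - (b * c - b * d)                ≈⟨ +-congˡ (-‿cong (+-congˡ (-‿distribʳ-* b d))) ⟩
    a * (c - d) - (b * c + b * - d)              ≈⟨ +-congˡ (-‿cong (distribˡ b c (- d))) ⟨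
    a * (c - d) - b * (c - d)                    ≈⟨ +-congˡ (-‿distribˡ-* b (c - d)) ⟩
    a * (c - d) + - b * (c - d)                  ≈⟨ distribʳ (c - d) a (- b) ⟨
    (a - b) * (c - d)                            ∎

  fromℕ-+ : ∀ a b → fromℕ (a ℕ.+ b) ≈ fromℕ a + fromℕ b
  fromℕ-+ a b = ×-homo-+ 1# a b

  fromℕ-* : ∀ a b → fromℕ (a ℕ.* b) ≈ fromℕ a * fromℕ b
  fromℕ-* = ×1-homo-*

  difference : ℕ × ℕ → Carrier
  difference (a , b) = fromℕ a - fromℕ b

  -- Separate clauses make con (0 , 0) and con (1 , 0) denote 0# and 1#.
  ⟦_⟧ᶜ : ℕ × ℕ → Carrier
  ⟦ 0 , 0 ⟧ᶜ = 0#
  ⟦ 1 , 0 ⟧ᶜ = 1#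
  ⟦ p ⟧ᶜ     = difference p

  ⟦⟧ᶜ≈difference : ∀ p → ⟦ p ⟧ᶜ ≈ difference p
  ⟦⟧ᶜ≈difference (0 , 0)           = sym (-‿inverseʳ 0#)
  ⟦⟧ᶜ≈difference (1 , 0)           = sym (trans (+-cong (+-identityʳ 1#) -0#≈0#) (+-identityʳ 1#))
  ⟦⟧ᶜ≈difference (0 , suc _)       = refl
  ⟦⟧ᶜ≈difference (1 , suc _)       = refl
  ⟦⟧ᶜ≈difference (suc (suc _) , _) = refl

  ⟦⟧ᶜ-homo : coefficients -Raw-AlmostCommutative⟶ fromCommutativeRing commutativeRing
  ⟦⟧ᶜ-homo = record
    { ⟦_⟧    = ⟦_⟧ᶜ
    ; +-homo = λ p@(a , b) q@(c , d) → trans (⟦⟧ᶜ≈difference (a ℕ.+ c , b ℕ.+ d)) (trans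
        (trans (+-cong (fromℕ-+ a c) (-‿cong (fromℕ-+ b d))) (-‿interchange _ _ _ _))
        (sym (+-cong (⟦⟧ᶜ≈difference p) (⟦⟧ᶜ≈difference q))))
    ; *-homo = λ p@(a , b) q@(c , d) → trans (⟦⟧ᶜ≈difference (a ℕ.* c ℕ.+ b ℕ.* d , a ℕ.* d ℕ.+ b ℕ.* c)) (trans
        (trans (+-cong (trans (fromℕ-+ (a ℕ.* c) (b ℕ.* d)) (+-cong (fromℕ-* a c) (fromℕ-* b d)))
                 (-‿cong (trans (fromℕ-+ (a ℕ.* d) (b ℕ.* c)) (+-cong (fromℕ-* a d) (fromℕ-* b c)))))
               (*-expand _ _ _ _))
        (sym (*-cong (⟦⟧ᶜ≈difference p) (⟦⟧ᶜ≈difference q))))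
    ; -‿homo = λ p@(a , b) → trans (⟦⟧ᶜ≈difference (b , a)) (trans
        (trans (+-comm (fromℕ b) (- fromℕ a))
          (trans (+-congˡ (sym (-‿involutive (fromℕ b)))) (-‿+-comm (fromℕ a) (- fromℕ b))))
        (sym (-‿cong (⟦⟧ᶜ≈difference p))))
    ; 0-homo = refl
    ; 1-homo = refl
    }

  -- Equality of a - b and c - d is tested as a + d = c + b in ℕ, so normalisation never has to
  -- decide an equality of reals.
  ⟦⟧ᶜ-cong? : ∀ p q → Maybe (⟦ p ⟧ᶜ ≈ ⟦ q ⟧ᶜ)
  ⟦⟧ᶜ-cong? p@(a , b) q@(c , d) with a ℕ.+ d ℕ.≟ c ℕ.+ b
  ... | no _   = nothing
  ... | yes eq = just (begin-equality
    ⟦ p ⟧ᶜ                                        ≈⟨ ⟦⟧ᶜ≈difference p ⟩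
    fromℕ a - fromℕ b                             ≈⟨ pad (fromℕ a) (fromℕ b) (fromℕ d) ⟩
    (fromℕ a + fromℕ d) - (fromℕ b + fromℕ d)     ≈⟨ +-cong (fromℕ-+ a d) (-‿cong (+-comm (fromℕ d) (fromℕ b))) ⟨
    fromℕ (a ℕ.+ d) - (fromℕ d + fromℕ b)         ≡⟨ ≡.cong (λ n → fromℕ n - (fromℕ d + fromℕ b)) eq ⟩
    fromℕ (c ℕ.+ b) - (fromℕ d + fromℕ b)         ≈⟨ +-congʳ (fromℕ-+ c b) ⟩
    (fromℕ c + fromℕ b) - (fromℕ d + fromℕ b)     ≈⟨ pad (fromℕ c) (fromℕ d) (fromℕ b) ⟨
    fromℕ c - fromℕ d                             ≈⟨ ⟦⟧ᶜ≈difference q ⟨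
    ⟦ q ⟧ᶜ                                        ∎)
    where
    pad : ∀ x y z → x - y ≈ (x + z) - (y + z)
    pad x y z = begin-equality
      x - y               ≈⟨ +-identityʳ (x - y) ⟨
      (x - y) + 0#        ≈⟨ +-congˡ (-‿inverseʳ z) ⟨
      (x - y) + (z - z)   ≈⟨ -‿interchange x y z z ⟨
      (x + z) - (y + z)   ∎

  open RingSolver coefficients (fromCommutativeRing commutativeRing) ⟦⟧ᶜ-homo ⟦⟧ᶜ-cong?
    using (solve; _:=_; _:+_; _:*_; _:-_; :-_; con)

  *-monoʳ-≤ : ∀ {x y z} → 0# ≤ z → x ≤ y → x * z ≤ y * z
  *-monoʳ-≤ {x} {y} {z} 0≤z x≤y = ≤-resp-≈ (*-comm z x) (*-comm z y) (*-monoˡ-≤ 0≤z x≤y)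

  +-nonneg : ∀ {x y} → 0# ≤ x → 0# ≤ y → 0# ≤ x + y
  +-nonneg p q = ≤-trans p (x≤x+y q)

  neg-mono-≤ : ∀ {x y} → x ≤ y → - y ≤ - x
  neg-mono-≤ {x} {y} x≤y = 0≤y-x⇒x≤y (≤-resp-≈ refl
    (solve 2 (λ x y → y :- x := :- x :- :- y) refl x y) (x≤y⇒0≤y-x x≤y))

  sum-mono-≤ : ∀ {n} {f g : Fin n → Carrier} → (∀ i → f i ≤ g i) → sum f ≤ sum g
  sum-mono-≤ {zero}  f≤g = ≤-refl
  sum-mono-≤ {suc n} f≤g = +-mono-≤ (f≤g zero) (sum-mono-≤ (f≤g ∘ suc))

  sum-nonneg : ∀ {n} {f : Fin n → Carrier} → (∀ i → 0# ≤ f i) → 0# ≤ sum f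
  sum-nonneg {n} 0≤f = ≤-trans (≤-reflexive (sym (sum-replicate-zero n))) (sum-mono-≤ 0≤f)

  suc-inverseʳ : ∀ n → fromℕ (suc n) * fromℕ (suc n) ⁻¹ ≈ 1#
  suc-inverseʳ n = *-inverseʳ (1≤x⇒x≉0 (1≤fromℕ (suc n)))

  0≤suc⁻¹ : ∀ n → 0# ≤ fromℕ (suc n) ⁻¹
  0≤suc⁻¹ n = 1≤x⇒0≤x⁻¹ (1≤fromℕ (suc n))

  *-suc⁻¹-cancel : ∀ n x → fromℕ (suc n) * (fromℕ (suc n) ⁻¹ * x) ≈ x
  *-suc⁻¹-cancel n x = trans (sym (*-assoc _ _ x)) (trans (*-congʳ (suc-inverseʳ n)) (*-identityˡ x))

  suc⁻¹-*-cancel : ∀ n x → fromℕ (suc n) ⁻¹ * (fromℕ (suc n) * x) ≈ x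
  suc⁻¹-*-cancel n x = trans (*-swap _ _ x) (*-suc⁻¹-cancel n x)

  suc-*-cancelˡ-≤ : ∀ n {x y} → fromℕ (suc n) * x ≤ fromℕ (suc n) * y → x ≤ y
  suc-*-cancelˡ-≤ n p = ≤-resp-≈ (suc⁻¹-*-cancel n _) (suc⁻¹-*-cancel n _) (*-monoˡ-≤ (0≤suc⁻¹ n) p)

  Linear-sum : ∀ {A} {E : Functional A} → Linear E → ∀ {n} (F : Fin n → A → Carrier) →
               E (λ a → sum λ i → F i a) ≈ sum λ i → E (F i)
  Linear-sum {E = E} lin {zero} F = begin-equality
    E (λ a → 0#)           ≈⟨ L.cong (λ a → zeroˡ 0#) ⟨
    E (λ a → 0# * 0#)      ≈⟨ L.scale 0# (λ _ → 0#) ⟩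
    0# * E (λ _ → 0#)      ≈⟨ zeroˡ _ ⟩
    0#                     ∎
    where module L = Linear lin
  Linear-sum lin {suc n} F = trans (L.add _ _) (+-congˡ (Linear-sum lin (F ∘ suc)))
    where module L = Linear lin

  -- `fubini` asks of E′ only linearity, so that laws can be exchanged with `uniformPermutation n`,
  -- which is handled through its linearity alone. It holds for the laws built here because each is
  -- a finite combination of evaluations.
  record Law {A : Set} (E : Functional A) : Set₁ where
    field
      linear : Linear E
      total  : ∀ c → E (λ _ → c) ≈ c
      mono   : ∀ {f g} → (∀ a → f a ≤ g a) → E f ≤ E g
      fubini : ∀ {B : Set} {E′ : Functional B} → Linear E′ → ∀ (F : A → B → Carrier) →
               E (λ a → E′ (F a)) ≈ E′ (λ b → E λ a → F a b)
    open Linear linear public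

  bernoulli-const : ∀ p c → bernoulli p (λ _ → c) ≈ c
  bernoulli-const (q , _) c = solve 2 (λ q c → q :* c :+ (con (1 , 0) :- q) :* c := c) refl q c

  bernoulli-law : ∀ p → Law (bernoulli p)
  bernoulli-law p@(q , 0≤q , q≤1) = record
    { linear = bernoulli-linear p
    ; total  = bernoulli-const p
    ; mono   = λ f≤g → +-mono-≤ (*-monoˡ-≤ 0≤q (f≤g true)) (*-monoˡ-≤ (x≤y⇒0≤y-x q≤1) (f≤g false))
    ; fubini = λ lin F → let module L = Linear lin in
        sym (trans (L.add _ _) (+-cong (L.scale _ _) (L.scale _ _)))
    }

  expectation-law : ∀ {n} (D : Distribution n) → Law (Distribution.expectation D)
  expectation-law D = record
    { linear = record
      { cong  = λ f≈g → sum-cong-≋ λ b → *-congˡ (f≈g b)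
      ; add   = λ f g → trans (sum-cong-≋ λ b → distribˡ (mass b) (f b) (g b)) (∑-distrib-+ (λ b → mass b * f b) (λ b → mass b * g b))
      ; scale = λ c f → trans (sum-cong-≋ λ b → *-swap (mass b) c (f b)) (sym (*-distribˡ-sum c λ b → mass b * f b))
      }
    ; total  = λ c → trans (sym (*-distribʳ-sum c mass)) (trans (*-congʳ mass-total) (*-identityˡ c))
    ; mono   = λ f≤g → sum-mono-≤ λ b → *-monoˡ-≤ (mass-nonneg b) (f≤g b)
    ; fubini = λ lin F → let module L = Linear lin in
        sym (trans (Linear-sum lin λ b a → mass b * F b a) (sum-cong-≋ λ b → L.scale (mass b) (F b)))
    }
    where open Distribution D

  independent-law : ∀ {A n} {E : Fin n → Functional A} → (∀ i → Law (E i)) → Law (independent E)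
  independent-law {A} {zero} law = record
    { linear = independent-linear _ λ i → Law.linear (law i)
    ; total  = λ c → refl
    ; mono   = λ f≤g → f≤g []
    ; fubini = λ lin F → refl
    }
  independent-law {A} {suc n} {E} law = record
    { linear = independent-linear E λ i → Law.linear (law i)
    ; total  = λ c → trans (E₀.cong λ a → Eₛ.total c) (E₀.total c)
    ; mono   = λ f≤g → E₀.mono λ a → Eₛ.mono λ v → f≤g (a ∷ v)
    ; fubini = λ lin F → trans (E₀.cong λ a → Eₛ.fubini lin _) (E₀.fubini lin _)
    }
    where
    module E₀ = Law (law zero)
    module Eₛ = Law (independent-law (law ∘ suc))

  -- For the first coordinate, the old value is ignored by f and integrates out by `total`; for a
  -- later one, `fubini` moves the new draw to the front. This lets types and edge states be drawn
  -- at the moment they are looked at.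
  independent-resample : ∀ {A n} {E : Fin n → Functional A} → (∀ i → Law (E i)) → ∀ i f →
                         independent E f ≈ E i λ a → independent E λ v → f (v [ i ]≔ a)
  independent-resample {E = E} law zero f =
    sym (Law.cong (law zero) λ a → Law.total (law zero) _)
  independent-resample {E = E} law (suc i) f = begin-equality
    E zero (λ a → independent (E ∘ suc) λ v → f (a ∷ v))
      ≈⟨ Law.cong (law zero) (λ a → independent-resample (law ∘ suc) i λ v → f (a ∷ v)) ⟩
    E zero (λ a → E (suc i) λ b → independent (E ∘ suc) λ v → f (a ∷ v [ i ]≔ b))
      ≈⟨ Law.fubini (law zero) (Law.linear (law (suc i))) _ ⟩
    E (suc i) (λ b → E zero λ a → independent (E ∘ suc) λ v → f (a ∷ v [ i ]≔ b))
      ∎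

  -- Stopping at one of the arrivals in random order

  data Pick {A : Set} : ∀ {t} → A → Vec A t → Vec A (suc t) → Set where
    here  : ∀ {t x} {r : Vec A t} → Pick x r (x ∷ r)
    there : ∀ {t x y} {r : Vec A t} {R} → Pick x r R → Pick x (y ∷ r) (y ∷ R)

  -- The sum of φ x r over the ways of taking an entry x out of R, leaving r.
  pickSum : ∀ {A : Set} {t} → (A → Vec A t → Carrier) → Vec A (suc t) → Carrier
  pickSum {t = zero}  φ (a ∷ []) = φ a []
  pickSum {t = suc t} φ (a ∷ R)  = φ a R + pickSum (λ x r → φ x (a ∷ r)) R

  module _ {A : Set} where

    pickSum-cong : ∀ {t} {φ ψ : A → Vec A t → Carrier} R →
                   (∀ {x r} → Pick x r R → φ x r ≈ ψ x r) → pickSum φ R ≈ pickSum ψ R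
    pickSum-cong {zero}  (a ∷ []) φ≈ψ = φ≈ψ here
    pickSum-cong {suc t} (a ∷ R)  φ≈ψ = +-cong (φ≈ψ here) (pickSum-cong R (φ≈ψ ∘ there))

    pickSum-mono : ∀ {t} {φ ψ : A → Vec A t → Carrier} R →
                   (∀ {x r} → Pick x r R → φ x r ≤ ψ x r) → pickSum φ R ≤ pickSum ψ R
    pickSum-mono {zero}  (a ∷ []) φ≤ψ = φ≤ψ here
    pickSum-mono {suc t} (a ∷ R)  φ≤ψ = +-mono-≤ (φ≤ψ here) (pickSum-mono R (φ≤ψ ∘ there))

    pickSum-add : ∀ {t} (φ ψ : A → Vec A t → Carrier) R →
                  pickSum (λ x r → φ x r + ψ x r) R ≈ pickSum φ R + pickSum ψ R
    pickSum-add {zero}  φ ψ (a ∷ []) = refl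
    pickSum-add {suc t} φ ψ (a ∷ R)  = trans (+-congˡ (pickSum-add _ _ R)) (+-interchange _ _ _ _)

    pickSum-scale : ∀ {t} c (φ : A → Vec A t → Carrier) R →
                    pickSum (λ x r → c * φ x r) R ≈ c * pickSum φ R
    pickSum-scale {zero}  c φ (a ∷ []) = refl
    pickSum-scale {suc t} c φ (a ∷ R)  = trans (+-congˡ (pickSum-scale c _ R)) (sym (distribˡ c _ _))

    pickSum-sub : ∀ {t} (φ ψ : A → Vec A t → Carrier) R →
                  pickSum (λ x r → φ x r - ψ x r) R ≈ pickSum φ R - pickSum ψ R
    pickSum-sub {zero}  φ ψ (a ∷ []) = refl
    pickSum-sub {suc t} φ ψ (a ∷ R)  = trans (+-congˡ (pickSum-sub _ _ R))
      (solve 4 (λ a b c d → (a :- b) :+ (c :- d) := (a :+ c) :- (b :+ d)) refl _ _ _ _)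

    pickSum-heads : ∀ {t} (g : A → Carrier) (R : Vec A (suc t)) →
                    pickSum (λ x _ → g x) R ≈ sum (g ∘ lookup R)
    pickSum-heads {zero}  g (a ∷ []) = sym (+-identityʳ (g a))
    pickSum-heads {suc t} g (a ∷ R)  = +-congˡ (pickSum-heads g R)

    pickSum-const : ∀ {t} c (R : Vec A (suc t)) → pickSum (λ _ _ → c) R ≈ fromℕ (suc t) * c
    pickSum-const {zero}  c (a ∷ []) = solve 1 (λ c → c := (con (1 , 0) :+ con (0 , 0)) :* c) refl c
    pickSum-const {suc t} c (a ∷ R)  = trans (+-congˡ (pickSum-const c R))
      (solve 2 (λ c n → c :+ n :* c := (con (1 , 0) :+ n) :* c) refl c (fromℕ (suc t)))

    -- Both sides sum over the ordered pairs of distinct positions in R.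
    pickSum-comm : ∀ {t} (ψ : A → A → Vec A t → Carrier) R →
                   pickSum (λ x r → pickSum (ψ x) r) R ≈
                   pickSum (λ x r → pickSum (λ y → ψ y x) r) R
    pickSum-comm {zero}  ψ (a ∷ b ∷ []) = +-comm _ _
    pickSum-comm {suc t} ψ (a ∷ R) = begin-equality
      pickSum (ψ a) R + pickSum (λ x r → ψ x a r + pickSum (λ y s → ψ x y (a ∷ s)) r) R
        ≈⟨ +-congˡ (trans (pickSum-add _ _ R) (+-congˡ (pickSum-comm (λ x y s → ψ x y (a ∷ s)) R))) ⟩
      pickSum (ψ a) R + (pickSum (λ x r → ψ x a r) R + pickSum (λ x r → pickSum (λ y s → ψ y x (a ∷ s)) r) R)
        ≈⟨ solve 3 (λ a b c → a :+ (b :+ c) := b :+ (a :+ c)) refl _ _ _ ⟩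
      pickSum (λ x r → ψ x a r) R + (pickSum (ψ a) R + pickSum (λ x r → pickSum (λ y s → ψ y x (a ∷ s)) r) R)
        ≈⟨ +-congˡ (pickSum-add _ _ R) ⟨
      pickSum (λ x r → ψ x a r) R + pickSum (λ x r → ψ a x r + pickSum (λ y s → ψ y x (a ∷ s)) r) R
        ∎

    -- A pick from R either takes the inserted a and leaves r, or takes some y of r and leaves a
    -- remainder that still contains a.
    pickSum-insert : ∀ {t a} {r : Vec A (suc t)} {R} {φ : A → Vec A (suc t) → Carrier} {ψ} → Pick a r R →
                     (∀ {y s s′} → Pick a s s′ → ψ y s ≤ φ y s′) →
                     φ a r + pickSum ψ r ≤ pickSum φ R
    pickSum-insert {r = r} here ψ≤φ = +-monoʳ-≤ _ (pickSum-mono r λ _ → ψ≤φ here)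
    pickSum-insert {zero} {r = b ∷ []} (there here) ψ≤φ =
      ≤-trans (≤-reflexive (+-comm _ _)) (+-mono-≤ (ψ≤φ here) ≤-refl)
    pickSum-insert {suc t} {a} {b ∷ r} {b ∷ R} {φ} {ψ} (there p) ψ≤φ = begin
      φ a (b ∷ r) + (ψ b r + pickSum (λ y s → ψ y (b ∷ s)) r)
        ≈⟨ solve 3 (λ a b c → a :+ (b :+ c) := b :+ (a :+ c)) refl _ _ _ ⟩
      ψ b r + (φ a (b ∷ r) + pickSum (λ y s → ψ y (b ∷ s)) r)
        ≤⟨ +-mono-≤ (ψ≤φ p) (pickSum-insert p (ψ≤φ ∘ there)) ⟩
      φ b R + pickSum (λ y s → φ y (b ∷ s)) R ∎

    pickSum-map : ∀ {B : Set} {t} (g : B → A) (φ : A → Vec A t → Carrier) R →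
                  pickSum φ (Vec.map g R) ≈ pickSum (λ x r → φ (g x) (Vec.map g r)) R
    pickSum-map {t = zero}  g φ (a ∷ []) = refl
    pickSum-map {t = suc t} g φ (a ∷ R)  = +-congˡ (pickSum-map g _ R)

  Linear-pickSum : ∀ {A B : Set} {E : Functional A} → Linear E → ∀ {t} (F : A → B → Vec B t → Carrier) R →
                   E (λ a → pickSum (F a) R) ≈ pickSum (λ x r → E λ a → F a x r) R
  Linear-pickSum lin {zero}  F (a ∷ []) = refl
  Linear-pickSum lin {suc t} F (a ∷ R)  =
    trans (Linear.add lin _ _) (+-congˡ (Linear-pickSum lin _ R))

  -- Items arrive in uniformly random order and at most one of them is collected.
  -- h a c is the expected payoff when a arrives and c is the payoff of going on.
  record Rewards (A : Set) : Set where
    field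
      h      : A → Carrier → Carrier
      W x    : A → Carrier
      h-mono : ∀ a {c d} → c ≤ d → h a c ≤ h a d
      c≤h    : ∀ a c → c ≤ h a c
      W≤h    : ∀ a c → W a + (c - x a * c) ≤ h a c
      0≤x    : ∀ a → 0# ≤ x a

    h-cong : ∀ a {c d} → c ≈ d → h a c ≈ h a d
    h-cong a c≈d = antisym (h-mono a (≤-reflexive c≈d)) (h-mono a (≤-reflexive (sym c≈d)))

    -- Backward induction, the next arrival being uniform over those listed in R. In the application
    -- x a is the probability that a brings a candidate and W a the expected weight it brings, so
    -- `W≤h` compares with taking every candidate and `c≤h` with taking none.
    value : ∀ {t} → Vec A t → Carrier
    value {zero}  R = 0#
    value {suc t} R = fromℕ (suc t) ⁻¹ * pickSum (λ a r → h a (value r)) R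

    value-step : ∀ {t} (R : Vec A (suc t)) →
                 fromℕ (suc t) * value R ≈ pickSum (λ a r → h a (value r)) R
    value-step {t} R = *-suc⁻¹-cancel t _

    -- The expected value of R after k random arrivals have been passed by.
    delayed : ℕ → ∀ {t} → Vec A t → Carrier
    delayed zero    R = value R
    delayed (suc k) {zero}  R = 0#
    delayed (suc k) {suc t} R = fromℕ (suc t) ⁻¹ * pickSum (λ _ r → delayed k r) R

    delayed-step : ∀ k {t} (R : Vec A (suc t)) →
                   fromℕ (suc t) * delayed (suc k) R ≈ pickSum (λ _ r → delayed k r) R
    delayed-step k {t} R = *-suc⁻¹-cancel t _

    private
      suc-* : ∀ n c → c + fromℕ n * c ≈ fromℕ (suc n) * c
      suc-* n c = solve 2 (λ c n → c :+ n :* c := (con (1 , 0) :+ n) :* c) refl c (fromℕ n)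

    pickSum-nonneg : ∀ {t} {φ : A → Vec A t → Carrier} R → (∀ a r → 0# ≤ φ a r) → 0# ≤ pickSum φ R
    pickSum-nonneg {φ = φ} R 0≤φ =
      ≤-trans (≤-reflexive (sym (trans (pickSum-const 0# R) (zeroʳ _)))) (pickSum-mono R λ {a} {r} _ → 0≤φ a r)

    value-nonneg : ∀ {t} (R : Vec A t) → 0# ≤ value R
    value-nonneg {zero}  R = ≤-refl
    value-nonneg {suc t} R =
      *-nonneg (0≤suc⁻¹ t) (pickSum-nonneg R λ a r → ≤-trans (value-nonneg r) (c≤h a (value r)))

    delayed-nonneg : ∀ k {t} (R : Vec A t) → 0# ≤ delayed k R
    delayed-nonneg zero    R = value-nonneg R
    delayed-nonneg (suc k) {zero}  R = ≤-refl
    delayed-nonneg (suc k) {suc t} R = *-nonneg (0≤suc⁻¹ t) (pickSum-nonneg R λ _ → delayed-nonneg k)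

    -- When the additional arrival a comes first it can be passed by, which secures `value r`. When
    -- another one comes first, the remainders again differ by a, and the induction hypothesis
    -- applies.
    value-mono : ∀ {t a} {r : Vec A t} {R} → Pick a r R → value r ≤ value R
    value-mono {zero}  {R = R} p = value-nonneg R
    value-mono {suc t} {a} {r} {R} p = suc-*-cancelˡ-≤ (suc t) (begin
      fromℕ (2 ℕ.+ t) * value r                       ≈⟨ suc-* (suc t) (value r) ⟨
      value r + fromℕ (suc t) * value r               ≈⟨ +-congˡ (value-step r) ⟩
      value r + pickSum (λ b s → h b (value s)) r     ≤⟨ +-mono-≤ (c≤h a (value r)) ≤-refl ⟩
      h a (value r) + pickSum (λ b s → h b (value s)) r
        ≤⟨ pickSum-insert p (λ {b} q → h-mono b (value-mono q)) ⟩
      pickSum (λ b s → h b (value s)) R               ≈⟨ value-step R ⟨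
      fromℕ (2 ℕ.+ t) * value R                       ∎)

    -- The argument of `value-mono`, with one change: when a is the first arrival passed by,
    -- `delayed k r` is left, and this is at least `delayed (suc k) r` because another forced pass
    -- never helps.
    delayed-mono : ∀ k {t a} {r : Vec A t} {R} → Pick a r R → delayed k r ≤ delayed k R
    delayed-mono zero    p = value-mono p
    delayed-mono (suc k) {zero}  {R = R} p = delayed-nonneg (suc k) R
    delayed-mono (suc k) {suc t} {a} {r} {R} p = suc-*-cancelˡ-≤ (suc t) (begin
      fromℕ (2 ℕ.+ t) * delayed (suc k) r                    ≈⟨ suc-* (suc t) (delayed (suc k) r) ⟨
      delayed (suc k) r + fromℕ (suc t) * delayed (suc k) r  ≈⟨ +-congˡ (delayed-step k r) ⟩
      delayed (suc k) r + pickSum (λ _ s → delayed k s) r    ≤⟨ +-mono-≤ decreases ≤-refl ⟩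
      delayed k r + pickSum (λ _ s → delayed k s) r          ≤⟨ pickSum-insert p (λ q → delayed-mono k q) ⟩
      pickSum (λ _ s → delayed k s) R                        ≈⟨ delayed-step k R ⟨
      fromℕ (2 ℕ.+ t) * delayed (suc k) R                    ∎)
      where
      decreases : delayed (suc k) r ≤ delayed k r
      decreases = suc-*-cancelˡ-≤ t (begin
        fromℕ (suc t) * delayed (suc k) r     ≈⟨ delayed-step k r ⟩
        pickSum (λ _ s → delayed k s) r       ≤⟨ pickSum-mono r (λ q → delayed-mono k q) ⟩
        pickSum (λ _ _ → delayed k r) r       ≈⟨ pickSum-const (delayed k r) r ⟩
        fromℕ (suc t) * delayed k r           ∎)

    delayed-exhausted : ∀ {t} (R : Vec A t) → delayed t R ≈ 0#
    delayed-exhausted {zero}  R = refl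
    delayed-exhausted {suc t} R = begin-equality
      fromℕ (suc t) ⁻¹ * pickSum (λ _ r → delayed t r) R   ≈⟨ *-congˡ (pickSum-cong R λ {_} {r} _ → delayed-exhausted r) ⟩
      fromℕ (suc t) ⁻¹ * pickSum (λ _ _ → 0#) R            ≈⟨ *-congˡ (trans (pickSum-const 0# R) (zeroʳ _)) ⟩
      fromℕ (suc t) ⁻¹ * 0#                                ≈⟨ zeroʳ _ ⟩
      0#                                                   ∎

    -- For k = 0 the right side is the sum of h a (value r) - value r, and `W≤h` bounds it term by
    -- term. For larger k both sides are averaged over the first arrival passed by. The bound k ≤ t
    -- ensures that there are k + 1 arrivals to pass by.
    delayed-gap : ∀ k {t} (R : Vec A (suc t)) → k ℕ.≤ t →
                  pickSum (λ a r → W a - x a * delayed k r) R ≤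
                  fromℕ (suc t) * (delayed k R - delayed (suc k) R)
    delayed-gap zero {t} R _ = begin
      pickSum (λ a r → W a - x a * value r) R
        ≤⟨ pickSum-mono R (λ {a} {r} _ → gap a (value r)) ⟩
      pickSum (λ a r → h a (value r) - value r) R
        ≈⟨ pickSum-sub _ _ R ⟩
      pickSum (λ a r → h a (value r)) R - pickSum (λ _ r → value r) R
        ≈⟨ +-cong (value-step R) (-‿cong (delayed-step zero R)) ⟨
      fromℕ (suc t) * value R - fromℕ (suc t) * delayed 1 R
        ≈⟨ solve 3 (λ n a b → n :* a :- n :* b := n :* (a :- b)) refl _ _ _ ⟩
      fromℕ (suc t) * (value R - delayed 1 R) ∎
      where
      gap : ∀ a c → W a - x a * c ≤ h a c - c
      gap a c = ≤-resp-≈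
        (solve 3 (λ w c y → :- c :+ (w :+ (c :- y)) := w :- y) refl (W a) c (x a * c))
        (+-comm (- c) (h a c)) (+-monoʳ-≤ (- c) (W≤h a c))
    delayed-gap (suc k) {suc t} R (ℕ.s≤s k≤t) = suc-*-cancelˡ-≤ t (begin
      n * pickSum (λ a r → W a - x a * delayed (suc k) r) R
        ≈⟨ pickSum-scale n _ R ⟨
      pickSum (λ a r → n * (W a - x a * delayed (suc k) r)) R
        ≈⟨ pickSum-cong R (λ {a} {r} _ → spread a r) ⟩
      pickSum (λ a r → pickSum (λ _ s → W a - x a * delayed k s) r) R
        -- The arrival a that is counted and the one passed by change places, so that the induction
        -- hypothesis applies to what the latter leaves.
        ≈⟨ pickSum-comm (λ a _ s → W a - x a * delayed k s) R ⟩
      pickSum (λ _ r → pickSum (λ a s → W a - x a * delayed k s) r) R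
        ≤⟨ pickSum-mono R (λ {_} {r} _ → delayed-gap k r k≤t) ⟩
      pickSum (λ _ r → n * (delayed k r - delayed (suc k) r)) R
        ≈⟨ pickSum-scale n _ R ⟩
      n * pickSum (λ _ r → delayed k r - delayed (suc k) r) R
        ≈⟨ *-congˡ (pickSum-sub _ _ R) ⟩
      n * (pickSum (λ _ r → delayed k r) R - pickSum (λ _ r → delayed (suc k) r) R)
        ≈⟨ *-congˡ (+-cong (delayed-step k R) (-‿cong (delayed-step (suc k) R))) ⟨
      n * (N * delayed (suc k) R - N * delayed (2 ℕ.+ k) R)
        ≈⟨ *-congˡ (solve 3 (λ n a b → n :* a :- n :* b := n :* (a :- b)) refl _ _ _) ⟩
      n * (N * (delayed (suc k) R - delayed (2 ℕ.+ k) R)) ∎)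
      where
      n = fromℕ (suc t)
      N = fromℕ (2 ℕ.+ t)
      spread : ∀ a r → n * (W a - x a * delayed (suc k) r) ≈ pickSum (λ _ s → W a - x a * delayed k s) r
      spread a r = begin-equality
        n * (W a - x a * delayed (suc k) r)
          ≈⟨ solve 4 (λ n w x d → n :* (w :- x :* d) := n :* w :- x :* (n :* d)) refl n (W a) (x a) _ ⟩
        n * W a - x a * (n * delayed (suc k) r)
          ≈⟨ +-cong (sym (pickSum-const (W a) r)) (-‿cong (*-congˡ (delayed-step k r))) ⟩
        pickSum (λ _ _ → W a) r - x a * pickSum (λ _ s → delayed k s) r
          ≈⟨ +-congˡ (-‿cong (pickSum-scale (x a) _ r)) ⟨
        pickSum (λ _ _ → W a) r - pickSum (λ _ s → x a * delayed k s) r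
          ≈⟨ pickSum-sub _ _ r ⟨
        pickSum (λ _ s → W a - x a * delayed k s) r ∎

    value-shortfall : ∀ {t} (R : Vec A (suc t)) → sum (x ∘ lookup R) ≤ 1# →
                      (1# + fromℕ (suc t) ⁻¹) ^ suc t * (sum (W ∘ lookup R) - value R) ≤ sum (W ∘ lookup R)
    value-shortfall {t} R ∑x≤1 = ≤-trans (power (suc t) ℕ.≤-refl)
      (≤-reflexive (trans (+-congˡ (trans (-‿cong (delayed-exhausted R)) -0#≈0#)) (+-identityʳ ∑W)))
      where
      ∑W = sum (W ∘ lookup R)
      N  = fromℕ (suc t)
      z  = 1# + N ⁻¹

      0≤z : 0# ≤ z
      0≤z = +-nonneg 0≤1 (0≤suc⁻¹ t)

      -- The budget on x distributes one copy of `delayed k R` over the arrivals; monotonicity then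
      -- trades it for `delayed k r`, from which a is absent.
      gap : ∀ k → k ℕ.≤ t → ∑W - delayed k R ≤ N * (delayed k R - delayed (suc k) R)
      gap k k≤t = begin
        ∑W - delayed k R                               ≈⟨ +-congˡ (-‿cong (*-identityˡ _)) ⟨
        ∑W - 1# * delayed k R                          ≤⟨ +-monoʳ-≤ ∑W (neg-mono-≤ (*-monoʳ-≤ (delayed-nonneg k R) ∑x≤1)) ⟩
        ∑W - sum (x ∘ lookup R) * delayed k R          ≈⟨ +-cong (pickSum-heads W R) (-‿cong (trans (*-comm _ _) (*-congʳ (pickSum-heads x R)))) ⟨
        pickSum (λ a _ → W a) R - delayed k R * pickSum (λ a _ → x a) R
          ≈⟨ +-congˡ (-‿cong (pickSum-scale (delayed k R) _ R)) ⟨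
        pickSum (λ a _ → W a) R - pickSum (λ a _ → delayed k R * x a) R
          ≈⟨ pickSum-sub _ _ R ⟨
        pickSum (λ a _ → W a - delayed k R * x a) R
          ≤⟨ pickSum-mono R (λ {a} p → +-monoʳ-≤ (W a) (neg-mono-≤
               (≤-trans (*-monoˡ-≤ (0≤x a) (delayed-mono k p)) (≤-reflexive (*-comm _ _))))) ⟩
        pickSum (λ a r → W a - x a * delayed k r) R    ≤⟨ delayed-gap k R k≤t ⟩
        N * (delayed k R - delayed (suc k) R)          ∎

      grow : ∀ k → k ℕ.≤ t → z * (∑W - delayed k R) ≤ ∑W - delayed (suc k) R
      grow k k≤t = begin
        z * (∑W - delayed k R)
          ≈⟨ solve 2 (λ i d → (con (1 , 0) :+ i) :* d := d :+ i :* d) refl (N ⁻¹) _ ⟩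
        (∑W - delayed k R) + N ⁻¹ * (∑W - delayed k R)
          ≤⟨ +-monoʳ-≤ _ (*-monoˡ-≤ (0≤suc⁻¹ t) (gap k k≤t)) ⟩
        (∑W - delayed k R) + N ⁻¹ * (N * (delayed k R - delayed (suc k) R))
          ≈⟨ +-congˡ (suc⁻¹-*-cancel t _) ⟩
        (∑W - delayed k R) + (delayed k R - delayed (suc k) R)
          ≈⟨ solve 3 (λ w a b → (w :- a) :+ (a :- b) := w :- b) refl _ _ _ ⟩
        ∑W - delayed (suc k) R ∎

      power : ∀ k → k ℕ.≤ suc t → z ^ k * (∑W - value R) ≤ ∑W - delayed k R
      power zero    _           = ≤-reflexive (*-identityˡ _)
      power (suc k) (ℕ.s≤s k≤t) = begin
        z * z ^ k * (∑W - value R)     ≈⟨ *-assoc z (z ^ k) _ ⟩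
        z * (z ^ k * (∑W - value R))   ≤⟨ *-monoˡ-≤ 0≤z (power k (ℕ.m≤n⇒m≤1+n k≤t)) ⟩
        z * (∑W - delayed k R)         ≤⟨ grow k k≤t ⟩
        ∑W - delayed (suc k) R         ∎

  -- The entry `nothing` brings no candidate and `h` is the identity on it, but it counts as an
  -- arrival in the shortfall inequality. So N becomes a free parameter.
  withDummy : ∀ {A} → Rewards A → Rewards (Maybe A)
  withDummy 𝓡 = record
    { h      = λ { nothing c → c ; (just a) c → h a c }
    ; W      = λ { nothing → 0# ; (just a) → W a }
    ; x      = λ { nothing → 0# ; (just a) → x a }
    ; h-mono = λ { nothing c≤d → c≤d ; (just a) c≤d → h-mono a c≤d }
    ; c≤h    = λ { nothing c → ≤-refl ; (just a) c → c≤h a c }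
    ; W≤h    = λ { nothing c → ≤-reflexive (solve 1 (λ c → con (0 , 0) :+ (c :- con (0 , 0) :* c) := c) refl c)
                 ; (just a) c → W≤h a c }
    ; 0≤x    = λ { nothing → ≤-refl ; (just a) → 0≤x a }
    }
    where open Rewards 𝓡

  module _ {A : Set} (𝓡 : Rewards A) where

    private
      module R = Rewards 𝓡
      module D = Rewards (withDummy 𝓡)

    value-map-just : ∀ {t} (r : Vec A t) → D.value (Vec.map just r) ≈ R.value r
    value-map-just {zero}  r = refl
    value-map-just {suc t} r = *-congˡ (trans (pickSum-map just _ r)
      (pickSum-cong r λ {a} {s} _ → R.h-cong a (value-map-just s)))

    -- Of the t + 2 equally likely first arrivals, the dummy leaves r itself; after any other one
    -- the induction hypothesis drops the dummy. This makes 1 + (t + 1) copies of the value of r,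
    -- divided by t + 2.
    value-dummy : ∀ {t} (r : Vec (Maybe A) t) → D.value (nothing ∷ r) ≈ D.value r
    value-dummy {zero} []  = trans (*-congˡ refl) (zeroʳ _)
    value-dummy {suc t} r  = begin-equality
      n ⁻¹ * (D.value r + pickSum (λ a s → D.h a (D.value (nothing ∷ s))) r)
        ≈⟨ *-congˡ (+-congˡ (pickSum-cong r λ {a} {s} _ → D.h-cong a (value-dummy s))) ⟩
      n ⁻¹ * (D.value r + pickSum (λ a s → D.h a (D.value s)) r)
        ≈⟨ *-congˡ (+-congˡ (D.value-step r)) ⟨
      n ⁻¹ * (D.value r + fromℕ (suc t) * D.value r)
        ≈⟨ *-congˡ (solve 2 (λ c n → c :+ n :* c := (con (1 , 0) :+ n) :* c) refl _ _) ⟩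
      n ⁻¹ * (n * D.value r)
        ≈⟨ suc⁻¹-*-cancel (suc t) _ ⟩
      D.value r ∎
      where n = fromℕ (2 ℕ.+ t)

    padded : ∀ d {t} → Vec A t → Vec (Maybe A) (d ℕ.+ t)
    padded zero    r = Vec.map just r
    padded (suc d) r = nothing ∷ padded d r

    value-padded : ∀ d {t} (r : Vec A t) → D.value (padded d r) ≈ R.value r
    value-padded zero    r = value-map-just r
    value-padded (suc d) r = trans (value-dummy (padded d r)) (value-padded d r)

    sum-padded : ∀ d {t} (r : Vec A t) (g : Maybe A → Carrier) → g nothing ≈ 0# →
                 sum (g ∘ lookup (padded d r)) ≈ sum (g ∘ just ∘ lookup r)
    sum-padded zero    []      g g0 = refl
    sum-padded zero    (a ∷ r) g g0 = +-congˡ (sum-padded zero r g g0)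
    sum-padded (suc d) r       g g0 = trans (+-cong g0 (sum-padded d r g g0)) (+-identityˡ _)

    -- One dummy more than d keeps the vector nonempty even when r is empty, as `value-shortfall`
    -- demands.
    value-padded-shortfall : ∀ d {t} (r : Vec A t) → sum (R.x ∘ lookup r) ≤ 1# →
      (1# + fromℕ (suc (d ℕ.+ t)) ⁻¹) ^ suc (d ℕ.+ t) * (sum (R.W ∘ lookup r) - R.value r) ≤
      sum (R.W ∘ lookup r)
    value-padded-shortfall d r ∑x≤1 = ≤-resp-≈
      (*-congˡ (+-cong (sum-padded (suc d) r D.W refl) (-‿cong (value-padded (suc d) r))))
      (sum-padded (suc d) r D.W refl)
      (D.value-shortfall (padded (suc d) r)
        (≤-trans (≤-reflexive (sum-padded (suc d) r D.x refl)) ∑x≤1))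

  -- The limit of (1 + 1/N)^N

  -- The Archimedean property.
  multiples-bounded⇒≤0 : ∀ {ε c} → (∀ n → fromℕ n * ε ≤ c) → ε ≤ 0#
  multiples-bounded⇒≤0 {ε} {c} bounded with complete (λ y → ∃ λ n → y ≈ fromℕ n * ε)
      (0# * ε , 0 , refl) (c , λ { y (n , y≈) → ≤-trans (≤-reflexive y≈) (bounded n) })
  -- For the supremum s of the multiples of ε, s - ε is an upper bound as well, because y + ε is the
  -- next multiple after y. Hence s ≤ s - ε.
  ... | s , above , least = ≤-resp-≈
    (solve 2 (λ s ε → s :- (s :- ε) := ε) refl s ε) (-‿inverseʳ (s - ε))
    (≤-resp-≈ (+-comm _ _) (+-comm _ _) (+-monoʳ-≤ (- (s - ε)) (least (s - ε) λ { y (n , y≈) → begin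
      y                                ≈⟨ solve 2 (λ y ε → y := (:- ε) :+ (y :+ ε)) refl y ε ⟩
      - ε + (y + ε)                    ≤⟨ +-monoʳ-≤ (- ε) (above (y + ε) (suc n , (begin-equality
        y + ε                            ≈⟨ +-congʳ y≈ ⟩
        fromℕ n * ε + ε                  ≈⟨ solve 2 (λ n ε → n :* ε :+ ε := (con (1 , 0) :+ n) :* ε) refl (fromℕ n) ε ⟩
        fromℕ (suc n) * ε                ∎))) ⟩
      - ε + s                          ≈⟨ +-comm (- ε) s ⟩
      s - ε                            ∎ })))

  ^-nonneg : ∀ {x} → 0# ≤ x → ∀ k → 0# ≤ x ^ k
  ^-nonneg 0≤x zero    = 0≤1
  ^-nonneg 0≤x (suc k) = *-nonneg 0≤x (^-nonneg 0≤x k)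

  1≤^ : ∀ {x} → 1# ≤ x → ∀ k → 1# ≤ x ^ k
  1≤^ 1≤x zero    = ≤-refl
  1≤^ {x} 1≤x (suc k) = begin
    1#          ≤⟨ 1≤x ⟩
    x           ≈⟨ *-identityʳ x ⟨
    x * 1#      ≤⟨ *-monoˡ-≤ (≤-trans 0≤1 1≤x) (1≤^ 1≤x k) ⟩
    x * x ^ k   ∎

  -- Convexity of powers: the tangent at y + i lies below the graph.
  ^-tangent : ∀ {y i} → 0# ≤ y → 0# ≤ i → ∀ m →
              (y + i) ^ suc m ≤ y ^ suc m + i * (fromℕ (suc m) * (y + i) ^ m)
  ^-tangent {y} {i} 0≤y 0≤i zero = ≤-reflexive
    (solve 2 (λ y i → (y :+ i) :* con (1 , 0) := y :* con (1 , 0) :+ i :* ((con (1 , 0) :+ con (0 , 0)) :* con (1 , 0))) refl y i)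
  ^-tangent {y} {i} 0≤y 0≤i (suc m) = begin
    (y + i) * P
      ≈⟨ distribʳ P y i ⟩
    y * P + i * P
      ≤⟨ +-mono-≤ (*-monoˡ-≤ 0≤y (^-tangent 0≤y 0≤i m)) ≤-refl ⟩
    y * (y ^ suc m + i * (fromℕ (suc m) * Q)) + i * P
      ≈⟨ solve 6 (λ y r i n q p → y :* (r :+ i :* (n :* q)) :+ i :* p := y :* r :+ i :* (n :* (y :* q) :+ p)) refl y (y ^ suc m) i (fromℕ (suc m)) Q P ⟩
    y ^ (2 ℕ.+ m) + i * (fromℕ (suc m) * (y * Q) + P)
      ≤⟨ +-monoʳ-≤ _ (*-monoˡ-≤ 0≤i (+-mono-≤ (*-monoˡ-≤ (0≤fromℕ (suc m))
           (*-monoʳ-≤ (^-nonneg (+-nonneg 0≤y 0≤i) m) (x≤x+y 0≤i))) ≤-refl)) ⟩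
    y ^ (2 ℕ.+ m) + i * (fromℕ (suc m) * P + P)
      ≈⟨ +-congˡ (*-congˡ (solve 2 (λ n p → n :* p :+ p := (con (1 , 0) :+ n) :* p) refl (fromℕ (suc m)) P)) ⟩
    y ^ (2 ℕ.+ m) + i * (fromℕ (2 ℕ.+ m) * P) ∎
    where
    P = (y + i) ^ suc m
    Q = (y + i) ^ m

  1≤fromℕ! : ∀ k → 1# ≤ fromℕ (k !)
  1≤fromℕ! k = 1≤fromℕ (k !) {{ℕ._!≢0 k}}

  0≤1/! : ∀ k → 0# ≤ 1/! k
  0≤1/! k = 1≤x⇒0≤x⁻¹ (1≤fromℕ! k)

  !-inverse : ∀ k → fromℕ (k !) * 1/! k ≈ 1#
  !-inverse k = *-inverseʳ (1≤x⇒x≉0 (1≤fromℕ! k))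

  suc-*-1/! : ∀ k → fromℕ (suc k) * 1/! (suc k) ≈ 1/! k
  suc-*-1/! k = begin-equality
    N * b                         ≈⟨ *-identityˡ _ ⟨
    1# * (N * b)                  ≈⟨ *-congʳ (!-inverse k) ⟨
    F * 1/! k * (N * b)           ≈⟨ solve 4 (λ f c n b → f :* c :* (n :* b) := n :* f :* b :* c) refl F (1/! k) N b ⟩
    N * F * b * 1/! k             ≈⟨ *-congʳ (*-congʳ (fromℕ-* (suc k) (k !))) ⟨
    fromℕ (suc k !) * b * 1/! k   ≈⟨ *-congʳ (!-inverse (suc k)) ⟩
    1# * 1/! k                    ≈⟨ *-identityˡ _ ⟩
    1/! k                         ∎
    where
    N = fromℕ (suc k)
    F = fromℕ (k !)
    b = 1/! (suc k)

  -- The Taylor polynomials of exp at 0, k being the number of terms. The argument y is variable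
  -- because the comparison with powers walks from 0 to 1 in steps of length 1/N.
  expSumAt : ℕ → Carrier → Carrier
  expSumAt zero    y = 0#
  expSumAt (suc k) y = expSumAt k y + y ^ k * 1/! k

  expSumAt-cong : ∀ k {y z} → y ≈ z → expSumAt k y ≈ expSumAt k z
  expSumAt-cong zero    y≈z = refl
  expSumAt-cong (suc k) y≈z = +-cong (expSumAt-cong k y≈z) (*-congʳ (^-congˡ k y≈z))

  1^k≈1 : ∀ k → 1# ^ k ≈ 1#
  1^k≈1 zero    = refl
  1^k≈1 (suc k) = trans (*-identityˡ _) (1^k≈1 k)

  expSumAt-1 : ∀ k → expSumAt k 1# ≈ expSum k
  expSumAt-1 zero    = refl
  expSumAt-1 (suc k) = +-cong (expSumAt-1 k) (trans (*-congʳ (1^k≈1 k)) (*-identityˡ _))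

  1/!0≈1 : 1/! 0 ≈ 1#
  1/!0≈1 = trans (sym (trans (*-congʳ (+-identityʳ 1#)) (*-identityˡ _))) (!-inverse 0)

  expSumAt-0 : ∀ k → expSumAt k 0# ≤ 1#
  expSumAt-0 zero          = 0≤1
  expSumAt-0 (suc zero)    = ≤-reflexive (trans (+-identityˡ _) (trans (*-identityˡ _) 1/!0≈1))
  expSumAt-0 (suc (suc k)) = ≤-trans
    (≤-reflexive (trans (+-congˡ (trans (*-congʳ (zeroˡ _)) (zeroˡ _))) (+-identityʳ _))) (expSumAt-0 (suc k))

  -- Convexity again: the derivative of a Taylor polynomial of exp is the one with a term less, and
  -- the tangent at y + i lies below the graph. Obtained from `^-tangent` term by term.
  expSumAt-tangent : ∀ {y i} → 0# ≤ y → 0# ≤ i → ∀ k →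
                     expSumAt (suc k) (y + i) ≤ expSumAt (suc k) y + i * expSumAt k (y + i)
  expSumAt-tangent {y} {i} 0≤y 0≤i zero = x≤x+y (≤-reflexive (sym (zeroʳ i)))
  expSumAt-tangent {y} {i} 0≤y 0≤i (suc k) = begin
    expSumAt (suc k) (y + i) + (y + i) ^ suc k * b
      ≤⟨ +-mono-≤ (expSumAt-tangent 0≤y 0≤i k) (*-monoʳ-≤ (0≤1/! (suc k)) (^-tangent 0≤y 0≤i k)) ⟩
    (expSumAt (suc k) y + i * expSumAt k (y + i)) + (y ^ suc k + i * (N * Q)) * b
      ≈⟨ solve 7 (λ s i u p n q b → (s :+ i :* u) :+ (p :+ i :* (n :* q)) :* b := (s :+ p :* b) :+ i :* (u :+ q :* (n :* b)))
           refl (expSumAt (suc k) y) i (expSumAt k (y + i)) (y ^ suc k) N Q b ⟩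
    (expSumAt (suc k) y + y ^ suc k * b) + i * (expSumAt k (y + i) + Q * (N * b))
      ≈⟨ +-congˡ (*-congˡ (+-congˡ (*-congˡ (suc-*-1/! k)))) ⟩
    (expSumAt (suc k) y + y ^ suc k * b) + i * (expSumAt k (y + i) + Q * 1/! k) ∎
    where
    N = fromℕ (suc k)
    b = 1/! (suc k)
    Q = (y + i) ^ k

  -- A step of length i raises the polynomial by at most i times the one with a term less, while the
  -- power gains the factor 1 + i. The extra exponent K makes the induction close: lowering K and
  -- raising k preserves k + K.
  expSumAt≤^ : ∀ {i} → 0# ≤ i → ∀ K k → expSumAt K (fromℕ k * i) ≤ (1# + i) ^ (k ℕ.+ K)
  expSumAt≤^ 0≤i zero    k    = ^-nonneg (+-nonneg 0≤1 0≤i) (k ℕ.+ 0)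
  expSumAt≤^ {i} 0≤i (suc K) zero = begin
    expSumAt (suc K) (0# * i)   ≈⟨ expSumAt-cong (suc K) (zeroˡ i) ⟩
    expSumAt (suc K) 0#         ≤⟨ expSumAt-0 (suc K) ⟩
    1#                          ≤⟨ 1≤^ (x≤x+y 0≤i) (suc K) ⟩
    (1# + i) ^ suc K            ∎
  expSumAt≤^ {i} 0≤i (suc K) (suc k) = begin
    expSumAt (suc K) (fromℕ (suc k) * i)
      ≈⟨ expSumAt-cong (suc K) step ⟩
    expSumAt (suc K) (y + i)
      ≤⟨ expSumAt-tangent (*-nonneg (0≤fromℕ k) 0≤i) 0≤i K ⟩
    expSumAt (suc K) y + i * expSumAt K (y + i)
      ≈⟨ +-congˡ (*-congˡ (expSumAt-cong K step)) ⟨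
    expSumAt (suc K) y + i * expSumAt K (fromℕ (suc k) * i)
      ≤⟨ +-mono-≤ (expSumAt≤^ 0≤i (suc K) k) (*-monoˡ-≤ 0≤i (expSumAt≤^ 0≤i K (suc k))) ⟩
    (1# + i) ^ (k ℕ.+ suc K) + i * (1# + i) ^ (suc k ℕ.+ K)
      ≡⟨ ≡.cong (λ j → (1# + i) ^ (k ℕ.+ suc K) + i * (1# + i) ^ j) (≡.sym (ℕ.+-suc k K)) ⟩
    (1# + i) ^ (k ℕ.+ suc K) + i * (1# + i) ^ (k ℕ.+ suc K)
      ≈⟨ solve 2 (λ p i → p :+ i :* p := (con (1 , 0) :+ i) :* p) refl _ i ⟩
    (1# + i) ^ (suc k ℕ.+ suc K) ∎
    where
    y = fromℕ k * i
    step : fromℕ (suc k) * i ≈ y + i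
    step = solve 2 (λ k i → (con (1 , 0) :+ k) :* i := k :* i :+ i) refl (fromℕ k) i

  expSum≤^ : ∀ K n → expSum K ≤ (1# + fromℕ (suc n) ⁻¹) ^ (suc n ℕ.+ K)
  expSum≤^ K n = ≤-trans
    (≤-reflexive (sym (trans (expSumAt-cong K (suc-inverseʳ n)) (expSumAt-1 K))))
    (expSumAt≤^ (0≤suc⁻¹ n) K (suc n))

  -- Needed for the extra exponent K in `expSum≤^`: the factor (1 + 1/N)^K that it causes differs
  -- from 1 only by a multiple of 1/N.
  ^-linear-bound : ∀ K → ∃ λ c → 0# ≤ c × (∀ i → 0# ≤ i → i ≤ 1# → (1# + i) ^ K ≤ 1# + c * i)
  ^-linear-bound zero    = 0# , ≤-refl , λ i _ _ → x≤x+y (≤-reflexive (sym (zeroˡ i)))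
  ^-linear-bound (suc K) with ^-linear-bound K
  -- The product is 1 + (1 + c) i + c i², and c i² ≤ c i because i ≤ 1.
  ... | c , 0≤c , bound = 1# + (c + c) , +-nonneg 0≤1 (+-nonneg 0≤c 0≤c) , λ i 0≤i i≤1 → begin
    (1# + i) * (1# + i) ^ K   ≤⟨ *-monoˡ-≤ (+-nonneg 0≤1 0≤i) (bound i 0≤i i≤1) ⟩
    (1# + i) * (1# + c * i)   ≈⟨ solve 2 (λ i c → (con (1 , 0) :+ i) :* (con (1 , 0) :+ c :* i) :=
                                   (con (1 , 0) :+ (i :+ c :* i)) :+ c :* i :* i) refl i c ⟩
    (1# + (i + c * i)) + c * i * i    ≤⟨ +-monoʳ-≤ _ (*-monoˡ-≤ (*-nonneg 0≤c 0≤i) i≤1) ⟩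
    (1# + (i + c * i)) + c * i * 1#   ≈⟨ solve 2 (λ i c → (con (1 , 0) :+ (i :+ c :* i)) :+ c :* i :* con (1 , 0) :=
                                           con (1 , 0) :+ (con (1 , 0) :+ (c :+ c)) :* i) refl i c ⟩
    1# + (1# + (c + c)) * i ∎

  suc⁻¹≤1 : ∀ n → fromℕ (suc n) ⁻¹ ≤ 1#
  suc⁻¹≤1 n = suc-*-cancelˡ-≤ n (≤-trans (≤-reflexive (suc-inverseʳ n))
    (≤-trans (x≤x+y (0≤fromℕ n)) (≤-reflexive (sym (*-identityʳ _)))))

  fromℕ-mono : ∀ {m n} → m ℕ.≤ n → fromℕ m ≤ fromℕ n
  fromℕ-mono {n = n} ℕ.z≤n = 0≤fromℕ n
  fromℕ-mono (ℕ.s≤s p)     = +-monoʳ-≤ 1# (fromℕ-mono p)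

  -- With z = 1 + 1/N, expSum K is at most z^N z^K, where z^N is covered by the hypothesis and z^K ≤
  -- 1 + c/N. So a nonnegative excess ε of expSum K * D over B satisfies N ε ≤ B c for arbitrarily
  -- large N, and the Archimedean property leaves only ε = 0.
  compound-interest-limit : ∀ {D B} t → 0# ≤ D → 0# ≤ B →
    (∀ d → (1# + fromℕ (suc (d ℕ.+ t)) ⁻¹) ^ suc (d ℕ.+ t) * D ≤ B) → ∀ K → expSum K * D ≤ B
  compound-interest-limit {D} {B} t 0≤D 0≤B bounded K with total (expSum K * D - B) 0# | ^-linear-bound K
  ... | inj₁ ε≤0 | _ = ≤-resp-≈ (solve 2 (λ a b → b :+ (a :- b) := a) refl _ B) (+-identityʳ B) (+-monoʳ-≤ B ε≤0)
  ... | inj₂ 0≤ε | c , 0≤c , linear = ≤-resp-≈ (solve 2 (λ a b → b :+ (a :- b) := a) refl _ B) (+-identityʳ B)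
    (+-monoʳ-≤ B (multiples-bounded⇒≤0 multiple≤))
    where
    ε = expSum K * D - B
    multiple≤ : ∀ n → fromℕ n * ε ≤ B * c
    multiple≤ d = begin
      fromℕ d * ε         ≤⟨ *-monoʳ-≤ 0≤ε (fromℕ-mono (ℕ.m≤n⇒m≤1+n (ℕ.m≤m+n d t))) ⟩
      N * ε               ≤⟨ *-monoˡ-≤ (0≤fromℕ (suc n)) (+-mono-≤ (begin
        expSum K * D                ≤⟨ *-monoʳ-≤ 0≤D (expSum≤^ K n) ⟩
        z ^ (suc n ℕ.+ K) * D       ≈⟨ *-congʳ (^-homo-* z (suc n) K) ⟩
        z ^ suc n * z ^ K * D       ≈⟨ solve 3 (λ a b d → a :* b :* d := b :* (a :* d)) refl _ _ _ ⟩
        z ^ K * (z ^ suc n * D)     ≤⟨ *-monoˡ-≤ (^-nonneg (+-nonneg 0≤1 (0≤suc⁻¹ n)) K) (bounded d) ⟩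
        z ^ K * B                   ≤⟨ *-monoʳ-≤ 0≤B (linear (N ⁻¹) (0≤suc⁻¹ n) (suc⁻¹≤1 n)) ⟩
        (1# + c * N ⁻¹) * B         ∎) ≤-refl) ⟩
      N * ((1# + c * N ⁻¹) * B - B)
        ≈⟨ solve 4 (λ n c i b → n :* ((con (1 , 0) :+ c :* i) :* b :- b) := n :* (i :* (b :* c))) refl N c (N ⁻¹) B ⟩
      N * (N ⁻¹ * (B * c))   ≈⟨ *-suc⁻¹-cancel n _ ⟩
      B * c               ∎
      where
      n = d ℕ.+ t
      N = fromℕ (suc n)
      z = 1# + N ⁻¹

  -- From the shortfall inequality to the factor 1 - 1/e

  ⁻¹-nonneg : ∀ {x} → 0# ≤ x → ¬ x ≈ 0# → 0# ≤ x ⁻¹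
  ⁻¹-nonneg {x} 0≤x x≉0 with total 0# (x ⁻¹)
  ... | inj₁ p = p
  ... | inj₂ p = ⊥-elim (0≉1 (antisym 0≤1 (≤-resp-≈ (*-inverseʳ x≉0) (zeroʳ x) (*-monoˡ-≤ 0≤x p))))

  expSum≤e : ∀ K → expSum K ≤ e
  expSum≤e K = proj₁ (proj₂ e-exists) (expSum K) (K , refl)

  1≤e : 1# ≤ e
  1≤e = ≤-trans (≤-reflexive (trans (sym 1/!0≈1) (sym (+-identityˡ _)))) (expSum≤e 1)

  0≤e⁻¹ : 0# ≤ e ⁻¹
  0≤e⁻¹ = 1≤x⇒0≤x⁻¹ 1≤e

  -- As `e` is known only as a supremum, D is moved to the other side, where B * D ⁻¹ bounds all
  -- partial sums. The division sets the case D = 0 apart.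
  e-*-≤ : ∀ {D B} → 0# ≤ D → 0# ≤ B → (∀ K → expSum K * D ≤ B) → e * D ≤ B
  e-*-≤ {D} {B} 0≤D 0≤B bounded with D ≟ 0#
  ... | yes D≈0 = ≤-trans (≤-reflexive (trans (*-congˡ D≈0) (zeroʳ e))) 0≤B
  ... | no  D≉0 = begin
    e * D               ≤⟨ *-monoʳ-≤ 0≤D (proj₂ (proj₂ e-exists) (B * D ⁻¹) λ { y (K , y≈) → begin
      y                   ≈⟨ y≈ ⟩
      expSum K            ≈⟨ *-identityʳ _ ⟨
      expSum K * 1#       ≈⟨ *-congˡ (*-inverseʳ D≉0) ⟨
      expSum K * (D * D ⁻¹) ≈⟨ *-assoc _ D (D ⁻¹) ⟨
      expSum K * D * D ⁻¹ ≤⟨ *-monoʳ-≤ (⁻¹-nonneg 0≤D D≉0) (bounded K) ⟩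
      B * D ⁻¹            ∎ }) ⟩
    B * D ⁻¹ * D        ≈⟨ solve 3 (λ b i d → b :* i :* d := b :* (d :* i)) refl B (D ⁻¹) D ⟩
    B * (D * D ⁻¹)      ≈⟨ *-congˡ (*-inverseʳ D≉0) ⟩
    B * 1#              ≈⟨ *-identityʳ B ⟩
    B                   ∎

  -- This is e (∑W - v) ≤ ∑W solved for v. A negative shortfall is treated apart, since the limit
  -- argument multiplies inequalities by it.
  value-bound : ∀ {A} (𝓡 : Rewards A) (let open Rewards 𝓡) {t} (R : Vec A t) →
                (∀ a → 0# ≤ W a) → sum (x ∘ lookup R) ≤ 1# →
                (1# - e ⁻¹) * sum (W ∘ lookup R) ≤ value R
  value-bound 𝓡 {t} R 0≤W ∑x≤1 with total (∑W - value R) 0#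
    where
    open Rewards 𝓡
    ∑W = sum (W ∘ lookup R)
  ... | inj₁ D≤0 = begin
    (1# - e ⁻¹) * ∑W            ≈⟨ solve 2 (λ i w → (con (1 , 0) :- i) :* w := w :- i :* w) refl (e ⁻¹) ∑W ⟩
    ∑W - e ⁻¹ * ∑W              ≤⟨ +-monoʳ-≤ ∑W (neg-mono-≤ (*-nonneg 0≤e⁻¹ 0≤∑W)) ⟩
    ∑W - 0#                     ≈⟨ solve 2 (λ w v → w :- con (0 , 0) := v :+ (w :- v)) refl ∑W (value R) ⟩
    value R + (∑W - value R)    ≤⟨ +-monoʳ-≤ _ D≤0 ⟩
    value R + 0#                ≈⟨ +-identityʳ _ ⟩
    value R                     ∎
    where
    open Rewards 𝓡
    ∑W = sum (W ∘ lookup R)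
    0≤∑W = sum-nonneg {f = W ∘ lookup R} (0≤W ∘ lookup R)
  ... | inj₂ 0≤D = begin
    (1# - e ⁻¹) * ∑W            ≈⟨ solve 2 (λ i w → (con (1 , 0) :- i) :* w := w :- i :* w) refl (e ⁻¹) ∑W ⟩
    ∑W - e ⁻¹ * ∑W              ≤⟨ +-monoʳ-≤ ∑W (neg-mono-≤ (*-monoˡ-≤ 0≤e⁻¹ eD≤W)) ⟩
    ∑W - e ⁻¹ * (e * D)         ≈⟨ +-congˡ (-‿cong (trans (*-swap _ e D) (trans (sym (*-assoc e _ D)) (trans (*-congʳ (*-inverseʳ (1≤x⇒x≉0 1≤e))) (*-identityˡ D))))) ⟩
    ∑W - D                      ≈⟨ solve 2 (λ w v → w :- (w :- v) := v) refl ∑W (value R) ⟩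
    value R                     ∎
    where
    open Rewards 𝓡
    ∑W = sum (W ∘ lookup R)
    D  = ∑W - value R
    0≤∑W = sum-nonneg {f = W ∘ lookup R} (0≤W ∘ lookup R)
    eD≤W : e * D ≤ ∑W
    eD≤W = e-*-≤ 0≤D 0≤∑W (compound-interest-limit t 0≤D 0≤∑W λ d → value-padded-shortfall 𝓡 d R ∑x≤1)

  -- Offline strategies

  mix : Probability → Carrier → Carrier → Carrier
  mix q x y = bernoulli q λ b → if b then x else y

  mix-cong : ∀ q {x x′ y y′} → x ≈ x′ → y ≈ y′ → mix q x y ≈ mix q x′ y′
  mix-cong q x≈x′ y≈y′ = +-cong (*-congˡ x≈x′) (*-congˡ y≈y′)

  mix-shift : ∀ q c x y → mix q (c + x) (c + y) ≈ c + mix q x y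
  mix-shift (q , _) = solve 4
    (λ q c x y → q :* (c :+ x) :+ (con (1 , 0) :- q) :* (c :+ y) := c :+ (q :* x :+ (con (1 , 0) :- q) :* y)) refl q

  mix-nonneg : ∀ q {x y} → 0# ≤ x → 0# ≤ y → 0# ≤ mix q x y
  mix-nonneg (_ , 0≤q , q≤1) 0≤x 0≤y = +-nonneg (*-nonneg 0≤q 0≤x) (*-nonneg (x≤y⇒0≤y-x q≤1) 0≤y)

  module _ {A : Set} where

    Linear-zero : Linear {A} (λ _ → 0#)
    Linear-zero = record
      { cong  = λ _ → refl
      ; add   = λ _ _ → sym (+-identityʳ 0#)
      ; scale = λ c _ → sym (zeroʳ c)
      }

    Linear-eval : ∀ a → Linear {A} (λ f → f a)
    Linear-eval a = record { cong = λ f≈g → f≈g a ; add = λ _ _ → refl ; scale = λ _ _ → refl }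

    Linear-+ : ∀ {E F : Functional A} → Linear E → Linear F → Linear (λ f → E f + F f)
    Linear-+ l k = record
      { cong  = λ f≈g → +-cong (Linear.cong l f≈g) (Linear.cong k f≈g)
      ; add   = λ f g → trans (+-cong (Linear.add l f g) (Linear.add k f g)) (+-interchange _ _ _ _)
      ; scale = λ c f → trans (+-cong (Linear.scale l c f) (Linear.scale k c f)) (sym (distribˡ c _ _))
      }

    Linear-* : ∀ a {E : Functional A} → Linear E → Linear (λ f → a * E f)
    Linear-* a l = record
      { cong  = λ f≈g → *-congˡ (Linear.cong l f≈g)
      ; add   = λ f g → trans (*-congˡ (Linear.add l f g)) (distribˡ a _ _)
      ; scale = λ c f → trans (*-congˡ (Linear.scale l c f)) (*-swap a c _)
      }

    Linear-commutes-mix : ∀ {E : Functional A} → Linear E → ∀ q f g →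
                          E (λ a → mix q (f a) (g a)) ≈ mix q (E f) (E g)
    Linear-commutes-mix l (q , _) f g =
      trans (Linear.add l _ _) (+-cong (Linear.scale l q f) (Linear.scale l (1# - q) g))

    Linear-commutes-sub : ∀ {E : Functional A} → Linear E → ∀ f g → E (λ a → f a - g a) ≈ E f - E g
    Linear-commutes-sub {E} l f g = begin-equality
      E (λ a → f a - g a)           ≈⟨ Linear.cong l (λ a → solve 2 (λ x y → x :- y := x :+ :- con (1 , 0) :* y) refl (f a) (g a)) ⟩
      E (λ a → f a + - 1# * g a)    ≈⟨ trans (Linear.add l _ _) (+-congˡ (Linear.scale l (- 1#) g)) ⟩
      E f + - 1# * E g              ≈⟨ solve 2 (λ x y → x :- y := x :+ :- con (1 , 0) :* y) refl (E f) (E g) ⟨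
      E f - E g                     ∎

    Linear-mix : ∀ q {E F : Functional A} → Linear E → Linear F → Linear (λ f → mix q (E f) (F f))
    Linear-mix (q , _) l k = Linear-+ (Linear-* q l) (Linear-* (1# - q) k)

  δ : ∀ {n} → Fin n → Fin n → Carrier
  δ i j = if does (i Fin.≟ j) then 1# else 0#

  δ-refl : ∀ {n} (i : Fin n) → δ i i ≈ 1#
  δ-refl i with i Fin.≟ i
  ... | yes _   = refl
  ... | no  i≢i = ⊥-elim (i≢i ≡.refl)

  δ-≢ : ∀ {n} {i j : Fin n} → i ≢ j → δ i j ≈ 0#
  δ-≢ {i = i} {j} i≢j with i Fin.≟ j
  ... | yes i≡j = ⊥-elim (i≢j i≡j)
  ... | no  _   = refl

  0≤δ : ∀ {n} (i j : Fin n) → 0# ≤ δ i j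
  0≤δ i j with does (i Fin.≟ j)
  ... | true  = 0≤1
  ... | false = ≤-refl

  sum-zero : ∀ {n} {f : Fin n → Carrier} → (∀ i → f i ≈ 0#) → sum f ≈ 0#
  sum-zero {n} f≈0 = trans (sum-cong-≋ f≈0) (sum-replicate-zero n)

  sum-single : ∀ {n} (f : Fin n → Carrier) j → (∀ i → i ≢ j → f i ≈ 0#) → sum f ≈ f j
  sum-single f zero    f≈0 = trans (+-congˡ (sum-zero λ i → f≈0 (suc i) λ ())) (+-identityʳ _)
  sum-single f (suc j) f≈0 = trans (+-cong (f≈0 zero λ ()) (sum-single (f ∘ suc) j λ i i≢j → f≈0 (suc i) (i≢j ∘ Fin.suc-injective)))
    (+-identityˡ _)

  sum-δ : ∀ {n} (f : Fin n → Carrier) j → sum (λ i → f i * δ i j) ≈ f j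
  sum-δ f j = trans (sum-single (λ i → f i * δ i j) j λ i i≢j → trans (*-congˡ (δ-≢ i≢j)) (zeroʳ _))
    (trans (*-congˡ (δ-refl j)) (*-identityʳ _))

  sum-update : ∀ {A : Set} {m} (φ : Fin m → A → Carrier) (M : Vec A m) u a →
               sum (λ i → φ i (lookup (M [ u ]≔ a) i)) + φ u (lookup M u) ≈ sum (λ i → φ i (lookup M i)) + φ u a
  sum-update φ (b ∷ M) zero    a = solve 3 (λ a s b → (a :+ s) :+ b := (b :+ s) :+ a) refl _ _ _
  sum-update φ (b ∷ M) (suc u) a = trans (+-assoc _ _ _) (trans (+-congˡ (sum-update (φ ∘ suc) M u a)) (sym (+-assoc _ _ _)))

  unique-∷ʳ⇒∉ : ∀ {A : Set} {s : List A} {a} → Unique (s ∷ʳ a) → a ∉ s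
  unique-∷ʳ⇒∉ {s = b ∷ s} (b∉ AllPairs.∷ _) (here eq) = All.lookup b∉ (∈-++⁺ʳ s (here ≡.refl)) (≡.sym eq)
  unique-∷ʳ⇒∉ {s = b ∷ s} (_ AllPairs.∷ us) (there p) = unique-∷ʳ⇒∉ us p

  setEdge : ∀ {m n} → EdgeStates m n → Fin m → Fin n → Bool → EdgeStates m n
  setEdge st u v c = st [ u ]≔ (lookup st u [ v ]≔ c)

  active-setEdge : ∀ {m n} (st : EdgeStates m n) u v c → active (setEdge st u v c) u v ≡ c
  active-setEdge st u v c = ≡.trans
    (≡.cong (λ r → lookup r v) (Vec.lookup∘update u st (lookup st u [ v ]≔ c))) (Vec.lookup∘update v (lookup st u) c)

  active-setEdge-≢ : ∀ {m n} (st : EdgeStates m n) u v c {u′ v′} → ¬ (u′ ≡ u × v′ ≡ v) →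
                     active (setEdge st u v c) u′ v′ ≡ active st u′ v′
  active-setEdge-≢ st u v c {u′} {v′} ≢uv with u′ Fin.≟ u
  ... | no  u′≢u   = ≡.cong (λ r → lookup r v′) (Vec.lookup∘update′ u′≢u st _)
  ... | yes ≡.refl = ≡.trans (≡.cong (λ r → lookup r v′) (Vec.lookup∘update u st _))
    (Vec.lookup∘update′ (λ v′≡v → ≢uv (≡.refl , v′≡v)) (lookup st u) c)

  vacant : ∀ {n} → Maybe (Fin n) → Carrier
  vacant = maybe (λ _ → 0#) 1#

  module _ {m n : ℕ} (G : StochasticGraph m n) where

    open StochasticGraph G

    edgeStates-law : Law (edgeStates G)
    edgeStates-law = independent-law λ u → independent-law λ v → bernoulli-law (p u v)

    edgeStates-resample : ∀ u v (f : EdgeStates m n → Carrier) →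
      edgeStates G f ≈ bernoulli (p u v) λ c → edgeStates G λ st → f (setEdge st u v c)
    edgeStates-resample u v f = begin-equality
      edgeStates G f
        ≈⟨ independent-resample rows u f ⟩
      row (λ r → edgeStates G λ st → f (st [ u ]≔ r))
        ≈⟨ independent-resample (bernoulli-law ∘ p u) v _ ⟩
      bernoulli (p u v) (λ c → row λ r → edgeStates G λ st → f (st [ u ]≔ (r [ v ]≔ c)))
        ≈⟨ Law.cong (bernoulli-law (p u v)) (λ c → Law.cong (rows u) λ r → Law.cong edgeStates-law λ st →
             reflexive (≡.cong f (overwrite st r c))) ⟨
      bernoulli (p u v) (λ c → row λ r → edgeStates G λ st → f (setEdge (st [ u ]≔ r) u v c))
        ≈⟨ Law.cong (bernoulli-law (p u v)) (λ c → independent-resample rows u λ st → f (setEdge st u v c)) ⟨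
      bernoulli (p u v) (λ c → edgeStates G λ st → f (setEdge st u v c)) ∎
      where
      rows : ∀ u → Law (independent (bernoulli ∘ p u))
      rows u = independent-law (bernoulli-law ∘ p u)
      row = independent (bernoulli ∘ p u)
      overwrite : ∀ st r c → setEdge (st [ u ]≔ r) u v c ≡ st [ u ]≔ (r [ v ]≔ c)
      overwrite st r c = ≡.trans (≡.cong (λ r′ → (st [ u ]≔ r) [ u ]≔ (r′ [ v ]≔ c)) (Vec.lookup∘update u st r))
        (Vec.[]≔-idempotent st u)

    Ignores : Fin m → Fin n → (EdgeStates m n → Carrier) → Set
    Ignores u v f = ∀ st c → f (setEdge st u v c) ≈ f st

    -- Deferred decisions for a single edge: once its state is redrawn, the branch is chosen by a
    -- fresh coin, and neither continuation can see the outcome.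
    edgeStates-defer : ∀ {u v f g} → Ignores u v f → Ignores u v g →
      edgeStates G (λ st → if active st u v then f st else g st) ≈ mix (p u v) (edgeStates G f) (edgeStates G g)
    edgeStates-defer {u} {v} {f} {g} fi gi = trans (edgeStates-resample u v _)
      (mix-cong (p u v) (Law.cong edgeStates-law on-true) (Law.cong edgeStates-law on-false))
      where
      on-true : ∀ st → (if active (setEdge st u v true) u v then f (setEdge st u v true) else g (setEdge st u v true)) ≈ f st
      on-true st rewrite active-setEdge st u v true = fi st true
      on-false : ∀ st → (if active (setEdge st u v false) u v then f (setEdge st u v false) else g (setEdge st u v false)) ≈ g st
      on-false st rewrite active-setEdge st u v false = gi st false

    -- The expected total of f over the edges that the strategy still adds.
    mutual
      reward : ∀ {h M} → Offline G h M → Functional (Fin m × Fin n)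
      reward stop              f = 0#
      reward (flip q σ₁ σ₂)    f = mix q (reward σ₁ f) (reward σ₂ f)
      reward (probe u v _ σ δ) f = mix (p u v) (rewardDecision δ f) (reward σ f)

      rewardDecision : ∀ {u v h M} → Decision G u v h M → Functional (Fin m × Fin n)
      rewardDecision         (reject σ)   f = reward σ f
      rewardDecision {u} {v} (accept _ σ) f = f (u , v) + reward σ f

    mutual
      reward-linear : ∀ {h M} (σ : Offline G h M) → Linear (reward σ)
      reward-linear stop              = Linear-zero
      reward-linear (flip q σ₁ σ₂)    = Linear-mix q (reward-linear σ₁) (reward-linear σ₂)
      reward-linear (probe u v _ σ δ) = Linear-mix (p u v) (rewardDecision-linear δ) (reward-linear σ)

      rewardDecision-linear : ∀ {u v h M} (δ : Decision G u v h M) → Linear (rewardDecision δ)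
      rewardDecision-linear         (reject σ)   = reward-linear σ
      rewardDecision-linear {u} {v} (accept _ σ) = Linear-+ (Linear-eval (u , v)) (reward-linear σ)

    module _ {f : Fin m × Fin n → Carrier} (0≤f : ∀ e → 0# ≤ f e) where
      mutual
        reward-nonneg : ∀ {h M} (σ : Offline G h M) → 0# ≤ reward σ f
        reward-nonneg stop              = ≤-refl
        reward-nonneg (flip q σ₁ σ₂)    = mix-nonneg q (reward-nonneg σ₁) (reward-nonneg σ₂)
        reward-nonneg (probe u v _ σ δ) = mix-nonneg (p u v) (rewardDecision-nonneg δ) (reward-nonneg σ)

        rewardDecision-nonneg : ∀ {u v h M} (δ : Decision G u v h M) → 0# ≤ rewardDecision δ f
        rewardDecision-nonneg (reject σ)   = reward-nonneg σ
        rewardDecision-nonneg (accept _ σ) = +-nonneg (0≤f _) (reward-nonneg σ)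

    module _ {f : Fin m × Fin n → Carrier} (u : Fin m)
             (f≤1 : ∀ v → f (u , v) ≤ 1#) (f≤0 : ∀ {u′} v → u′ ≢ u → f (u′ , v) ≤ 0#) where
      0≤vacant : ∀ (a : Maybe (Fin n)) → 0# ≤ vacant a
      0≤vacant nothing  = 0≤1
      0≤vacant (just _) = ≤-refl

      mutual
        -- Accepting an edge at u requires u to be vacant and fills it, so at most one edge at u is
        -- still added. For the indicator of the edges at u this bounds the probability that u gets
        -- matched.
        reward≤vacant : ∀ {h M} (σ : Offline G h M) → reward σ f ≤ vacant (lookup M u)
        reward≤vacant {M = M} stop      = 0≤vacant (lookup M u)
        reward≤vacant (flip q σ₁ σ₂)    = convex≤ q (reward≤vacant σ₁) (reward≤vacant σ₂)
        reward≤vacant (probe u v _ σ δ) = convex≤ (p u v) (rewardDecision≤vacant δ) (reward≤vacant σ)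

        rewardDecision≤vacant : ∀ {u′ v h M} (δ : Decision G u′ v h M) → rewardDecision δ f ≤ vacant (lookup M u)
        rewardDecision≤vacant (reject σ) = reward≤vacant σ
        rewardDecision≤vacant {u′} {v} {h} {M} (accept (free , _) σ) with u′ Fin.≟ u
        ... | yes ≡.refl = ≤-trans (+-mono-≤ (f≤1 v) (reward≤vacant σ)) (≤-reflexive (trans
          (+-congˡ (reflexive (≡.cong vacant (Vec.lookup∘update u M (just v)))))
          (trans (+-identityʳ 1#) (reflexive (≡.cong vacant (≡.sym free))))))
        ... | no  u′≢u   = ≤-trans (+-mono-≤ (f≤0 v u′≢u) (reward≤vacant σ)) (≤-reflexive (trans (+-identityˡ _)
          (reflexive (≡.cong vacant (Vec.lookup∘update′ (u′≢u ∘ ≡.sym) M (just v))))))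

    module _ {f : Fin m × Fin n → Carrier} (i : Fin n) (f≈0 : ∀ u {v} → v ≢ i → f (u , v) ≈ 0#) where
      mutual
        -- Once i has a partner, no edge at i is `Free`, so every edge still added is one where f
        -- vanishes. Therefore a simulation may be cut off after its first edge at i without
        -- changing the expected total.
        reward-matched : ∀ {h M} u → lookup M u ≡ just i → (σ : Offline G h M) → reward σ f ≈ 0#
        reward-matched u M-u stop              = refl
        reward-matched u M-u (flip q σ₁ σ₂)    =
          trans (mix-cong q (reward-matched u M-u σ₁) (reward-matched u M-u σ₂)) (bernoulli-const q 0#)
        reward-matched u M-u (probe u′ v _ σ δ) =
          trans (mix-cong (p u′ v) (rewardDecision-matched u M-u δ) (reward-matched u M-u σ)) (bernoulli-const (p u′ v) 0#)

        rewardDecision-matched : ∀ {u′ v h M} u → lookup M u ≡ just i → (δ : Decision G u′ v h M) →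
                                 rewardDecision δ f ≈ 0#
        rewardDecision-matched u M-u (reject σ) = reward-matched u M-u σ
        rewardDecision-matched {u′} {v} {M = M} u M-u (accept (free , unmatched) σ) = trans
          (+-cong (f≈0 u′ λ { ≡.refl → unmatched u M-u })
            (reward-matched u (≡.trans (Vec.lookup∘update′ u≢u′ M (just v)) M-u) σ))
          (+-identityʳ 0#)
          where
          u≢u′ : u ≢ u′
          u≢u′ ≡.refl with ≡.trans (≡.sym M-u) free
          ... | ()

    weight-accept : ∀ {M u} v → lookup M u ≡ nothing → weight G (M [ u ]≔ just v) ≈ weight G M + w u v
    weight-accept {M} {u} v M-u = trans
      (sym (trans (+-congˡ (reflexive (≡.cong (maybe (w u) 0#) M-u))) (+-identityʳ _)))
      (sum-update (λ u → maybe (w u) 0#) M u (just v))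

    private
      SameUnprobed : Vec (List (Fin m)) n → EdgeStates m n → EdgeStates m n → Set
      SameUnprobed h st st′ = ∀ u v → u ∉ lookup h v → active st u v ≡ active st′ u v

      sameUnprobed-probe : ∀ {h st st′} v u → SameUnprobed h st st′ → SameUnprobed (h [ v ]≔ (lookup h v ∷ʳ u)) st st′
      sameUnprobed-probe {h} v u same u′ v′ u′∉ = same u′ v′ λ u′∈ → u′∉ (still-probed u′∈)
        where
        still-probed : u′ ∈ lookup h v′ → u′ ∈ lookup (h [ v ]≔ (lookup h v ∷ʳ u)) v′
        still-probed u′∈ with v′ Fin.≟ v
        ... | yes ≡.refl = ≡.subst (u′ ∈_) (≡.sym (Vec.lookup∘update v h _)) (∈-++⁺ˡ u′∈)
        ... | no  v′≢v   = ≡.subst (u′ ∈_) (≡.sym (Vec.lookup∘update′ v′≢v h _)) u′∈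

      setEdge-sameUnprobed : ∀ {h} v u st c → SameUnprobed (h [ v ]≔ (lookup h v ∷ʳ u)) (setEdge st u v c) st
      setEdge-sameUnprobed {h} v u st c _ _ u′∉ = active-setEdge-≢ st u v c λ { (≡.refl , ≡.refl) →
        u′∉ (≡.subst (u ∈_) (≡.sym (Vec.lookup∘update v h _)) (∈-++⁺ʳ (lookup h v) (here ≡.refl))) }

      mutual
        -- Constraint strings have distinct entries, so an edge that is about to be probed does not
        -- occur in h, and the two states agree on it.
        runOffline-local : ∀ {h M st st′} (σ : Offline G h M) → SameUnprobed h st st′ →
                           runOffline G σ st ≡ runOffline G σ st′
        runOffline-local stop           same = ≡.refl
        runOffline-local (flip q σ₁ σ₂) same =
          ≡.cong₂ (mix q) (runOffline-local σ₁ same) (runOffline-local σ₂ same)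
        runOffline-local {h} {st = st} {st′} (probe u v ok σ δ) same
          rewrite same u v (unique-∷ʳ⇒∉ (C-distinct ok))
          = ≡.cong₂ (if active st′ u v then_else_) (runDecision-local δ same′) (runOffline-local σ same′)
          where
          same′ : SameUnprobed (h [ v ]≔ (lookup h v ∷ʳ u)) st st′
          same′ = sameUnprobed-probe {h} {st} {st′} v u same

        runDecision-local : ∀ {u v h M st st′} (δ : Decision G u v h M) → SameUnprobed h st st′ →
                            runDecision G δ st ≡ runDecision G δ st′
        runDecision-local (reject σ)   = runOffline-local σ
        runDecision-local (accept _ σ) = runOffline-local σ

    private
      ŵ : Fin m × Fin n → Carrier
      ŵ (u , v) = w u v

    -- Edge states can be drawn when they are probed, as no edge is probed twice.
    mutual
      offline-deferred : ∀ {h M} (σ : Offline G h M) → edgeStates G (runOffline G σ) ≈ weight G M + reward σ ŵ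
      offline-deferred {M = M} stop = trans (Law.total edgeStates-law _) (sym (+-identityʳ _))
      offline-deferred {M = M} (flip q σ₁ σ₂) = begin-equality
        edgeStates G (λ st → mix q (runOffline G σ₁ st) (runOffline G σ₂ st))
          ≈⟨ Linear-commutes-mix (Law.linear edgeStates-law) q (runOffline G σ₁) (runOffline G σ₂) ⟩
        mix q (edgeStates G (runOffline G σ₁)) (edgeStates G (runOffline G σ₂))
          ≈⟨ mix-cong q (offline-deferred σ₁) (offline-deferred σ₂) ⟩
        mix q (weight G M + reward σ₁ ŵ) (weight G M + reward σ₂ ŵ)
          ≈⟨ mix-shift q _ _ _ ⟩
        weight G M + mix q (reward σ₁ ŵ) (reward σ₂ ŵ) ∎
      offline-deferred {h} {M} (probe u v ok σ δ) = begin-equality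
        edgeStates G (λ st → if active st u v then runDecision G δ st else runOffline G σ st)
          ≈⟨ edgeStates-defer (λ st c → reflexive (runDecision-local δ (setEdge-sameUnprobed {h} v u st c)))
                              (λ st c → reflexive (runOffline-local σ (setEdge-sameUnprobed {h} v u st c))) ⟩
        mix (p u v) (edgeStates G (runDecision G δ)) (edgeStates G (runOffline G σ))
          ≈⟨ mix-cong (p u v) (decision-deferred δ) (offline-deferred σ) ⟩
        mix (p u v) (weight G M + rewardDecision δ ŵ) (weight G M + reward σ ŵ)
          ≈⟨ mix-shift (p u v) _ _ _ ⟩
        weight G M + mix (p u v) (rewardDecision δ ŵ) (reward σ ŵ) ∎

      decision-deferred : ∀ {u v h M} (δ : Decision G u v h M) →
                          edgeStates G (runDecision G δ) ≈ weight G M + rewardDecision δ ŵ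
      decision-deferred         (reject σ)            = offline-deferred σ
      decision-deferred {v = v} {M = M} (accept (free , _) σ) =
        trans (offline-deferred σ) (trans (+-congʳ (weight-accept {M} v free)) (+-assoc _ _ _))

  weight-empty : ∀ {m n} (G : StochasticGraph m n) → weight G emptyMatching ≈ 0#
  weight-empty G = sum-zero λ u → reflexive (≡.cong (maybe (StochasticGraph.w G u) 0#) (Vec.lookup-replicate u nothing))

  -- Online strategies

  Distinct : ∀ {n t} → Vec (Fin n) t → Set
  Distinct = VecAllPairs.AllPairs _≢_

  sum-linear : ∀ {n} → Linear (sum {n})
  sum-linear = record
    { cong  = sum-cong-≋
    ; add   = ∑-distrib-+
    ; scale = λ c f → sym (*-distribˡ-sum c f)
    }

  onlyIf : Bool → Carrier → Carrier
  onlyIf b x = if b then x else 0#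

  Linear-onlyIf : ∀ {A} {E : Functional A} (c : A → Bool) → Linear E → Linear (λ f → E λ a → onlyIf (c a) (f a))
  Linear-onlyIf c l = record
    { cong  = λ f≈g → Linear.cong l λ a → onlyIf-cong (c a) (f≈g a)
    ; add   = λ f g → trans (Linear.cong l λ a → onlyIf-add (c a)) (Linear.add l _ _)
    ; scale = λ k f → trans (Linear.cong l λ a → onlyIf-scale (c a)) (Linear.scale l k _)
    }
    where
    onlyIf-cong : ∀ b {x y} → x ≈ y → onlyIf b x ≈ onlyIf b y
    onlyIf-cong true  x≈y = x≈y
    onlyIf-cong false x≈y = refl
    onlyIf-add : ∀ b {x y} → onlyIf b (x + y) ≈ onlyIf b x + onlyIf b y
    onlyIf-add true  = refl
    onlyIf-add false = sym (+-identityʳ 0#)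
    onlyIf-scale : ∀ b {k x} → onlyIf b (k * x) ≈ k * onlyIf b x
    onlyIf-scale true  = refl
    onlyIf-scale false = sym (zeroʳ _)

  distinct? : ∀ {n t} (π : Vec (Fin n) t) → Dec (Distinct π)
  distinct? = VecAllPairs.allPairs? λ i j → ¬? (i Fin.≟ j)

  uniformPermutation-linear : ∀ n → Linear (uniformPermutation n)
  uniformPermutation-linear n =
    Linear-* _ (Linear-onlyIf (λ π → does (distinct? π)) (independent-linear _ λ _ → sum-linear))

  uniformPermutation-cong : ∀ {n F G} → (∀ π → Distinct π → F π ≈ G π) →
                            uniformPermutation n F ≈ uniformPermutation n G
  uniformPermutation-cong {n} {F} {G} F≈G =
    *-congˡ (Linear.cong (independent-linear _ λ _ → sum-linear) λ π → pointwise π (distinct? π))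
    where
    pointwise : ∀ π (d : Dec (Distinct π)) → onlyIf (does d) (F π) ≈ onlyIf (does d) (G π)
    pointwise π (yes π≢) = F≈G π π≢
    pointwise π (no  _)  = refl

  module _ (I : Input) where

    open Input I
    open StochasticGraph H

    typesLaw : Law (types I)
    typesLaw = independent-law (expectation-law ∘ D)

    -- The expected total weight of the edges that the strategy still adds, in
    -- arrival order π, when the type of each arriving i is drawn from E i.
    module _ (E : Fin n → Functional (Fin k)) where
      mutual
        gain : ∀ {t M} → Online I t M → Vec (Fin n) t → Carrier
        gain end        []      = 0#
        gain (arrive σ) (i ∷ π) = E i λ b → gainSession (σ i b) π

        gainSession : ∀ {t i b s M} → Session I t i b s M → Vec (Fin n) t → Carrier
        gainSession (done σ)               π = gain σ π
        gainSession (flip q σ₁ σ₂)         π = mix q (gainSession σ₁ π) (gainSession σ₂ π)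
        gainSession {b = b} (probe u _ σ ω) π = mix (p u b) (gainVerdict ω π) (gainSession σ π)

        gainVerdict : ∀ {t i b u s M} → Verdict I t i b u s M → Vec (Fin n) t → Carrier
        gainVerdict                 (reject σ)   π = gainSession σ π
        gainVerdict {b = b} {u = u} (accept _ σ) π = w u b + gainSession σ π

    -- Point masses at τ: with them `gain` describes a run on given types, with `drawn` one whose
    -- types are drawn on arrival.
    atTypes : Vec (Fin k) n → Fin n → Functional (Fin k)
    atTypes τ i f = f (lookup τ i)

    module _ (τ : Vec (Fin k) n) where

      private
        G = instantiate H τ

        SameAt : ∀ {t} → Vec (Fin n) t → EdgeStates m n → EdgeStates m n → Set
        SameAt π st st′ = ∀ u x → active st u (lookup π x) ≡ active st′ u (lookup π x)

        SameUnprobedAt : Fin n → List (Fin m) → EdgeStates m n → EdgeStates m n → Set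
        SameUnprobedAt i s st st′ = ∀ u → u ∉ s → active st u i ≡ active st′ u i

        mutual
          runOnline-local : ∀ {t M st st′ π} (σ : Online I t M) → SameAt π st st′ →
                            runOnline I τ st σ π ≡ runOnline I τ st′ σ π
          runOnline-local {π = []}    end        same = ≡.refl
          runOnline-local {π = i ∷ π} (arrive σ) same =
            runSession-local (σ i (lookup τ i)) (λ u _ → same u zero) (λ u x → same u (suc x))

          runSession-local : ∀ {t i b s M st st′ π} (σ : Session I t i b s M) →
                             SameUnprobedAt i s st st′ → SameAt π st st′ →
                             runSession I τ st σ π ≡ runSession I τ st′ σ π
          runSession-local (done σ)       now later = runOnline-local σ later
          runSession-local (flip q σ₁ σ₂) now later =
            ≡.cong₂ (mix q) (runSession-local σ₁ now later) (runSession-local σ₂ now later)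
          runSession-local {i = i} {s = s} {st = st} {st′} (probe u ok σ ω) now later
            rewrite now u (unique-∷ʳ⇒∉ (C-distinct ok))
            = ≡.cong₂ (if active st′ u i then_else_) (runVerdict-local ω now′ later) (runSession-local σ now′ later)
            where
            now′ : SameUnprobedAt i (s ∷ʳ u) st st′
            now′ u′ u′∉ = now u′ (u′∉ ∘ ∈-++⁺ˡ)

          runVerdict-local : ∀ {t i b u s M st st′ π} (ω : Verdict I t i b u s M) →
                             SameUnprobedAt i s st st′ → SameAt π st st′ →
                             runVerdict I τ st ω π ≡ runVerdict I τ st′ ω π
          runVerdict-local (reject σ)   = runSession-local σ
          runVerdict-local (accept _ σ) = runSession-local σ

        law = edgeStates-law G

      mutual
        -- Edge states can be drawn on probing here too. Within a session the constraint forbids a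
        -- second look at an edge; across sessions distinctness of π does, since later arrivals
        -- concern other indices.
        online-deferred : ∀ {t M π} → Distinct π → (σ : Online I t M) →
          edgeStates G (λ st → runOnline I τ st σ π) ≈ weight G M + gain (atTypes τ) σ π
        online-deferred {π = []}    _                  end        = trans (Law.total law _) (sym (+-identityʳ _))
        online-deferred {π = i ∷ π} (i∉π VecAllPairs.∷ π≢) (arrive σ) = session-deferred i∉π π≢ ≡.refl (σ i (lookup τ i))

        session-deferred : ∀ {t i b s M} {π : Vec (Fin n) t} → VecAll.All (i ≢_) π → Distinct π → lookup τ i ≡ b →
          (σ : Session I t i b s M) →
          edgeStates G (λ st → runSession I τ st σ π) ≈ weight G M + gainSession (atTypes τ) σ π
        session-deferred i∉π π≢ τi≡b (done σ) = online-deferred π≢ σ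
        session-deferred {M = M} {π} i∉π π≢ τi≡b (flip q σ₁ σ₂) = begin-equality
          edgeStates G (λ st → mix q (runSession I τ st σ₁ π) (runSession I τ st σ₂ π))
            ≈⟨ Linear-commutes-mix (Law.linear law) q _ _ ⟩
          mix q (edgeStates G λ st → runSession I τ st σ₁ π) (edgeStates G λ st → runSession I τ st σ₂ π)
            ≈⟨ mix-cong q (session-deferred i∉π π≢ τi≡b σ₁) (session-deferred i∉π π≢ τi≡b σ₂) ⟩
          mix q (weight G M + gainSession (atTypes τ) σ₁ π) (weight G M + gainSession (atTypes τ) σ₂ π)
            ≈⟨ mix-shift q _ _ _ ⟩
          weight G M + mix q (gainSession (atTypes τ) σ₁ π) (gainSession (atTypes τ) σ₂ π) ∎
        session-deferred {i = i} {s = s} {M} {π} i∉π π≢ ≡.refl (probe u ok σ ω) = begin-equality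
          edgeStates G (λ st → if active st u i then runVerdict I τ st ω π else runSession I τ st σ π)
            ≈⟨ edgeStates-defer G (λ st c → reflexive (runVerdict-local ω (now st c) (later st c)))
                                  (λ st c → reflexive (runSession-local σ (now st c) (later st c))) ⟩
          mix (p u (lookup τ i)) (edgeStates G λ st → runVerdict I τ st ω π) (edgeStates G λ st → runSession I τ st σ π)
            ≈⟨ mix-cong (p u (lookup τ i)) (verdict-deferred i∉π π≢ ≡.refl ω) (session-deferred i∉π π≢ ≡.refl σ) ⟩
          mix (p u (lookup τ i)) (weight G M + gainVerdict (atTypes τ) ω π) (weight G M + gainSession (atTypes τ) σ π)
            ≈⟨ mix-shift (p u (lookup τ i)) _ _ _ ⟩
          weight G M + mix (p u (lookup τ i)) (gainVerdict (atTypes τ) ω π) (gainSession (atTypes τ) σ π) ∎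
          where
          now : ∀ st c → SameUnprobedAt i (s ∷ʳ u) (setEdge st u i c) st
          now st c u′ u′∉ = active-setEdge-≢ st u i c λ { (≡.refl , _) → u′∉ (∈-++⁺ʳ s (here ≡.refl)) }
          later : ∀ st c → SameAt π (setEdge st u i c) st
          later st c u′ x = active-setEdge-≢ st u i c λ (_ , π-x≡i) → VecAll.lookup⁺ i∉π x (≡.sym π-x≡i)

        verdict-deferred : ∀ {t i b u s M} {π : Vec (Fin n) t} → VecAll.All (i ≢_) π → Distinct π → lookup τ i ≡ b →
          (ω : Verdict I t i b u s M) →
          edgeStates G (λ st → runVerdict I τ st ω π) ≈ weight G M + gainVerdict (atTypes τ) ω π
        verdict-deferred i∉π π≢ τi≡b (reject σ) = session-deferred i∉π π≢ τi≡b σ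
        verdict-deferred {i = i} {M = M} i∉π π≢ ≡.refl (accept (free , _) σ) =
          trans (session-deferred i∉π π≢ ≡.refl σ) (trans (+-congʳ (weight-accept G {M} i free)) (+-assoc _ _ _))

    private
      SameTypesAt : ∀ {t} → Vec (Fin n) t → Vec (Fin k) n → Vec (Fin k) n → Set
      SameTypesAt π τ τ′ = ∀ x → lookup τ (lookup π x) ≡ lookup τ′ (lookup π x)

      module _ (τ τ′ : Vec (Fin k) n) where
        mutual
          gain-local : ∀ {t M π} (σ : Online I t M) → SameTypesAt π τ τ′ →
                       gain (atTypes τ) σ π ≡ gain (atTypes τ′) σ π
          gain-local {π = []}    end        same = ≡.refl
          gain-local {π = i ∷ π} (arrive σ) same
            rewrite same zero = gainSession-local (σ i (lookup τ′ i)) (same ∘ suc)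

          gainSession-local : ∀ {t i b s M π} (σ : Session I t i b s M) → SameTypesAt π τ τ′ →
                              gainSession (atTypes τ) σ π ≡ gainSession (atTypes τ′) σ π
          gainSession-local (done σ)       same = gain-local σ same
          gainSession-local (flip q σ₁ σ₂) same =
            ≡.cong₂ (mix q) (gainSession-local σ₁ same) (gainSession-local σ₂ same)
          gainSession-local {b = b} (probe u _ σ ω) same =
            ≡.cong₂ (mix (p u b)) (gainVerdict-local ω same) (gainSession-local σ same)

          gainVerdict-local : ∀ {t i b u s M π} (ω : Verdict I t i b u s M) → SameTypesAt π τ τ′ →
                              gainVerdict (atTypes τ) ω π ≡ gainVerdict (atTypes τ′) ω π
          gainVerdict-local                 (reject σ)   same = gainSession-local σ same
          gainVerdict-local {b = b} {u = u} (accept _ σ) same = ≡.cong (w u b +_) (gainSession-local σ same)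

    drawn : Fin n → Functional (Fin k)
    drawn = Distribution.expectation ∘ D

    mutual
      -- The type of v_i is looked at on its arrival and, as π does not repeat i, never again; so it
      -- can be redrawn at that moment.
      types-deferred : ∀ {t M π} → Distinct π → (σ : Online I t M) →
        types I (λ τ → gain (atTypes τ) σ π) ≈ gain drawn σ π
      types-deferred {π = []} _ end = Law.total typesLaw 0#
      types-deferred {π = i ∷ π} (i∉π VecAllPairs.∷ π≢) (arrive σ) = begin-equality
        types I (λ τ → gainSession (atTypes τ) (σ i (lookup τ i)) π)
          ≈⟨ independent-resample (expectation-law ∘ D) i _ ⟩
        drawn i (λ b → types I λ τ → gainSession (atTypes (τ [ i ]≔ b)) (σ i (lookup (τ [ i ]≔ b) i)) π)
          ≈⟨ Law.cong (expectation-law (D i)) (λ b → Law.cong typesLaw λ τ → reflexive (≡.trans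
               (≡.cong (λ b′ → gainSession (atTypes (τ [ i ]≔ b)) (σ i b′) π) (Vec.lookup∘update i τ b))
               (gainSession-local (τ [ i ]≔ b) τ (σ i b) λ x → Vec.lookup∘update′ (VecAll.lookup⁺ i∉π x ∘ ≡.sym) τ b))) ⟩
        drawn i (λ b → types I λ τ → gainSession (atTypes τ) (σ i b) π)
          ≈⟨ Law.cong (expectation-law (D i)) (λ b → session-types-deferred π≢ (σ i b)) ⟩
        drawn i (λ b → gainSession drawn (σ i b) π) ∎

      session-types-deferred : ∀ {t i b s M π} → Distinct π → (σ : Session I t i b s M) →
        types I (λ τ → gainSession (atTypes τ) σ π) ≈ gainSession drawn σ π
      session-types-deferred π≢ (done σ)       = types-deferred π≢ σ
      session-types-deferred π≢ (flip q σ₁ σ₂) = trans (Linear-commutes-mix (Law.linear typesLaw) q _ _)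
        (mix-cong q (session-types-deferred π≢ σ₁) (session-types-deferred π≢ σ₂))
      session-types-deferred {b = b} π≢ (probe u _ σ ω) = trans (Linear-commutes-mix (Law.linear typesLaw) (p u b) _ _)
        (mix-cong (p u b) (verdict-types-deferred π≢ ω) (session-types-deferred π≢ σ))

      verdict-types-deferred : ∀ {t i b u s M π} → Distinct π → (ω : Verdict I t i b u s M) →
        types I (λ τ → gainVerdict (atTypes τ) ω π) ≈ gainVerdict drawn ω π
      verdict-types-deferred π≢ (reject σ)   = session-types-deferred π≢ σ
      verdict-types-deferred π≢ (accept _ σ) = trans (Law.add typesLaw _ _)
        (+-cong (Law.total typesLaw _) (session-types-deferred π≢ σ))

    randomOrderValue≈gain : ∀ σ → randomOrderValue I σ ≈ uniformPermutation n (gain drawn σ)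
    randomOrderValue≈gain σ = begin-equality
      randomOrderValue I σ
        ≈⟨ Law.cong typesLaw (λ τ → uniformPermutation-cong λ π π≢ → trans (online-deferred τ π≢ σ)
             (trans (+-congʳ (weight-empty (instantiate H τ))) (+-identityˡ _))) ⟩
      types I (λ τ → uniformPermutation n (gain (atTypes τ) σ))
        ≈⟨ Law.fubini typesLaw (uniformPermutation-linear n) _ ⟩
      uniformPermutation n (λ π → types I λ τ → gain (atTypes τ) σ π)
        ≈⟨ uniformPermutation-cong (λ π π≢ → types-deferred π≢ σ) ⟩
      uniformPermutation n (gain drawn σ) ∎

  -- Uniformly random orders

  module _ {A : Set} where

    pick-All : ∀ {P : A → Set} {t x} {r : Vec A t} {R} → Pick x r R → VecAll.All P R → P x × VecAll.All P r
    pick-All here      (px VecAll.∷ pr) = px , pr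
    pick-All (there q) (py VecAll.∷ pR) with pick-All q pR
    ... | px , pr = px , py VecAll.∷ pr

    pick-∈ : ∀ {t x} {r : Vec A t} {R} → Pick x r R → x Vec.∈ R
    pick-∈ here      = VecAny.here ≡.refl
    pick-∈ (there q) = VecAny.there (pick-∈ q)

    pick-⊆ : ∀ {t x y} {r : Vec A t} {R} → Pick x r R → y Vec.∈ r → y Vec.∈ R
    pick-⊆ here      y∈                = VecAny.there y∈
    pick-⊆ (there q) (VecAny.here y≡)  = VecAny.here y≡
    pick-⊆ (there q) (VecAny.there y∈) = VecAny.there (pick-⊆ q y∈)

    pick-split : ∀ {t x y} {r : Vec A t} {R} → Pick x r R → y Vec.∈ R → x ≢ y → y Vec.∈ r
    pick-split here      (VecAny.here ≡.refl) x≢y = ⊥-elim (x≢y ≡.refl)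
    pick-split here      (VecAny.there y∈)    x≢y = y∈
    pick-split (there q) (VecAny.here y≡)     x≢y = VecAny.here y≡
    pick-split (there q) (VecAny.there y∈)    x≢y = VecAny.there (pick-split q y∈ x≢y)

    ∈⇒pick : ∀ {t x} {R : Vec A (suc t)} → x Vec.∈ R → ∃ λ r → Pick x r R
    ∈⇒pick (VecAny.here ≡.refl) = _ , here
    ∈⇒pick {suc t} (VecAny.there x∈) with ∈⇒pick x∈
    ... | _ , q = _ , there q

  module _ {n : ℕ} where

    pick-distinct : ∀ {t i} {r : Vec (Fin n) t} {R} → Pick i r R → Distinct R → VecAll.All (i ≢_) r × Distinct r
    pick-distinct here      (i∉ VecAllPairs.∷ r≢) = i∉ , r≢
    pick-distinct (there q) (y∉ VecAllPairs.∷ R≢) with pick-distinct q R≢ | pick-All q y∉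
    ... | i∉ , r≢ | y≢i , y∉r = (y≢i ∘ ≡.sym) VecAll.∷ i∉ , y∉r VecAllPairs.∷ r≢

    pick-unique : ∀ {t i} {r r′ : Vec (Fin n) t} {R} → Distinct R → Pick i r R → Pick i r′ R → r ≡ r′
    pick-unique R≢ here here = ≡.refl
    pick-unique (i∉ VecAllPairs.∷ _) here (there q) = ⊥-elim (proj₁ (pick-All q i∉) ≡.refl)
    pick-unique (i∉ VecAllPairs.∷ _) (there q) here = ⊥-elim (proj₁ (pick-All q i∉) ≡.refl)
    pick-unique (_ VecAllPairs.∷ R≢) (there q) (there q′) = ≡.cong (_ ∷_) (pick-unique R≢ q q′)

    pick? : ∀ {t} i (R : Vec (Fin n) (suc t)) → Dec (∃ λ r → Pick i r R)
    pick? i (a ∷ R) with i Fin.≟ a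
    pick? i (i ∷ R) | yes ≡.refl = yes (R , here)
    pick? {zero}  i (a ∷ []) | no i≢a = no λ { (_ , here) → i≢a ≡.refl }
    pick? {suc t} i (a ∷ R)  | no i≢a with pick? i R
    ... | yes (r , q) = yes (a ∷ r , there q)
    ... | no  i∉R     = no λ { (_ , here) → i≢a ≡.refl ; (_ , there q) → i∉R (_ , q) }

    whenPicked : ∀ {t i} {R : Vec (Fin n) (suc t)} → (Vec (Fin n) t → Carrier) → Dec (∃ λ r → Pick i r R) → Carrier
    whenPicked φ (yes (r , _)) = φ r
    whenPicked φ (no _)        = 0#

    -- Passes from sums over all indices, as in `uniformPermutation`, to sums over the entries of R.
    -- Distinctness makes the pick of i unique, so nothing is counted twice or missed.
    sum-whenPicked : ∀ {t} (φ : Fin n → Vec (Fin n) t → Carrier) {R} → Distinct R →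
                     sum (λ i → whenPicked (φ i) (pick? i R)) ≈ pickSum φ R
    sum-whenPicked {zero} φ {a ∷ []} _ = trans (sum-cong-≋ pointwise) (sum-δ (λ i → φ i []) a)
      where
      pointwise : ∀ i → whenPicked (φ i) (pick? i (a ∷ [])) ≈ φ i [] * δ i a
      pointwise i with i Fin.≟ a
      ... | yes ≡.refl = sym (*-identityʳ _)
      ... | no  _      = sym (zeroʳ _)
    sum-whenPicked {suc t} φ {a ∷ R} (a∉R VecAllPairs.∷ R≢) = begin-equality
      sum (λ i → whenPicked (φ i) (pick? i (a ∷ R)))
        ≈⟨ sum-cong-≋ pointwise ⟩
      sum (λ i → φ i R * δ i a + whenPicked (φ i ∘ (a ∷_)) (pick? i R))
        ≈⟨ ∑-distrib-+ (λ i → φ i R * δ i a) (λ i → whenPicked (φ i ∘ (a ∷_)) (pick? i R)) ⟩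
      sum (λ i → φ i R * δ i a) + sum (λ i → whenPicked (φ i ∘ (a ∷_)) (pick? i R))
        ≈⟨ +-cong (sum-δ (λ i → φ i R) a) (sum-whenPicked (λ i → φ i ∘ (a ∷_)) R≢) ⟩
      φ a R + pickSum (λ i r → φ i (a ∷ r)) R ∎
      where
      pointwise : ∀ i → whenPicked (φ i) (pick? i (a ∷ R)) ≈ φ i R * δ i a + whenPicked (φ i ∘ (a ∷_)) (pick? i R)
      pointwise i with i Fin.≟ a
      ... | yes ≡.refl with pick? i R
      ...   | yes (r , q) = ⊥-elim (proj₁ (pick-All q a∉R) ≡.refl)
      ...   | no  _       = sym (trans (+-identityʳ _) (*-identityʳ _))
      pointwise i | no _ with pick? i R
      ...   | yes (r , q) = sym (trans (+-congʳ (zeroʳ _)) (+-identityˡ _))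
      ...   | no  _       = sym (trans (+-congʳ (zeroʳ _)) (+-identityˡ _))

    mutual
      -- A test for being a rearrangement of R that recurses on the first entry, as drawing without
      -- replacement does; the pairwise test in `uniformPermutation` has no such recursion.
      isOrdering : ∀ {t} → Vec (Fin n) t → Vec (Fin n) t → Bool
      isOrdering []        []      = true
      isOrdering R@(_ ∷ _) (i ∷ π) = isOrderingAfter π (pick? i R)

      isOrderingAfter : ∀ {t i} {R : Vec (Fin n) (suc t)} → Vec (Fin n) t → Dec (∃ λ r → Pick i r R) → Bool
      isOrderingAfter π (yes (r , _)) = isOrdering r π
      isOrderingAfter π (no _)        = false

    distinct⇒isOrdering : ∀ {t} (R π : Vec (Fin n) t) → Distinct π → VecAll.All (Vec._∈ R) π → isOrdering R π ≡ true
    distinct⇒isOrdering [] [] _ _ = ≡.refl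
    distinct⇒isOrdering R@(_ ∷ _) (i ∷ π) (i∉π VecAllPairs.∷ π≢) (i∈R VecAll.∷ π⊆R) with pick? i R
    ... | yes (r , q) = distinct⇒isOrdering r π π≢
      (VecAll.map (λ (i≢j , j∈R) → pick-split q j∈R i≢j) (VecAll.zip (i∉π , π⊆R)))
    ... | no  i∉R     = ⊥-elim (i∉R (∈⇒pick i∈R))

    isOrdering⇒distinct : ∀ {t} (R π : Vec (Fin n) t) → Distinct R → isOrdering R π ≡ true →
                          Distinct π × VecAll.All (Vec._∈ R) π
    isOrdering⇒distinct [] [] _ _ = VecAllPairs.[] , VecAll.[]
    isOrdering⇒distinct R@(_ ∷ _) (i ∷ π) R≢ eq with pick? i R
    ... | yes (r , q) with pick-distinct q R≢
    ...   | i∉r , r≢ with isOrdering⇒distinct r π r≢ eq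
    ...     | π≢ , π⊆r =
      (VecAll.map (VecAll.lookup i∉r) π⊆r) VecAllPairs.∷ π≢ , pick-∈ q VecAll.∷ VecAll.map (pick-⊆ q) π⊆r

    distinct?-isOrdering : ∀ {t} {R : Vec (Fin n) t} → Distinct R → (∀ i → i Vec.∈ R) → ∀ π →
                           does (distinct? π) ≡ isOrdering R π
    distinct?-isOrdering {R = R} R≢ ∈R π with distinct? π
    ... | yes π≢ = ≡.sym (distinct⇒isOrdering R π π≢ (VecAll.lookup⁻ (∈R ∘ lookup π)))
    ... | no ¬π≢ with isOrdering R π in eq
    ...   | true  = ⊥-elim (¬π≢ (proj₁ (isOrdering⇒distinct R π R≢ eq)))
    ...   | false = ≡.refl

  orderingSum : ∀ {A t} → Vec A t → Functional (Vec A t)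
  orderingSum {t = zero}  R F = F []
  orderingSum {t = suc t} R F = pickSum (λ x r → orderingSum r (F ∘ (x ∷_))) R

  uniformOrdering : ∀ {A t} → Vec A t → Functional (Vec A t)
  uniformOrdering {t = zero}  R F = F []
  uniformOrdering {t = suc t} R F = fromℕ (suc t) ⁻¹ * pickSum (λ x r → uniformOrdering r (F ∘ (x ∷_))) R

  uniformOrdering-linear : ∀ {A t} (R : Vec A t) → Linear (uniformOrdering R)
  uniformOrdering-linear {t = zero}  R = Linear-eval []
  uniformOrdering-linear {t = suc t} R = Linear-* _ record
    { cong  = λ F≈G → pickSum-cong R λ {x} {r} _ → Linear.cong (uniformOrdering-linear r) (F≈G ∘ (x ∷_))
    ; add   = λ F G → trans (pickSum-cong R λ {x} {r} _ → Linear.add (uniformOrdering-linear r) _ _) (pickSum-add _ _ R)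
    ; scale = λ c F → trans (pickSum-cong R λ {x} {r} _ → Linear.scale (uniformOrdering-linear r) c _) (pickSum-scale c _ R)
    }

  uniformOrdering-const : ∀ {A t} (R : Vec A t) c → uniformOrdering R (λ _ → c) ≈ c
  uniformOrdering-const {t = zero}  R c = refl
  uniformOrdering-const {t = suc t} R c = trans
    (*-congˡ (trans (pickSum-cong R λ {_} {r} _ → uniformOrdering-const r c) (pickSum-const c R)))
    (suc⁻¹-*-cancel t c)

  1/!-suc : ∀ k → 1/! (suc k) ≈ fromℕ (suc k) ⁻¹ * 1/! k
  1/!-suc k = trans (sym (suc⁻¹-*-cancel k _)) (*-congˡ (suc-*-1/! k))

  uniformOrdering-orderingSum : ∀ {A t} (R : Vec A t) F → uniformOrdering R F ≈ 1/! t * orderingSum R F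
  uniformOrdering-orderingSum {t = zero}  R F = sym (trans (*-congʳ 1/!0≈1) (*-identityˡ _))
  uniformOrdering-orderingSum {t = suc t} R F = begin-equality
    fromℕ (suc t) ⁻¹ * pickSum (λ x r → uniformOrdering r (F ∘ (x ∷_))) R
      ≈⟨ *-congˡ (pickSum-cong R λ {x} {r} _ → uniformOrdering-orderingSum r (F ∘ (x ∷_))) ⟩
    fromℕ (suc t) ⁻¹ * pickSum (λ x r → 1/! t * orderingSum r (F ∘ (x ∷_))) R
      ≈⟨ *-congˡ (pickSum-scale _ _ R) ⟩
    fromℕ (suc t) ⁻¹ * (1/! t * orderingSum R F)
      ≈⟨ *-assoc _ _ _ ⟨
    fromℕ (suc t) ⁻¹ * 1/! t * orderingSum R F
      ≈⟨ *-congʳ (1/!-suc t) ⟨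
    1/! (suc t) * orderingSum R F ∎

  orderings-sum : ∀ {n t} {R : Vec (Fin n) t} → Distinct R → ∀ F →
                  independent (λ _ → sum) (λ π → onlyIf (isOrdering R π) (F π)) ≈ orderingSum R F
  orderings-sum {R = []}        _  F = refl
  orderings-sum {n} {suc t} {R = R@(_ ∷ _)} R≢ F = trans
    (sum-cong-≋ λ i → pointwise i (pick? i R))
    (sum-whenPicked (λ i r → orderingSum r (F ∘ (i ∷_))) R≢)
    where
    pointwise : ∀ i (d : Dec (∃ λ r → Pick i r R)) →
      independent (λ _ → sum {n}) (λ π → onlyIf (isOrderingAfter π d) (F (i ∷ π))) ≈
      whenPicked (λ r → orderingSum r (F ∘ (i ∷_))) d
    pointwise i (yes (r , q)) = orderings-sum (proj₂ (pick-distinct q R≢)) (F ∘ (i ∷_))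
    pointwise i (no _)        = sums-zero t
      where
      sums-zero : ∀ s → independent {n = s} (λ _ → sum {n}) (λ _ → 0#) ≈ 0#
      sums-zero zero    = refl
      sums-zero (suc s) = sum-zero {n} λ _ → sums-zero s

  allFin-distinct : ∀ n → Distinct (Vec.allFin n)
  allFin-distinct n = VecAllPairs.tabulate⁺ id

  -- A uniform permutation arises by drawing without replacement. In this form it exposes the next
  -- arrival and the remaining ones, which is what the recursion of `value` follows.
  uniformPermutation≈uniformOrdering : ∀ n F → uniformPermutation n F ≈ uniformOrdering (Vec.allFin n) F
  uniformPermutation≈uniformOrdering n F = begin-equality
    1/! n * independent (λ _ → sum) (λ π → onlyIf (does (distinct? π)) (F π))
      ≈⟨ *-congˡ (Linear.cong (independent-linear _ λ _ → sum-linear) λ π →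
           reflexive (≡.cong (λ b → onlyIf b (F π)) (distinct?-isOrdering (allFin-distinct n) Vec.∈-allFin⁺ π))) ⟩
    1/! n * independent (λ _ → sum) (λ π → onlyIf (isOrdering (Vec.allFin n) π) (F π))
      ≈⟨ *-congˡ (orderings-sum (allFin-distinct n) F) ⟩
    1/! n * orderingSum (Vec.allFin n) F
      ≈⟨ uniformOrdering-orderingSum (Vec.allFin n) F ⟨
    uniformOrdering (Vec.allFin n) F ∎

  -- The algorithm

  term≤sum : ∀ {n} (f : Fin n → Carrier) → (∀ i → 0# ≤ f i) → ∀ i → f i ≤ sum f
  term≤sum f 0≤f zero    = x≤x+y (sum-nonneg (0≤f ∘ suc))
  term≤sum f 0≤f (suc i) = ≤-trans (term≤sum (f ∘ suc) (0≤f ∘ suc) i)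
    (≤-trans (x≤x+y (0≤f zero)) (≤-reflexive (+-comm _ _)))

  module _ {S : Set} (toss : Probability → S → S → S) where

    -- Strategies own only biased coins, so outcomes are offered one after the other, each with its
    -- share of the mass still left.
    drawMass : ∀ {k} (μ : Fin (suc k) → Carrier) → (∀ b → 0# ≤ μ b) → (Fin (suc k) → S) → S
    drawMass {zero}  μ 0≤μ κ = κ zero
    drawMass {suc k} μ 0≤μ κ with sum μ ≟ 0#
    -- No mass is left, so this branch is reached with probability 0 and any choice will do.
    ... | yes _    = κ zero
    ... | no  ∑≉0 = toss (μ zero * sum μ ⁻¹ , *-nonneg (0≤μ zero) 0≤∑⁻¹ , share≤1) (κ zero)
                         (drawMass (μ ∘ suc) (0≤μ ∘ suc) (κ ∘ suc))
      where
      0≤∑⁻¹ : 0# ≤ sum μ ⁻¹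
      0≤∑⁻¹ = ⁻¹-nonneg (sum-nonneg 0≤μ) ∑≉0
      share≤1 : μ zero * sum μ ⁻¹ ≤ 1#
      share≤1 = ≤-trans (*-monoʳ-≤ 0≤∑⁻¹ (term≤sum μ 0≤μ zero)) (≤-reflexive (*-inverseʳ ∑≉0))

    draw : ∀ {k} → Distribution k → (Fin k → S) → S
    draw {zero}  D κ = ⊥-elim (0≉1 (Distribution.mass-total D))
    draw {suc k} D κ = drawMass (Distribution.mass D) (Distribution.mass-nonneg D) κ

    drawAll : ∀ {k n} → (Fin n → Distribution k) → (Vec (Fin k) n → S) → S
    drawAll {n = zero}  D κ = κ []
    drawAll {n = suc n} D κ = draw (D zero) λ a → drawAll (D ∘ suc) (κ ∘ (a ∷_))

    module _ (val : S → Carrier) (val-toss : ∀ q s s′ → val (toss q s s′) ≈ mix q (val s) (val s′)) where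

      -- Left unnormalised: multiplied by the total mass, the claim for the tail is what the
      -- recursion needs, and it stays true when that mass is 0.
      val-drawMass : ∀ {k} (μ : Fin (suc k) → Carrier) 0≤μ κ →
                     sum μ * val (drawMass μ 0≤μ κ) ≈ sum λ b → μ b * val (κ b)
      val-drawMass {zero}  μ 0≤μ κ = solve 2 (λ a x → (a :+ con (0 , 0)) :* x := a :* x :+ con (0 , 0)) refl _ _
      val-drawMass {suc k} μ 0≤μ κ with sum μ ≟ 0#
      ... | yes ∑≈0 = trans (trans (*-congʳ ∑≈0) (zeroˡ _))
        (sym (sum-zero {f = λ b → μ b * val (κ b)} λ b → trans (*-congʳ (μ≈0 b)) (zeroˡ _)))
        where
        μ≈0 : ∀ b → μ b ≈ 0#
        μ≈0 b = antisym (≤-trans (term≤sum μ 0≤μ b) (≤-reflexive ∑≈0)) (0≤μ b)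
      ... | no ∑≉0 = begin-equality
        T * val (toss _ (κ zero) rest)
          ≈⟨ *-congˡ (val-toss _ (κ zero) rest) ⟩
        T * (μ zero * T ⁻¹ * val (κ zero) + (1# - μ zero * T ⁻¹) * val rest)
          ≈⟨ solve 5 (λ t a i x y → t :* (a :* i :* x :+ (con (1 , 0) :- a :* i) :* y) := a :* (t :* i) :* x :+ (t :- a :* (t :* i)) :* y)
               refl T (μ zero) (T ⁻¹) (val (κ zero)) (val rest) ⟩
        μ zero * (T * T ⁻¹) * val (κ zero) + (T - μ zero * (T * T ⁻¹)) * val rest
          ≈⟨ +-cong (*-congʳ μ₀) (*-congʳ (+-congˡ (-‿cong μ₀))) ⟩
        μ zero * val (κ zero) + (T - μ zero) * val rest
          ≈⟨ +-congˡ (*-congʳ (solve 2 (λ a b → a :+ b :- a := b) refl (μ zero) (sum (μ ∘ suc)))) ⟩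
        μ zero * val (κ zero) + sum (μ ∘ suc) * val rest
          ≈⟨ +-congˡ (val-drawMass (μ ∘ suc) (0≤μ ∘ suc) (κ ∘ suc)) ⟩
        μ zero * val (κ zero) + sum (λ b → μ (suc b) * val (κ (suc b))) ∎
        where
        T    = sum μ
        rest = drawMass (μ ∘ suc) (0≤μ ∘ suc) (κ ∘ suc)
        μ₀ : μ zero * (T * T ⁻¹) ≈ μ zero
        μ₀ = trans (*-congˡ (*-inverseʳ ∑≉0)) (*-identityʳ _)

      val-draw : ∀ {k} (D : Distribution k) κ → val (draw D κ) ≈ Distribution.expectation D (val ∘ κ)
      val-draw {zero}  D κ = ⊥-elim (0≉1 (Distribution.mass-total D))
      val-draw {suc k} D κ = trans
        (sym (trans (*-congʳ (Distribution.mass-total D)) (*-identityˡ _)))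
        (val-drawMass (Distribution.mass D) (Distribution.mass-nonneg D) κ)

      val-drawAll : ∀ {k n} (D : Fin n → Distribution k) κ →
                    val (drawAll D κ) ≈ independent (Distribution.expectation ∘ D) (val ∘ κ)
      val-drawAll {n = zero}  D κ = refl
      val-drawAll {n = suc n} D κ = trans (val-draw (D zero) _)
        (Law.cong (expectation-law (D zero)) λ a → val-drawAll (D ∘ suc) (κ ∘ (a ∷_)))

  edge : ∀ {m n} → Fin m → Fin n → Fin m × Fin n → Carrier
  edge u v (u′ , v′) = δ u u′ * δ v v′

  module _ {m n : ℕ} {E : Functional (Fin m × Fin n)} (linear : Linear E) where

    Linear-edges : ∀ f → E f ≈ sum λ u → sum λ v → f (u , v) * E (edge u v)
    Linear-edges f = begin-equality
      E f
        ≈⟨ Linear.cong linear (λ e → expand e) ⟨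
      E (λ e → sum λ u → sum λ v → f (u , v) * edge u v e)
        ≈⟨ Linear-sum linear (λ u e → sum λ v → f (u , v) * edge u v e) ⟩
      sum (λ u → E λ e → sum λ v → f (u , v) * edge u v e)
        ≈⟨ sum-cong-≋ (λ u → trans (Linear-sum linear λ v e → f (u , v) * edge u v e)
             (sum-cong-≋ λ v → Linear.scale linear (f (u , v)) (edge u v))) ⟩
      sum (λ u → sum λ v → f (u , v) * E (edge u v)) ∎
      where
      expand : ∀ e → sum (λ u → sum λ v → f (u , v) * edge u v e) ≈ f e
      expand (u′ , v′) = trans
        (sum-cong-≋ λ u → trans (sum-cong-≋ λ v → sym (*-assoc (f (u , v)) _ _))
          (sum-δ (λ v → f (u , v) * δ u u′) v′))
        (sum-δ (λ u → f (u , v′)) u′)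

    Linear-column : ∀ (g : Fin m → Carrier) v →
                    E (λ (u′ , v′) → g u′ * δ v v′) ≈ sum λ u → g u * E (edge u v)
    Linear-column g v = trans (Linear.cong linear λ (u′ , v′) → sym (trans
        (sum-cong-≋ λ u → solve 3 (λ a b c → a :* (b :* c) := a :* c :* b) refl (g u) (δ u u′) (δ v v′))
        (sum-δ (λ u → g u * δ v v′) u′)))
      (trans (Linear-sum linear λ u e → g u * edge u v e)
        (sum-cong-≋ λ u → Linear.scale linear (g u) (edge u v)))

    Linear-row : ∀ u → sum (λ v → E (edge u v)) ≈ E (λ (u′ , _) → δ u u′)
    Linear-row u = trans (sym (Linear-sum linear (edge u)))
      (Linear.cong linear λ (u′ , v′) → sum-δ (λ _ → δ u u′) v′)

  module _ (I : Input) where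

    open Input I
    open StochasticGraph H

    free? : ∀ M u i → Dec (Free {m} {n} M u i)
    free? M u i = Maybe.≡-dec Fin._≟_ (lookup M u) nothing ×-dec
                  Fin.all? λ u′ → ¬? (Maybe.≡-dec Fin._≟_ (lookup M u′) (just i))

    -- The first edge at i that the simulated strategy adds is also the last one,
    -- so the session may end there whether or not the edge is taken online.
    module _ {t : ℕ} (next : ∀ M → Online I t M) (i : Fin n) (M : PartialMatching m n) (τ : Vec (Fin k) n) {Wanted : Fin m → Set}
             (wanted? : ∀ u → Dec (Wanted u)) where

      private
        b = lookup τ i
        G = instantiate H τ

      -- A wanted candidate may still have to be dropped: the simulation proceeds with its own
      -- matching M′ and cannot know that u is already taken in M.
      respond : ∀ {s u} → Dec (Wanted u) → Dec (Free M u i) → Verdict I t i b u s M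
      respond {u = u} (yes _) (yes free) = accept free (done (next (M [ u ]≔ just i)))
      respond _ _                        = reject (done (next M))

      mutual
        simulate : ∀ {h M′ s} → s ≡ lookup h i → Offline G h M′ → Session I t i b s M
        simulate eq stop                  = done (next M)
        simulate eq (flip q σ₁ σ₂)        = flip q (simulate eq σ₁) (simulate eq σ₂)
        simulate {h} eq (probe u v ok σ ω) with v Fin.≟ i
        -- The real string at v_i and the simulated one are kept equal, so `ok` permits the real
        -- probe as well.
        simulate {h} ≡.refl (probe u v ok σ ω) | yes ≡.refl =
          probe u ok (simulate (≡.sym (Vec.lookup∘update i h _)) σ) (simulateHere (≡.sym (Vec.lookup∘update i h _)) ω)
        simulate {h} ≡.refl (probe u v ok σ ω) | no v≢i =
          flip (p u (lookup τ v)) (simulateAway (≡.sym (Vec.lookup∘update′ (v≢i ∘ ≡.sym) h _)) ω)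
                                  (simulate (≡.sym (Vec.lookup∘update′ (v≢i ∘ ≡.sym) h _)) σ)

        simulateHere : ∀ {h M′ s u} → s ≡ lookup h i → Decision G u i h M′ → Verdict I t i b u s M
        simulateHere         eq (reject σ)   = reject (simulate eq σ)
        simulateHere {u = u} eq (accept _ _) = respond (wanted? u) (free? M u i)

        simulateAway : ∀ {h M′ s u v} → s ≡ lookup h i → Decision G u v h M′ → Session I t i b s M
        simulateAway eq (reject σ)   = simulate eq σ
        simulateAway eq (accept _ σ) = simulate eq σ

      module _ (π : Vec (Fin n) t) where

        private
          val : ∀ {s} → Session I t i b s M → Carrier
          val σ = gainSession I (drawn I) σ π
          base = gain I (drawn I) (next M) π

        -- Measured against passing v_i by, so that it vanishes whenever the candidate is dropped
        -- and the value of a session becomes `base` plus a linear functional of the edges added by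
        -- the simulation.
        surplus : ∀ {u} → Dec (Wanted u) → Dec (Free M u i) → Carrier
        surplus {u} (yes _) (yes _) = (w u b + gain I (drawn I) (next (M [ u ]≔ just i)) π) - base
        surplus _ _                 = 0#

        surplusAt : Fin m → Carrier
        surplusAt u = surplus (wanted? u) (free? M u i)

        atColumn : Fin m × Fin n → Carrier
        atColumn (u , v) = surplusAt u * δ i v

        gain-respond : ∀ {s u} d d′ → gainVerdict I (drawn I) (respond {s} {u} d d′) π ≈ base + surplus d d′
        gain-respond (yes _) (yes _) = solve 2 (λ a b → a := b :+ (a :- b)) refl _ _
        gain-respond (yes _) (no _)  = sym (+-identityʳ _)
        gain-respond (no _)  _       = sym (+-identityʳ _)

        off-column : ∀ u {v} → v ≢ i → atColumn (u , v) ≈ 0#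
        off-column u v≢i = trans (*-congˡ (δ-≢ (v≢i ∘ ≡.sym))) (zeroʳ _)

        mutual
          -- The session stops at the first edge at i while `reward` runs the strategy to its end;
          -- `reward-matched` shows that the rest contributes nothing in column i, and `atColumn`
          -- vanishes off it.
          gain-simulate : ∀ {h M′ s} (eq : s ≡ lookup h i) (σ : Offline G h M′) →
                          val (simulate eq σ) ≈ base + reward G σ atColumn
          gain-simulate eq stop           = sym (+-identityʳ _)
          gain-simulate eq (flip q σ₁ σ₂) =
            trans (mix-cong q (gain-simulate eq σ₁) (gain-simulate eq σ₂)) (mix-shift q _ _ _)
          gain-simulate {h} eq (probe u v ok σ ω) with v Fin.≟ i
          gain-simulate {h} ≡.refl (probe u v ok σ ω) | yes ≡.refl =
            trans (mix-cong (p u b) (gain-simulateHere _ ω) (gain-simulate _ σ)) (mix-shift (p u b) _ _ _)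
          gain-simulate {h} ≡.refl (probe u v ok σ ω) | no v≢i =
            trans (mix-cong (p u (lookup τ v)) (gain-simulateAway v≢i _ ω) (gain-simulate _ σ)) (mix-shift (p u (lookup τ v)) _ _ _)

          gain-simulateHere : ∀ {h M′ s u} (eq : s ≡ lookup h i) (ω : Decision G u i h M′) →
            gainVerdict I (drawn I) (simulateHere eq ω) π ≈ base + rewardDecision G ω atColumn
          gain-simulateHere         eq (reject σ) = gain-simulate eq σ
          gain-simulateHere {M′ = M′} {u = u} eq (accept _ σ) = begin-equality
            gainVerdict I (drawn I) (respond (wanted? u) (free? M u i)) π
              ≈⟨ gain-respond (wanted? u) (free? M u i) ⟩
            base + surplusAt u
              ≈⟨ +-congˡ (trans (+-cong (trans (*-congˡ (δ-refl i)) (*-identityʳ _))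
                   (reward-matched G i off-column u (Vec.lookup∘update u M′ (just i)) σ)) (+-identityʳ _)) ⟨
            base + (surplusAt u * δ i i + reward G σ atColumn) ∎

          gain-simulateAway : ∀ {h M′ s u v} → v ≢ i → (eq : s ≡ lookup h i) (ω : Decision G u v h M′) →
            val (simulateAway eq ω) ≈ base + rewardDecision G ω atColumn
          gain-simulateAway         v≢i eq (reject σ)   = gain-simulate eq σ
          gain-simulateAway {u = u} v≢i eq (accept _ σ) = trans (gain-simulate eq σ)
            (+-congˡ (sym (trans (+-congʳ (off-column u v≢i)) (+-identityˡ _))))

    optimal : (τ : Vec (Fin k) n) → OfflineAlgorithm (instantiate H τ)
    optimal τ = proj₁ (proj₁ (proj₂ (optimum (instantiate H τ))))

    matches : Vec (Fin k) n → Functional (Fin m × Fin n)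
    matches τ = reward (instantiate H τ) (optimal τ)

    matches-linear : ∀ τ → Linear (matches τ)
    matches-linear τ = reward-linear (instantiate H τ) (optimal τ)

    OPTᴳ≈matches : ∀ τ → OPTᴳ (instantiate H τ) ≈ matches τ λ (u , i) → w u (lookup τ i)
    OPTᴳ≈matches τ = trans (proj₂ (proj₁ (proj₂ (optimum (instantiate H τ)))))
      (trans (offline-deferred (instantiate H τ) (optimal τ))
        (trans (+-congʳ (weight-empty (instantiate H τ))) (+-identityˡ _)))

    -- The probability that the optimum matches u and v_i, given that v_i has type b.
    y : Fin n → Fin k → Fin m → Carrier
    y i b u = types I λ τ → matches (τ [ i ]≔ b) (edge u i)

    0≤edge : ∀ (u : Fin m) (i : Fin n) e → 0# ≤ edge u i e
    0≤edge u i (u′ , i′) = *-nonneg (0≤δ u u′) (0≤δ i i′)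

    δ≤1 : ∀ {j} (a b : Fin j) → δ a b ≤ 1#
    δ≤1 a b with does (a Fin.≟ b)
    ... | true  = ≤-refl
    ... | false = 0≤1

    matches-row≤1 : ∀ τ u → matches τ (λ (u′ , _) → δ u u′) ≤ 1#
    matches-row≤1 τ u = ≤-trans
      (reward≤vacant (instantiate H τ) u (λ _ → δ≤1 u u) (λ _ u′≢u → ≤-reflexive (δ-≢ (u′≢u ∘ ≡.sym))) (optimal τ))
      (≤-reflexive (reflexive (≡.cong vacant (Vec.lookup-replicate u nothing))))

    0≤matches : ∀ τ u i → 0# ≤ matches τ (edge u i)
    0≤matches τ u i = reward-nonneg (instantiate H τ) (0≤edge u i) (optimal τ)

    matches≤1 : ∀ τ u i → matches τ (edge u i) ≤ 1#
    matches≤1 τ u i = begin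
      matches τ (edge u i)                ≤⟨ term≤sum (λ i → matches τ (edge u i)) (0≤matches τ u) i ⟩
      sum (λ i → matches τ (edge u i))    ≈⟨ Linear-row (matches-linear τ) u ⟩
      matches τ (λ (u′ , _) → δ u u′)     ≤⟨ matches-row≤1 τ u ⟩
      1#                                  ∎

    law : Law (types I)
    law = typesLaw I

    0≤y : ∀ i b u → 0# ≤ y i b u
    0≤y i b u = ≤-trans (≤-reflexive (sym (Law.total law 0#))) (Law.mono law λ τ → 0≤matches (τ [ i ]≔ b) u i)

    y≤1 : ∀ i b u → y i b u ≤ 1#
    y≤1 i b u = ≤-trans (Law.mono law λ τ → matches≤1 (τ [ i ]≔ b) u i) (≤-reflexive (Law.total law 1#))

    drawn-law : ∀ i → Law (drawn I i)
    drawn-law i = expectation-law (D i)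

    -- An arrival of type b proposes u with probability y i b u, and then the better of its weight
    -- and c is collected. The bound y ≤ 1 makes this a convex combination of the maximum and c,
    -- hence monotone in c.
    rewards : Fin m → Rewards (Fin n)
    rewards u = record
      { h      = λ i c → drawn I i λ b → c + ((w u b ⊔ c) - c) * y i b u
      ; W      = λ i → drawn I i λ b → y i b u * w u b
      ; x      = λ i → drawn I i λ b → y i b u
      ; h-mono = λ i c≤d → Law.mono (drawn-law i) λ b → payoff-mono (0≤y i b u) (y≤1 i b u) c≤d
      ; c≤h    = λ i c → ≤-trans (≤-reflexive (sym (Law.total (drawn-law i) c)))
                   (Law.mono (drawn-law i) λ b → x≤x+y (*-nonneg (x≤y⇒0≤y-x (x≤y⊔x (w u b) c)) (0≤y i b u)))
      ; W≤h    = λ i c → ≤-trans (≤-reflexive (split i c)) (Law.mono (drawn-law i) λ b → payoff-take (0≤y i b u))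
      ; 0≤x    = λ i → ≤-trans (≤-reflexive (sym (Law.total (drawn-law i) 0#))) (Law.mono (drawn-law i) λ b → 0≤y i b u)
      }
      where
      payoff-mono : ∀ {a c d q} → 0# ≤ q → q ≤ 1# → c ≤ d → c + ((a ⊔ c) - c) * q ≤ d + ((a ⊔ d) - d) * q
      payoff-mono {a} {c} {d} {q} 0≤q q≤1 c≤d = begin
        c + ((a ⊔ c) - c) * q         ≈⟨ solve 3 (λ c s q → c :+ (s :- c) :* q := q :* s :+ (con (1 , 0) :- q) :* c) refl c (a ⊔ c) q ⟩
        q * (a ⊔ c) + (1# - q) * c    ≤⟨ +-mono-≤ (*-monoˡ-≤ 0≤q (⊔-monoʳ-≤ a c≤d)) (*-monoˡ-≤ (x≤y⇒0≤y-x q≤1) c≤d) ⟩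
        q * (a ⊔ d) + (1# - q) * d    ≈⟨ solve 3 (λ c s q → c :+ (s :- c) :* q := q :* s :+ (con (1 , 0) :- q) :* c) refl d (a ⊔ d) q ⟨
        d + ((a ⊔ d) - d) * q         ∎
      payoff-take : ∀ {a c q} → 0# ≤ q → q * a + (c + - c * q) ≤ c + ((a ⊔ c) - c) * q
      payoff-take {a} {c} {q} 0≤q = begin
        q * a + (c + - c * q)         ≤⟨ +-mono-≤ (*-monoˡ-≤ 0≤q (x≤x⊔y a c)) ≤-refl ⟩
        q * (a ⊔ c) + (c + - c * q)   ≈⟨ solve 3 (λ c s q → q :* s :+ (c :+ :- c :* q) := c :+ (s :- c) :* q) refl c (a ⊔ c) q ⟩
        c + ((a ⊔ c) - c) * q         ∎
      split : ∀ i c → (drawn I i λ b → y i b u * w u b) + (c - (drawn I i λ b → y i b u) * c) ≈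
                      drawn I i λ b → y i b u * w u b + (c + - c * y i b u)
      split i c = sym (trans (Law.add (drawn-law i) _ _) (+-congˡ
        (trans (Law.add (drawn-law i) _ _) (+-cong (Law.total (drawn-law i) c)
          (trans (Law.scale (drawn-law i) (- c) _) (solve 2 (λ c x → :- c :* x := :- (x :* c)) refl c _))))))

    V : ∀ {t} → Fin m → Vec (Fin n) t → Carrier
    V u R = Rewards.value (rewards u) R

    -- An index outside R would have arrived before. `Vec.tail` is a default that merely has the
    -- right length.
    remainder : ∀ {t} {i : Fin n} {R : Vec (Fin n) (suc t)} → Dec (∃ λ r → Pick i r R) → Vec (Fin n) t
    remainder         (yes (r , _)) = r
    remainder {R = R} (no _)        = Vec.tail R

    -- All types are drawn afresh and entry i is overwritten by the true type b. The simulation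
    -- produces a session for the type found at i in the new vector, and `subst` identifies that
    -- type with b. The threshold is the value of keeping u for the arrivals r after v_i.
    session : ∀ {t} (next : ∀ M → Online I t M) (r : Vec (Fin n) t) i b M → Session I t i b [] M
    session {t} next r i b M = drawAll flip D λ τ →
      ≡.subst (λ b → Session I t i b [] M) (Vec.lookup∘update i τ b)
        (simulate next i M (τ [ i ]≔ b) (λ u → V u r ≤? w u (lookup (τ [ i ]≔ b) i)) (≡.sym (Vec.lookup-replicate i [])) (optimal (τ [ i ]≔ b)))

    -- R lists the indices still to come. Thresholds depend on R but not on M.
    play : ∀ {t} → Vec (Fin n) t → ∀ M → Online I t M
    play {zero}  R M = end
    play {suc t} R M = arrive λ i b → let r = remainder (pick? i R) in session (play r) r i b M

  -- The value of the algorithm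

  module _ (I : Input) where

    open Input I
    open StochasticGraph H

    Φ : ∀ {t} → Vec (Fin n) t → PartialMatching m n → Carrier
    Φ R M = sum λ u → vacant (lookup M u) * V I u R

    Unmatched : ∀ {t} → PartialMatching m n → Vec (Fin n) t → Set
    Unmatched M = VecAll.All λ j → ∀ u → lookup M u ≢ just j

    just-unmatched : ∀ {t M u i} {r : Vec (Fin n) t} → VecAll.All (i ≢_) r → Unmatched M r → Unmatched (M [ u ]≔ just i) r
    just-unmatched {M = M} {u} {i} i∉r M∌r = VecAll.map (λ (i≢j , M∌j) → keep i≢j M∌j) (VecAll.zip (i∉r , M∌r))
      where
      keep : ∀ {j} → i ≢ j → (∀ u → lookup M u ≢ just j) → ∀ u′ → lookup (M [ u ]≔ just i) u′ ≢ just j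
      keep i≢j M∌j u′ eq with u′ Fin.≟ u
      ... | yes ≡.refl = i≢j (Maybe.just-injective (≡.trans (≡.sym (Vec.lookup∘update u M (just i))) eq))
      ... | no  u′≢u   = M∌j u′ (≡.trans (≡.sym (Vec.lookup∘update′ u′≢u M (just i))) eq)

    subst-gain : ∀ {t i b b′ M} {π : Vec (Fin n) t} (eq : b ≡ b′) (σ : Session I t i b [] M) →
      gainSession I (drawn I) (≡.subst (λ b → Session I t i b [] M) eq σ) π ≈ gainSession I (drawn I) σ π
    subst-gain ≡.refl σ = refl

    module _ {t : ℕ} {r : Vec (Fin n) t} {i : Fin n} {M : PartialMatching m n} (i∉r : VecAll.All (i ≢_) r) (M∌i : ∀ u → lookup M u ≢ just i)
             (M∌r : Unmatched M r)
             (play-r : ∀ M → Unmatched M r → uniformOrdering r (gain I (drawn I) (play I r M)) ≈ Φ r M) where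

      private
        linear = uniformOrdering-linear r

        after : Fin m → Vec (Fin n) t → Carrier
        after u = gain I (drawn I) (play I r (M [ u ]≔ just i))

        base : Vec (Fin n) t → Carrier
        base = gain I (drawn I) (play I r M)

        excess : Fin k → Fin m → Carrier
        excess b u = (w u b ⊔ V I u r) - V I u r

      -- Matching u closes its own stopping problem and leaves all others as they are.
      Φ-accept : ∀ {u} → lookup M u ≡ nothing → Φ r (M [ u ]≔ just i) ≈ Φ r M - V I u r
      Φ-accept {u} M-u = begin-equality
        Φ r (M [ u ]≔ just i)
          ≈⟨ solve 2 (λ p v → p := (p :+ con (1 , 0) :* v) :- v) refl _ (V I u r) ⟩
        (Φ r (M [ u ]≔ just i) + 1# * V I u r) - V I u r
          ≡⟨ ≡.cong (λ a → (Φ r (M [ u ]≔ just i) + vacant a * V I u r) - V I u r) M-u ⟨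
        (Φ r (M [ u ]≔ just i) + vacant (lookup M u) * V I u r) - V I u r
          ≈⟨ +-congʳ (sum-update (λ u a → vacant a * V I u r) M u (just i)) ⟩
        (Φ r M + 0# * V I u r) - V I u r
          ≈⟨ solve 2 (λ p v → (p :+ con (0 , 0) :* v) :- v := p :- v) refl _ (V I u r) ⟩
        Φ r M - V I u r ∎

      module _ (τ : Vec (Fin k) n) where

        private
          b = lookup τ i

          wanted? : ∀ u → Dec (V I u r ≤ w u b)
          wanted? u = V I u r ≤? w u b

        -- In each branch the decision realises max(w, V) - V if u is vacant: accepting exchanges V
        -- for w, and a candidate is unwanted only if w ≤ V. An occupied u counts for nothing on
        -- either side.
        surplus-value : ∀ u d d′ → uniformOrdering r (λ π → surplus I (play I r) i M τ wanted? π {u} d d′) ≈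
                                   vacant (lookup M u) * excess b u
        surplus-value u (yes V≤w) (yes (free , _)) = begin-equality
          uniformOrdering r (λ π → (w u b + after u π) - base π)
            ≈⟨ Linear-commutes-sub linear _ base ⟩
          uniformOrdering r (λ π → w u b + after u π) - uniformOrdering r base
            ≈⟨ +-cong (trans (Linear.add linear _ _) (+-cong (uniformOrdering-const r _) (play-r _ (just-unmatched {M = M} {u} i∉r M∌r))))
                      (-‿cong (play-r M M∌r)) ⟩
          (w u b + Φ r (M [ u ]≔ just i)) - Φ r M
            ≈⟨ +-congʳ (+-congˡ (Φ-accept free)) ⟩
          (w u b + (Φ r M - V I u r)) - Φ r M
            ≈⟨ solve 3 (λ w p v → (w :+ (p :- v)) :- p := con (1 , 0) :* (w :- v)) refl (w u b) (Φ r M) (V I u r) ⟩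
          1# * (w u b - V I u r)
            ≈⟨ *-cong (reflexive (≡.cong vacant free)) (+-congʳ (x≤y⇒y⊔x≈y V≤w)) ⟨
          vacant (lookup M u) * excess b u ∎
        surplus-value u (no V≰w) _ = trans (uniformOrdering-const r 0#) (sym (trans (*-congˡ (trans
          (+-congʳ (x≤y⇒x⊔y≈y w≤V)) (-‿inverseʳ _))) (zeroʳ _)))
          where
          w≤V : w u b ≤ V I u r
          w≤V with total (w u b) (V I u r)
          ... | inj₁ p = p
          ... | inj₂ p = ⊥-elim (V≰w p)
        surplus-value u (yes _) (no ¬free) = trans (uniformOrdering-const r 0#)
          (sym (trans (*-congʳ (occupied (lookup M u) ≡.refl)) (zeroˡ _)))
          where
          occupied : ∀ a → lookup M u ≡ a → vacant a ≈ 0#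
          -- As v_i has no partner yet, a vacant u would be `Free`.
          occupied nothing  M-u = ⊥-elim (¬free (M-u , M∌i))
          occupied (just _) _   = refl

        simulate-value : ∀ {h M′ s} (eq : s ≡ lookup h i) (σ : Offline (instantiate H τ) h M′) →
          uniformOrdering r (gainSession I (drawn I) (simulate I (play I r) i M τ wanted? eq σ)) ≈
          Φ r M + sum λ u → vacant (lookup M u) * excess b u * reward (instantiate H τ) σ (edge u i)
        simulate-value eq σ = begin-equality
          uniformOrdering r (gainSession I (drawn I) (simulate I (play I r) i M τ wanted? eq σ))
            ≈⟨ Linear.cong linear (λ π → trans (gain-simulate I (play I r) i M τ wanted? π eq σ)
                 (+-congˡ (Linear-column (reward-linear (instantiate H τ) σ) (at π) i))) ⟩
          uniformOrdering r (λ π → base π + sum λ u → at π u * P u)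
            ≈⟨ trans (Linear.add linear _ _) (+-cong (play-r M M∌r) (Linear-sum linear λ u π → at π u * P u)) ⟩
          Φ r M + sum (λ u → uniformOrdering r λ π → at π u * P u)
            ≈⟨ +-congˡ (sum-cong-≋ λ u → begin-equality
                 uniformOrdering r (λ π → at π u * P u)           ≈⟨ Linear.cong linear (λ π → *-comm (at π u) (P u)) ⟩
                 uniformOrdering r (λ π → P u * at π u)           ≈⟨ Linear.scale linear (P u) _ ⟩
                 P u * uniformOrdering r (λ π → at π u)           ≈⟨ *-comm (P u) _ ⟩
                 uniformOrdering r (λ π → at π u) * P u           ≈⟨ *-congʳ (surplus-value u (wanted? u) (free? I M u i)) ⟩
                 vacant (lookup M u) * excess b u * P u           ∎) ⟩
          Φ r M + sum (λ u → vacant (lookup M u) * excess b u * P u) ∎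
          where
          at : Vec (Fin n) t → Fin m → Carrier
          at = surplusAt I (play I r) i M τ wanted?
          P : Fin m → Carrier
          P u = reward (instantiate H τ) σ (edge u i)

      -- Averaging over the fresh types turns the probability that the simulated optimum adds (u ,
      -- v_i) into `y`. As the simulation does not see M, this holds whatever has been matched
      -- before.
      session-value : ∀ b → uniformOrdering r (gainSession I (drawn I) (session I (play I r) r i b M)) ≈
                            Φ r M + sum λ u → vacant (lookup M u) * excess b u * y I i b u
      session-value b = begin-equality
        uniformOrdering r (gainSession I (drawn I) (session I (play I r) r i b M))
          ≈⟨ Linear.cong linear (λ π → trans
               (val-drawAll flip (λ σ → gainSession I (drawn I) σ π) (λ _ _ _ → refl) D _)
               (Law.cong (law I) λ τ → subst-gain (Vec.lookup∘update i τ b) _)) ⟩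
        uniformOrdering r (λ π → types I λ τ → gainSession I (drawn I) (simulated τ) π)
          ≈⟨ Law.fubini (law I) linear _ ⟨
        types I (λ τ → uniformOrdering r (gainSession I (drawn I) (simulated τ)))
          ≈⟨ Law.cong (law I) (λ τ → simulate-value (τ [ i ]≔ b) _ (optimal I (τ [ i ]≔ b))) ⟩
        types I (λ τ → Φ r M + sum λ u → vacant (lookup M u) * excess (lookup (τ [ i ]≔ b) i) u * P τ u)
          ≈⟨ Law.cong (law I) (λ τ → reflexive (≡.cong (λ b → Φ r M + sum λ u → vacant (lookup M u) * excess b u * P τ u)
               (Vec.lookup∘update i τ b))) ⟩
        types I (λ τ → Φ r M + sum λ u → vacant (lookup M u) * excess b u * P τ u)
          ≈⟨ trans (Law.add (law I) _ _) (+-cong (Law.total (law I) _)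
               (Linear-sum (Law.linear (law I)) λ u τ → vacant (lookup M u) * excess b u * P τ u)) ⟩
        Φ r M + sum (λ u → types I λ τ → vacant (lookup M u) * excess b u * P τ u)
          ≈⟨ +-congˡ (sum-cong-≋ λ u → Law.scale (law I) (vacant (lookup M u) * excess b u) (λ τ → P τ u)) ⟩
        Φ r M + sum (λ u → vacant (lookup M u) * excess b u * y I i b u) ∎
        where
        P : Vec (Fin k) n → Fin m → Carrier
        P τ u = matches I (τ [ i ]≔ b) (edge u i)
        simulated : ∀ τ → Session I t i (lookup (τ [ i ]≔ b) i) [] M
        simulated τ = simulate I (play I r) i M (τ [ i ]≔ b) (λ u → V I u r ≤? w u (lookup (τ [ i ]≔ b) i))
          (≡.sym (Vec.lookup-replicate i [])) (optimal I (τ [ i ]≔ b))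

      arrival-value : uniformOrdering r (λ π → drawn I i λ b → gainSession I (drawn I) (session I (play I r) r i b M) π) ≈
                      sum λ u → vacant (lookup M u) * Rewards.h (rewards I u) i (V I u r)
      arrival-value = begin-equality
        uniformOrdering r (λ π → drawn I i λ b → gainSession I (drawn I) (session I (play I r) r i b M) π)
          ≈⟨ Law.fubini Dᵢ linear (λ b → gainSession I (drawn I) (session I (play I r) r i b M)) ⟨
        drawn I i (λ b → uniformOrdering r (gainSession I (drawn I) (session I (play I r) r i b M)))
          ≈⟨ Law.cong Dᵢ (λ b → trans (session-value b) (sym (∑-distrib-+ (λ u → vacant (lookup M u) * V I u r) _))) ⟩
        drawn I i (λ b → sum λ u → vacant (lookup M u) * V I u r + vacant (lookup M u) * excess b u * y I i b u)
          ≈⟨ Law.cong Dᵢ (λ b → sum-cong-≋ λ u →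
               solve 4 (λ a v e y → a :* v :+ a :* e :* y := a :* (v :+ e :* y)) refl (vacant (lookup M u)) (V I u r) (excess b u) (y I i b u)) ⟩
        drawn I i (λ b → sum λ u → vacant (lookup M u) * (V I u r + excess b u * y I i b u))
          ≈⟨ Linear-sum (Law.linear Dᵢ) (λ u b → vacant (lookup M u) * (V I u r + excess b u * y I i b u)) ⟩
        sum (λ u → drawn I i λ b → vacant (lookup M u) * (V I u r + excess b u * y I i b u))
          ≈⟨ sum-cong-≋ (λ u → Law.scale Dᵢ (vacant (lookup M u)) (λ b → V I u r + excess b u * y I i b u)) ⟩
        sum (λ u → vacant (lookup M u) * Rewards.h (rewards I u) i (V I u r)) ∎
        where Dᵢ = drawn-law I i

    remainder-pick : ∀ {t i} {r : Vec (Fin n) t} {R} → Distinct R → Pick i r R →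
                     (d : Dec (∃ λ r → Pick i r R)) → remainder I d ≡ r
    remainder-pick R≢ q (yes (_ , q′)) = pick-unique R≢ q′ q
    remainder-pick R≢ q (no i∉R)       = ⊥-elim (i∉R (_ , q))

    -- An equality, not just a bound: proposals have a law that does not depend on M, an acceptance
    -- changes a single term of Φ, and so each term follows the recursion of `value` for its own u.
    play-value : ∀ {t} (R : Vec (Fin n) t) → Distinct R → ∀ M → Unmatched M R →
                 uniformOrdering R (gain I (drawn I) (play I R M)) ≈ Φ R M
    play-value {zero}  R R≢ M M∌R = sym (sum-zero {f = λ u → vacant (lookup M u) * 0#} λ u → zeroʳ _)
    play-value {suc t} R R≢ M M∌R = begin-equality
      N ⁻¹ * pickSum (λ i r → uniformOrdering r λ π → drawn I i λ b →
        gainSession I (drawn I) (response i (remainder I (pick? i R)) b) π) R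
        ≈⟨ *-congˡ (pickSum-cong R λ {i} {r} q → trans
             (reflexive (≡.cong (λ r′ → uniformOrdering r λ π → drawn I i λ b → gainSession I (drawn I) (response i r′ b) π)
               (remainder-pick R≢ q (pick? i R))))
             (arrival-value (proj₁ (pick-distinct q R≢)) (proj₁ (pick-All q M∌R)) (proj₂ (pick-All q M∌R))
               (play-value r (proj₂ (pick-distinct q R≢))))) ⟩
      N ⁻¹ * pickSum (λ i r → sum λ u → vacant (lookup M u) * Rewards.h (rewards I u) i (V I u r)) R
        ≈⟨ *-congˡ (Linear-pickSum sum-linear (λ u i r → vacant (lookup M u) * Rewards.h (rewards I u) i (V I u r)) R) ⟨
      N ⁻¹ * sum (λ u → pickSum (λ i r → vacant (lookup M u) * Rewards.h (rewards I u) i (V I u r)) R)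
        ≈⟨ *-distribˡ-sum (N ⁻¹) (λ u → pickSum (λ i r → vacant (lookup M u) * Rewards.h (rewards I u) i (V I u r)) R) ⟩
      sum (λ u → N ⁻¹ * pickSum (λ i r → vacant (lookup M u) * Rewards.h (rewards I u) i (V I u r)) R)
        ≈⟨ sum-cong-≋ (λ u → trans (*-congˡ (pickSum-scale (vacant (lookup M u)) _ R)) (*-swap (N ⁻¹) _ _)) ⟩
      Φ R M ∎
      where
      N = fromℕ (suc t)
      response : ∀ i (r : Vec (Fin n) t) b → Session I t i b [] M
      response i r b = session I (play I r) r i b M

    -- Comparison with the optimum

    types-resample : ∀ i f → types I f ≈ drawn I i λ b → types I λ τ → f (τ [ i ]≔ b)
    types-resample = independent-resample (expectation-law ∘ D)

    -- `y` is conditioned on the type of v_i; drawing that type restores the full law of τ.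
    W≈types : ∀ u i → Rewards.W (rewards I u) i ≈ types I λ τ → w u (lookup τ i) * matches I τ (edge u i)
    W≈types u i = sym (trans (types-resample i _) (Law.cong (drawn-law I i) λ b → begin-equality
      types I (λ τ → w u (lookup (τ [ i ]≔ b) i) * matches I (τ [ i ]≔ b) (edge u i))
        ≈⟨ Law.cong (law I) (λ τ → *-congʳ (reflexive (≡.cong (w u) (Vec.lookup∘update i τ b)))) ⟩
      types I (λ τ → w u b * matches I (τ [ i ]≔ b) (edge u i))
        ≈⟨ Law.scale (law I) (w u b) _ ⟩
      w u b * y I i b u
        ≈⟨ *-comm (w u b) (y I i b u) ⟩
      y I i b u * w u b ∎))

    ∑W≈OPT : sum (λ u → sum (Rewards.W (rewards I u))) ≈ OPT I
    ∑W≈OPT = begin-equality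
      sum (λ u → sum (Rewards.W (rewards I u)))
        ≈⟨ sum-cong-≋ (λ u → sum-cong-≋ (W≈types u)) ⟩
      sum (λ u → sum λ i → types I λ τ → w u (lookup τ i) * matches I τ (edge u i))
        ≈⟨ sum-cong-≋ (λ u → Linear-sum (Law.linear (law I)) λ i τ → w u (lookup τ i) * matches I τ (edge u i)) ⟨
      sum (λ u → types I λ τ → sum λ i → w u (lookup τ i) * matches I τ (edge u i))
        ≈⟨ Linear-sum (Law.linear (law I)) (λ u τ → sum λ i → w u (lookup τ i) * matches I τ (edge u i)) ⟨
      types I (λ τ → sum λ u → sum λ i → w u (lookup τ i) * matches I τ (edge u i))
        ≈⟨ Law.cong (law I) (λ τ → trans (OPTᴳ≈matches I τ)
             (Linear-edges (matches-linear I τ) λ (u , i) → w u (lookup τ i))) ⟨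
      OPT I ∎

    -- Drawing the type of v_i turns x into the probability that the optimum matches u to v_i, and
    -- for every τ the optimum matches u at most once.
    ∑x≤1 : ∀ u → sum (Rewards.x (rewards I u)) ≤ 1#
    ∑x≤1 u = begin
      sum (λ i → drawn I i λ b → y I i b u)
        ≈⟨ sum-cong-≋ (λ i → types-resample i λ τ → matches I τ (edge u i)) ⟨
      sum (λ i → types I λ τ → matches I τ (edge u i))
        ≈⟨ Linear-sum (Law.linear (law I)) (λ i τ → matches I τ (edge u i)) ⟨
      types I (λ τ → sum λ i → matches I τ (edge u i))
        ≤⟨ Law.mono (law I) (λ τ → ≤-trans (≤-reflexive (Linear-row (matches-linear I τ) u)) (matches-row≤1 I τ u)) ⟩
      types I (λ _ → 1#)
        ≈⟨ Law.total (law I) 1# ⟩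
      1# ∎

    0≤W : ∀ u i → 0# ≤ Rewards.W (rewards I u) i
    0≤W u i = ≤-trans (≤-reflexive (sym (Law.total (drawn-law I i) 0#)))
      (Law.mono (drawn-law I i) λ b → *-nonneg (0≤y I i b u) (w-nonneg u b))

    sum-allFin : ∀ {n} (g : Fin n → Carrier) → sum (g ∘ lookup (Vec.allFin n)) ≈ sum g
    sum-allFin g = sum-cong-≋ λ i → reflexive (≡.cong g (Vec.lookup-allFin i))

    order : Vec (Fin n) n
    order = Vec.allFin n

    strategy : Online I n emptyMatching
    strategy = play I order emptyMatching

    strategy-value : randomOrderValue I strategy ≈ sum λ u → V I u order
    strategy-value = begin-equality
      randomOrderValue I strategy
        ≈⟨ randomOrderValue≈gain I strategy ⟩
      uniformPermutation n (gain I (drawn I) strategy)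
        ≈⟨ uniformPermutation≈uniformOrdering n _ ⟩
      uniformOrdering order (gain I (drawn I) strategy)
        ≈⟨ play-value order (allFin-distinct n) emptyMatching (VecAll.lookup⁻ λ _ → empty-unmatched) ⟩
      Φ order emptyMatching
        ≈⟨ sum-cong-≋ (λ u → trans (*-congʳ (reflexive (≡.cong vacant (Vec.lookup-replicate u nothing)))) (*-identityˡ (V I u order))) ⟩
      sum (λ u → V I u order) ∎
      where
      empty-unmatched : ∀ {j} u → lookup (emptyMatching {m} {n}) u ≢ just j
      empty-unmatched u eq with ≡.trans (≡.sym (Vec.lookup-replicate u nothing)) eq
      ... | ()

    competitive : (1# - e ⁻¹) * OPT I ≤ randomOrderValue I strategy
    competitive = begin
      (1# - e ⁻¹) * OPT I
        ≈⟨ *-congˡ ∑W≈OPT ⟨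
      (1# - e ⁻¹) * sum (λ u → sum (Rewards.W (rewards I u)))
        ≈⟨ *-distribˡ-sum (1# - e ⁻¹) (λ u → sum (Rewards.W (rewards I u))) ⟩
      sum (λ u → (1# - e ⁻¹) * sum (Rewards.W (rewards I u)))
        ≈⟨ sum-cong-≋ (λ u → *-congˡ (sum-allFin (Rewards.W (rewards I u)))) ⟨
      sum (λ u → (1# - e ⁻¹) * sum (Rewards.W (rewards I u) ∘ lookup order))
        ≤⟨ sum-mono-≤ (λ u → value-bound (rewards I u) order (0≤W u)
             (≤-trans (≤-reflexive (sum-allFin (Rewards.x (rewards I u)))) (∑x≤1 u))) ⟩
      sum (λ u → V I u order)
        ≈⟨ strategy-value ⟨
      randomOrderValue I strategy ∎

corollary5p6 : (ℝ : Reals) →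
    let open RealNumbers ℝ
        open Matching ℝ
    in  ∃ λ (A : OnlineAlgorithm) → ∀ (I : Input) →
          (1# - e ⁻¹) * OPT I ≤ randomOrderValue I (A I)
corollary5p6 ℝ = strategy ℝ , competitive ℝ
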